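{- For any coprime positive integers $m,n$ and any integer $k\ge1$, $$q^{(km-1)(kn-1)/2+(k-1)/2}\;Q^s_{km,kn}\,(-1)^{kn}\;=\;\frac{[k]_q}{[km]_q}\,e_{kn}\big[X[km]_q\big],$$ where $Q^s_{km,kn}$ is applied to the constant symmetric function $(-1)^{kn}$.
   Context: Let $\Lambda$ be the ring of symmetric functions in the infinite alphabet $X=x_1+x_2+\cdots$ with coefficients in $\mathbb{Q}(q)$. Plethystic notation: for a formal expression $E$, $p_k[E]$ is obtained from $E$ by replacing every variable (including $q$ and an auxiliary variable $z$) by its $k$-th power; for $F\in\Lambda$, $F[E]$ is obtained by writing $F$ in power sums and substituting $p_k\mapsto p_k[E]$ (so $e_{kn}[X[km]_q]$ is $e_{kn}$ evaluated at the alphabet $\{q^jx_i: 0\le j\le km-1,\ i\ge1\}$). Set $\Omega[E]=\exp(\sum_{k\ge1}p_k[E]/k)$. For an integer $u$ put $[u]_q=(1-q^u)/(1-q)$; set $t=1/q$, $[u]_t=(1-q^{ -u})/(1-q^{ -1})$, $M=(1-t)(1-q)$. For integers $u,v$ let $D_{u,v}F[X]=F[X+M[u]_q/z]\,\Omega[-z[u]_tX]\big|_{z^v}$. With $[A,B]=AB-BA$: for coprime positive $m,n$, $Q^s_{1,n}=D_{1,n}$ (also $Q^s_{1,0}=D_{1,0}$); if $m\ge2$, with $(a,b)$ the unique integer pair with $1\le a\le m-1$ and $na-mb=1$, $Q^s_{m,n}=\frac1M[Q^s_{m-a,n-b},Q^s_{a,b}]$. For $k\ge2$ and coprime positive $m,n$,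 $Q^s_{km,kn}=\frac1M[Q^s_{km-a,kn-b},Q^s_{a,b}]$ for any integer pair $(a,b)$ with $1\le a\le km-1$ and $na-mb=1$ (independent of the choice). These are the specializations at $t=1/q$ of the Burban–Schiffmann operators $Q_{m,n}$. -}

module Defs where

open import Data.Nat as ℕ using (ℕ; zero; suc; _∸_; _⊓_; _≡ᵇ_; _≤ᵇ_; _!)
open import Data.Nat.GCD using (gcd)
import Data.Nat.DivMod as DM
open import Data.Integer as ℤ using (ℤ; +_; -[1+_]; 0ℤ; 1ℤ; -1ℤ)
open import Data.List using (List; []; _∷_; _++_; map; foldr; concatMap; length; upTo; filter)
open import Data.Nat.ListAction using (sum; product)
import Data.List.Properties as LP
open import Data.Product using (_×_; _,_)
open import Data.Bool using (Bool; true; false; if_then_else_)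
open import Relation.Nullary.Decidable using (⌊_⌋)
open import Relation.Binary.PropositionalEquality using (_≡_)

-- Laurent polynomials in q with integer coefficients (unnormalised):
-- a list of terms (c , e) standing for  c · q^e.

Laur : Set
Laur = List (ℤ × ℤ)

mono : ℤ → ℤ → Laur
mono c e = (c , e) ∷ []

constL : ℤ → Laur
constL c = mono c 0ℤ

_+L_ : Laur → Laur → Laur
p +L r = p ++ r

negL : Laur → Laur
negL p = map (λ { (c , e) → (ℤ.- c , e) }) p

_*L_ : Laur → Laur → Laur
p *L r = concatMap (λ { (c , e) → map (λ { (d , f) → (c ℤ.* d , e ℤ.+ f) }) r }) p

coeffL : Laur → ℤ → ℤ
coeffL [] e = 0ℤ
coeffL ((c , f) ∷ p) e = (if ⌊ f ℤ.≟ e ⌋ then c else 0ℤ) ℤ.+ coeffL p e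

_≈L_ : Laur → Laur → Set
p ≈L r = ∀ e → coeffL p e ≡ coeffL r e

-- Quantum integers.  qbr u e  is  [u]_q = (1-q^u)/(1-q)  evaluated at
-- q := q^e, i.e. p_e[[u]_q] (for e < 0 this gives p_{-e}[[u]_t], t = 1/q).
--   u ≥ 0 :  [u]_q = Σ_{0≤j<u} q^j ;   u < 0 :  [u]_q = - Σ_{u≤j≤-1} q^j.

qbrPos : ℕ → ℤ → Laur
qbrPos zero e = []
qbrPos (suc u) e = (1ℤ , e ℤ.* + u) ∷ qbrPos u e

qbrNeg : ℕ → ℤ → Laur
qbrNeg zero e = []
qbrNeg (suc w) e = (-1ℤ , ℤ.- (e ℤ.* + suc w)) ∷ qbrNeg w e

qbr : ℤ → ℤ → Laur
qbr (+ u) e = qbrPos u e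
qbr -[1+ w ] e = qbrNeg (suc w) e

-- The field Q(q) (here: fractions of Laurent polynomials; all denominators
-- that ever occur are nonzero).  Equality is cross-multiplication.

record K : Set where
  constructor _⁄_
  field
    num : Laur
    den : Laur

_+K_ : K → K → K
(a ⁄ b) +K (c ⁄ d) = ((a *L d) +L (c *L b)) ⁄ (b *L d)

_*K_ : K → K → K
(a ⁄ b) *K (c ⁄ d) = (a *L c) ⁄ (b *L d)

negK : K → K
negK (a ⁄ b) = negL a ⁄ b

fromLaur : Laur → K
fromLaur p = p ⁄ constL 1ℤ

0K 1K : K
0K = [] ⁄ constL 1ℤ
1K = constL 1ℤ ⁄ constL 1ℤ

_≈K_ : K → K → Set
(a ⁄ b) ≈K (c ⁄ d) = (a *L d) ≈L (c *L b)

prodK : List K → K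
prodK = foldr _*K_ 1K

sumK : List K → K
sumK = foldr _+K_ 0K

-- M = (1-t)(1-q), t = 1/q
Mlaur : Laur
Mlaur = ((1ℤ , 0ℤ) ∷ (-1ℤ , -1ℤ) ∷ []) *L ((1ℤ , 0ℤ) ∷ (-1ℤ , 1ℤ) ∷ [])

invM : K
invM = constL 1ℤ ⁄ Mlaur

-- Symmetric functions over Q(q), in the power-sum basis.
-- A partition is a weakly decreasing list of positive integers; a symmetric
-- function is a finite formal sum of terms  c · p_λ.

insertP : ℕ → List ℕ → List ℕ
insertP x [] = x ∷ []
insertP x (y ∷ ys) = if y ≤ᵇ x then x ∷ y ∷ ys else y ∷ insertP x ys

-- p_λ · p_μ = p_{λ ∪ μ}
mergeP : List ℕ → List ℕ → List ℕ
mergeP xs ys = foldr insertP ys xs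

Sym : Set
Sym = List (K × List ℕ)

_+S_ : Sym → Sym → Sym
F +S G = F ++ G

scaleS : K → Sym → Sym
scaleS c F = map (λ { (d , mu) → (c *K d , mu) }) F

negS : Sym → Sym
negS F = scaleS (negK 1K) F

_*S_ : Sym → Sym → Sym
F *S G = concatMap (λ { (c , mu) → map (λ { (d , nu) → (c *K d , mergeP mu nu) }) G }) F

constS : K → Sym
constS c = (c , []) ∷ []

coeffS : Sym → List ℕ → K
coeffS [] mu = 0K
coeffS ((c , nu) ∷ F) mu = (if ⌊ LP.≡-dec ℕ._≟_ nu mu ⌋ then c else 0K) +K coeffS F mu

_≈S_ : Sym → Sym → Set
F ≈S G = ∀ mu → coeffS F mu ≈K coeffS G mu

partsB : ℕ → ℕ → ℕ → List (List ℕ)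
partsB f zero mx = [] ∷ []
partsB zero (suc n) mx = []
partsB (suc f) (suc n) mx =
  concatMap (λ p → map (p ∷_) (partsB f (suc n ∸ p) p)) (map suc (upTo (mx ⊓ suc n)))

partitions : ℕ → List (List ℕ)
partitions n = partsB n n n

mult : ℕ → List ℕ → ℕ
mult i mu = length (filter (λ x → x ℕ.≟ i) mu)

zee : List ℕ → ℕ
zee mu = product (map (λ i → (i ℕ.^ mult i mu) ℕ.* (mult i mu) !) (map suc (upTo (sum mu))))

invZee : List ℕ → K
invZee mu = constL 1ℤ ⁄ constL (+ zee mu)

-- Plethysm with a scalar multiple of the alphabet: if  p_i[A X] = a i · p_i,
--   h_j[A X] = Σ_{μ ⊢ j} z_μ^{-1} p_μ[A X],
--   e_j[A X] = Σ_{μ ⊢ j} (-1)^{j-ℓ(μ)} z_μ^{-1} p_μ[A X].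
hPl : ℕ → (ℕ → K) → Sym
hPl j a = map (λ mu → (invZee mu *K prodK (map a mu) , mu)) (partitions j)

signK : ℕ → K
signK j = fromLaur (constL (-1ℤ ℤ.^ j))

ePl : ℕ → (ℕ → K) → Sym
ePl j a = map (λ mu → ((signK (j ∸ length mu) *K invZee mu) *K prodK (map a mu) , mu)) (partitions j)

-- The operators D_{u,v} F = F[X + M[u]_q / z] Ω[-z[u]_t X] |_{z^v}.
-- p_k[X + M[u]_q/z] = p_k + p_k[M[u]_q] z^{-k}, and Ω[-z[u]_t X] = Σ_j z^j h_j[-[u]_t X],
-- with p_i[-[u]_t X] = - p_i[[u]_t] p_i.

Op : Set
Op = Sym → Sym

-- p_k[M[u]_q] = (1-q^{-k})(1-q^k) [u]_{q^k}
pkMu : ℤ → ℕ → K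
pkMu u k = fromLaur ((((1ℤ , 0ℤ) ∷ (-1ℤ , ℤ.- (+ k)) ∷ []) *L ((1ℤ , 0ℤ) ∷ (-1ℤ , + k) ∷ [])) *L qbr u (+ k))

-- coefficient a i with p_i[-[u]_t X] = a i · p_i
minusUt : ℤ → ℕ → K
minusUt u i = negK (fromLaur (qbr u (ℤ.- (+ i))))

-- all ways to split the parts of λ into (parts carrying z^{-k}, remaining parts)
splits : List ℕ → List (List ℕ × List ℕ)
splits [] = ([] , []) ∷ []
splits (x ∷ xs) = concatMap (λ { (S , R) → (x ∷ S , R) ∷ (S , x ∷ R) ∷ [] }) (splits xs)

hPart : ℤ → ℤ → K → List ℕ → Sym
hPart u (+ j) c R = ((c , R) ∷ []) *S hPl j (minusUt u)
hPart u -[1+ _ ] c R = []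

D : ℤ → ℤ → Op
D u v F = concatMap (λ { (c , lam) →
            concatMap (λ { (S , R) → hPart u (v ℤ.+ + sum S) (c *K prodK (map (pkMu u) S)) R })
                      (splits lam) }) F

comm : Op → Op → Op
comm A B F = A (B F) +S negS (B (A F))

-- Q^s_{m,n}.  With d = gcd(m,n), m = d m', n = d n': if m = 1, Q^s_{1,n} = D_{1,n};
-- otherwise Q^s_{m,n} = (1/M) [Q^s_{m-a,n-b}, Q^s_{a,b}] where a is the least
-- integer in [1, m'] with n' a ≡ 1 (mod m') and b = (n' a - 1)/m', so
-- n' a - m' b = 1 and 1 ≤ a ≤ m-1.  (For d = 1 this is the unique such pair;
-- for d ≥ 2 it is one admissible choice.)  First argument = fuel (≥ m).

_div_ : ℕ → ℕ → ℕ
x div zero = 0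
x div suc y = DM._/_ x (suc y)

_mod_ : ℕ → ℕ → ℕ
x mod zero = x
x mod suc y = DM._%_ x (suc y)

findA : ℕ → ℕ → ℕ
findA m' n' = go (map suc (upTo m'))
  where
  go : List ℕ → ℕ
  go [] = 1
  go (a ∷ as) = if ((n' ℕ.* a) mod m') ≡ᵇ (1 mod m') then a else go as

QsF : ℕ → ℕ → ℕ → Op
QsF zero m n = λ F → []
QsF (suc f) m n =
  if m ≤ᵇ 1 then D (+ 1) (+ n)
  else (λ F → scaleS invM (comm (QsF f (m ∸ a) (n ∸ b)) (QsF f a b) F))
  where
  g  = gcd m n
  m' = m div g
  n' = n div g
  a  = findA m' n'
  b  = ((n' ℕ.* a) ∸ 1) div m'

Qs : ℕ → ℕ → Op
Qs m n = QsF m m n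

qpow : ℕ → K
qpow e = fromLaur (mono 1ℤ (+ e))

-- exponent (km-1)(kn-1)/2 + (k-1)/2, written as ((km-1)(kn-1) + (k-1)) / 2
-- (the numerator k(kmn - m - n + 1) is always even for coprime m, n)
expo : ℕ → ℕ → ℕ → ℕ
expo m n k = (((k ℕ.* m ∸ 1) ℕ.* (k ℕ.* n ∸ 1)) ℕ.+ (k ∸ 1)) div 2

qint : ℕ → K
qint u = fromLaur (qbr (+ u) 1ℤ)

_÷K_ : K → K → K
(a ⁄ b) ÷K (c ⁄ d) = (a *L d) ⁄ (b *L c)

lhsI3 : ℕ → ℕ → ℕ → Sym
lhsI3 m n k = scaleS (qpow (expo m n k)) (Qs (k ℕ.* m) (k ℕ.* n) (constS (signK (k ℕ.* n))))

-- right-hand side: [k]_q/[km]_q e_{kn}[X [km]_q], using p_i[X[km]_q] = [km]_{q^i} p_i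
rhsI3 : ℕ → ℕ → ℕ → Sym
rhsI3 m n k = scaleS (qint k ÷K qint (k ℕ.* m)) (ePl (k ℕ.* n) (λ i → fromLaur (qbr (+ (k ℕ.* m)) (+ i))))

{-# OPTIONS --safe #-}
module Submission where

-- At t = 1/q the operators D_{u,a} close under commutators up to scalars:
--   [D_{u,a}, D_{v,b}] = - (1-q^u)(1-q^v)/(1-q^{u+v}) (q^{ub} - q^{va}) D_{u+v,a+b}.
-- Hence, by induction on m, Q^s_{m,n} = q^c [g]_q/[m]_q D_{m,n} with g = gcd(m,n) and
-- 2c = (m-1)(n+1) - (g-1); applied to 1, D_{m,n} gives h_n[-[m]_t X], which is e_n[X[m]_q]
-- up to a sign and a power of q.
-- For the commutator, D_{u,a} p_k = p_k D_{u,a} + p_k[M[u]_q] D_{u,a+k} reduces the claim to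
-- the constant 1, that is to D_{u,a} h_b[-[v]_t X] - D_{v,b} h_a[-[u]_t X]. Both sides satisfy
-- the same Newton-type recursion in the total degree a + b, so it remains to compare them in
-- degree 0, where they are the coefficients of (1-x)(1-q^{u-v}x)/((1-q^u x)(1-q^{-v}x)).
-- Symmetric functions are studied through the functionals φ on monomials p_λ; operators then
-- act on φ by transposition, and every identity is one between scalars.

open import Defs
open import Algebra.Bundles using (CommutativeRing; RawRing)
open import Algebra.Solver.Ring.AlmostCommutativeRing using (fromCommutativeRing; _-Raw-AlmostCommutative⟶_)
open import Data.Bool.Base using (Bool; true; false; T; if_then_else_)
open import Data.Integer.Base as ℤ using (ℤ; +_; -[1+_]; _⊖_; 0ℤ; 1ℤ; -1ℤ)
import Data.Integer.Properties as ℤP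
open import Data.Integer.Tactic.RingSolver using (solve-∀)
open import Data.List.Base using (List; []; _∷_; _++_; map; concatMap; upTo; foldr; length)
open import Data.List.Membership.Propositional using (_∈_; lose)
open import Data.List.Membership.Propositional.Properties using (∈-map⁺; ∈-map⁻; ∈-upTo⁺; ∈-upTo⁻)
import Data.List.Properties as LP
open import Data.List.Relation.Unary.All as All using (All; []; _∷_)
import Data.List.Relation.Unary.All.Properties as AllP
open import Data.List.Relation.Unary.Any using (Any; here; there)
open import Data.Maybe.Base using (Maybe; just; nothing)
open import Data.Nat.Base as ℕ using (ℕ; zero; suc; _∸_; _≤_; _<_; z≤n; s≤s; _≤ᵇ_; _!; NonZero)
open import Data.Nat.Coprimality using (Coprime; coprime-Bézout; coprime-/gcd; coprime⇒gcd≡1)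
open import Data.Nat.Divisibility using (_∣_; ∣m+n∣m⇒∣n; ∣n⇒∣m*n; ∣m⇒∣m*n; ∣1⇒≡1; ∣-refl)
open import Data.Nat.DivMod using ([m+kn]%n≡m%n; %-distribˡ-*; m%n%n≡m%n; m%n<n; m<n⇒m%n≡m; m≡m%n+[m/n]*n; m*n/n≡m; m/n*n≡m; n%1≡0)
open import Data.Nat.GCD using (gcd; gcd[m,n]∣m; gcd[m,n]∣n; gcd[m,n]≢0; gcd-comm; gcd-zeroˡ; gcd-identityʳ; c*gcd[m,n]≡gcd[cm,cn]; module Bézout)
open import Data.Nat.ListAction using (sum; product)
open import Data.Nat.ListAction.Properties using (product-++; product≢0)
import Data.Nat.Properties as ℕP
open import Data.Nat.Tactic.RingSolver using () renaming (solve-∀ to solve-∀ℕ)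
open import Data.Product.Base using (_×_; _,_; proj₁; proj₂; ∃; Σ-syntax)
open import Data.Sum.Base using (_⊎_; inj₁; inj₂)
open import Data.Unit.Base using (tt)
open import Function.Base using (_∘_)
open import Level using (0ℓ; _⊔_)
open import Relation.Binary.Definitions using (tri<; tri≈; tri>)
open import Relation.Binary.PropositionalEquality as ≡ using (_≡_; _≢_)
open import Relation.Nullary.Decidable using (⌊_⌋; yes; no)
open import Relation.Nullary.Negation using (contradiction)
open import Relation.Nullary.Reflects using (ofʸ; ofⁿ)

-- In the recursion both factors of the commutator have coprime indices, and the determinant of the
-- two index vectors is g. Hence q^(ub) - q^(va) = q^(ub) (1 - q^g), which is the source of [g]_q,
-- while 1/M = -q/(1-q)^2 cancels the two numerators 1 - q. The Newton-type recursion carries the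
-- factor n = a + b and says nothing at n = 0, where a may still be any integer. There the two
-- products are expansions, at 0 and at infinity, of one rational function; their difference is what
-- produces q^(ub) - q^(va). Elements of `K` may have any denominator, even zero, so
-- cross-multiplication is not transitive on `K`, and the operators on `Sym` are not known to
-- respect `_≈S_`. The operators are therefore lifted to coefficients with cancellable denominators.
-- A lift agrees with the original literally once the cancellability proofs are forgotten, so
-- equations are needed only between lifts.

i≤∣i∣ : ∀ i → i ℤ.≤ + ℤ.∣ i ∣
i≤∣i∣ (+ n)    = ℤP.≤-refl
i≤∣i∣ -[1+ n ] = ℤ.-≤+

-- Integer multiples and finite sums in a commutative ring.

module Kit {c ℓ} (R : CommutativeRing c ℓ) where
  open CommutativeRing R renaming (Carrier to ∣R∣; zero to *-zero) public
  open import Algebra.Properties.Ring ring public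
    using (-‿distribˡ-*; -‿distribʳ-*; -‿involutive; -0#≈0#)
  open import Algebra.Properties.AbelianGroup +-abelianGroup public using (⁻¹-∙-comm)
  open import Algebra.Properties.Semiring.Mult.TCOptimised semiring using (×-homo-+; ×1-homo-*) renaming (_×_ to _×ᴿ_)
  open import Relation.Binary.Reasoning.Setoid setoid

  -- The optimised multiples let `fromℤ 0ℤ` and `fromℤ 1ℤ` reduce to `0#` and `1#`, so that the
  -- solver constants `con 0ℤ` and `con 1ℤ` stand for these directly.
  fromℤ : ℤ → ∣R∣
  fromℤ (+ n)    = n ×ᴿ 1#
  fromℤ -[1+ n ] = - (suc n ×ᴿ 1#)

  fromℤ-neg : ∀ i → fromℤ (ℤ.- i) ≈ - fromℤ i
  fromℤ-neg (+ zero)  = sym -0#≈0#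
  fromℤ-neg (+ suc n) = refl
  fromℤ-neg -[1+ n ]  = sym (-‿involutive _)

  fromℤ-⊖ : ∀ m n → fromℤ (m ⊖ n) ≈ m ×ᴿ 1# - n ×ᴿ 1#
  fromℤ-⊖ m       zero    = sym (trans (+-congˡ -0#≈0#) (+-identityʳ _))
  fromℤ-⊖ zero    (suc n) = sym (+-identityˡ _)
  fromℤ-⊖ (suc m) (suc n) = begin
    fromℤ (suc m ⊖ suc n)                        ≡⟨ ≡.cong fromℤ (ℤP.[1+m]⊖[1+n]≡m⊖n m n) ⟩
    fromℤ (m ⊖ n)                                ≈⟨ fromℤ-⊖ m n ⟩
    m ×ᴿ 1# - n ×ᴿ 1#                            ≈⟨ +-congʳ (+-identityˡ _) ⟨
    0# + m ×ᴿ 1# - n ×ᴿ 1#                       ≈⟨ +-congʳ (+-congʳ (-‿inverseʳ 1#)) ⟨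
    1# - 1# + m ×ᴿ 1# - n ×ᴿ 1#                  ≈⟨ +-congʳ (+-assoc _ _ _) ⟩
    1# + (- 1# + m ×ᴿ 1#) - n ×ᴿ 1#              ≈⟨ +-congʳ (+-congˡ (+-comm _ _)) ⟩
    1# + (m ×ᴿ 1# - 1#) - n ×ᴿ 1#                ≈⟨ +-congʳ (+-assoc _ _ _) ⟨
    1# + m ×ᴿ 1# - 1# - n ×ᴿ 1#                  ≈⟨ +-assoc _ _ _ ⟩
    1# + m ×ᴿ 1# + (- 1# - n ×ᴿ 1#)              ≈⟨ +-congˡ (⁻¹-∙-comm _ _) ⟩
    1# + m ×ᴿ 1# - (1# + n ×ᴿ 1#)                ≈⟨ +-cong (×-homo-+ 1# 1 m) (-‿cong (×-homo-+ 1# 1 n)) ⟨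
    suc m ×ᴿ 1# - suc n ×ᴿ 1#                    ∎

  fromℤ-+ : ∀ i j → fromℤ (i ℤ.+ j) ≈ fromℤ i + fromℤ j
  fromℤ-+ (+ m)    (+ n)    = ×-homo-+ 1# m n
  fromℤ-+ (+ m)    -[1+ n ] = fromℤ-⊖ m (suc n)
  fromℤ-+ -[1+ m ] (+ n)    = trans (fromℤ-⊖ n (suc m)) (+-comm _ _)
  fromℤ-+ -[1+ m ] -[1+ n ] = begin
    - (suc (suc (m ℕ.+ n)) ×ᴿ 1#)        ≡⟨ ≡.cong (λ k → - (k ×ᴿ 1#)) (ℕP.+-suc (suc m) n) ⟨
    - ((suc m ℕ.+ suc n) ×ᴿ 1#)          ≈⟨ -‿cong (×-homo-+ 1# (suc m) (suc n)) ⟩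
    - (suc m ×ᴿ 1# + suc n ×ᴿ 1#)        ≈⟨ ⁻¹-∙-comm _ _ ⟨
    - (suc m ×ᴿ 1#) - suc n ×ᴿ 1#        ∎

  private
    pos-* : ∀ m j → fromℤ (+ m ℤ.* j) ≈ fromℤ (+ m) * fromℤ j
    pos-* m (+ n) = trans (reflexive (≡.cong fromℤ (≡.sym (ℤP.pos-* m n)))) (×1-homo-* m n)
    pos-* m -[1+ n ] = begin
      fromℤ (+ m ℤ.* -[1+ n ])           ≡⟨ ≡.cong fromℤ (≡.sym (ℤP.neg-distribʳ-* (+ m) (+ suc n))) ⟩
      fromℤ (ℤ.- (+ m ℤ.* + suc n))      ≈⟨ fromℤ-neg (+ m ℤ.* + suc n) ⟩
      - fromℤ (+ m ℤ.* + suc n)          ≈⟨ -‿cong (pos-* m (+ suc n)) ⟩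
      - (fromℤ (+ m) * fromℤ (+ suc n))  ≈⟨ -‿distribʳ-* _ _ ⟩
      fromℤ (+ m) * fromℤ -[1+ n ]       ∎

  fromℤ-* : ∀ i j → fromℤ (i ℤ.* j) ≈ fromℤ i * fromℤ j
  fromℤ-* (+ m) j = pos-* m j
  fromℤ-* -[1+ m ] j = begin
    fromℤ (-[1+ m ] ℤ.* j)           ≡⟨ ≡.cong fromℤ (≡.sym (ℤP.neg-distribˡ-* (+ suc m) j)) ⟩
    fromℤ (ℤ.- (+ suc m ℤ.* j))      ≈⟨ fromℤ-neg (+ suc m ℤ.* j) ⟩
    - fromℤ (+ suc m ℤ.* j)          ≈⟨ -‿cong (pos-* (suc m) j) ⟩
    - (fromℤ (+ suc m) * fromℤ j)    ≈⟨ -‿distribˡ-* _ _ ⟩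
    fromℤ -[1+ m ] * fromℤ j         ∎

  private
    ℤ-raw : RawRing _ _
    ℤ-raw = record { Carrier = ℤ ; _≈_ = _≡_ ; _+_ = ℤ._+_ ; _*_ = ℤ._*_ ; -_ = ℤ.-_ ; 0# = 0ℤ ; 1# = 1ℤ }

    ℤ⟶R : ℤ-raw -Raw-AlmostCommutative⟶ fromCommutativeRing R
    ℤ⟶R = record
      { ⟦_⟧ = fromℤ ; +-homo = fromℤ-+ ; *-homo = fromℤ-* ; -‿homo = fromℤ-neg
      ; 0-homo = refl ; 1-homo = refl }

    fromℤ-≟ : ∀ i j → Maybe (fromℤ i ≈ fromℤ j)
    fromℤ-≟ i j with i ℤP.≟ j
    ... | yes eq = just (reflexive (≡.cong fromℤ eq))
    ... | no _   = nothing

  module Solver where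
    open import Algebra.Solver.Ring ℤ-raw (fromCommutativeRing R) ℤ⟶R fromℤ-≟ public

  infixr 8 Σ⟨_⟩
  Σ⟨_⟩ : ∀ {a} {A : Set a} → List A → (A → ∣R∣) → ∣R∣
  Σ⟨ [] ⟩ f = 0#
  Σ⟨ x ∷ xs ⟩ f = f x + Σ⟨ xs ⟩ f

  module _ {a} {A : Set a} where
    Σ-congᴬ : ∀ {f g : A → ∣R∣} {xs} → All (λ x → f x ≈ g x) xs → Σ⟨ xs ⟩ f ≈ Σ⟨ xs ⟩ g
    Σ-congᴬ []       = refl
    Σ-congᴬ (p ∷ ps) = +-cong p (Σ-congᴬ ps)

    Σ-cong : ∀ {f g : A → ∣R∣} xs → (∀ x → f x ≈ g x) → Σ⟨ xs ⟩ f ≈ Σ⟨ xs ⟩ g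
    Σ-cong xs p = Σ-congᴬ (All.universal p xs)

    Σ-0 : ∀ (xs : List A) → Σ⟨ xs ⟩ (λ _ → 0#) ≈ 0#
    Σ-0 []       = refl
    Σ-0 (x ∷ xs) = trans (+-identityˡ _) (Σ-0 xs)

    Σ-++ : ∀ (f : A → ∣R∣) xs ys → Σ⟨ xs ++ ys ⟩ f ≈ Σ⟨ xs ⟩ f + Σ⟨ ys ⟩ f
    Σ-++ f []       ys = sym (+-identityˡ _)
    Σ-++ f (x ∷ xs) ys = trans (+-congˡ (Σ-++ f xs ys)) (sym (+-assoc _ _ _))

    Σ-+ : ∀ (f g : A → ∣R∣) xs → Σ⟨ xs ⟩ (λ x → f x + g x) ≈ Σ⟨ xs ⟩ f + Σ⟨ xs ⟩ g
    Σ-+ f g []       = sym (+-identityˡ _)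
    Σ-+ f g (x ∷ xs) = trans (+-congˡ (Σ-+ f g xs))
      (solve 4 (λ a b c d → (a :+ b) :+ (c :+ d) := (a :+ c) :+ (b :+ d)) refl _ _ _ _)
      where open Solver

    *-Σ : ∀ r (f : A → ∣R∣) xs → r * Σ⟨ xs ⟩ f ≈ Σ⟨ xs ⟩ (λ x → r * f x)
    *-Σ r f []       = zeroʳ r
    *-Σ r f (x ∷ xs) = trans (distribˡ _ _ _) (+-congˡ (*-Σ r f xs))

    Σ-neg : ∀ (f : A → ∣R∣) xs → Σ⟨ xs ⟩ (λ x → - f x) ≈ - Σ⟨ xs ⟩ f
    Σ-neg f []       = sym -0#≈0#
    Σ-neg f (x ∷ xs) = trans (+-congˡ (Σ-neg f xs)) (⁻¹-∙-comm _ _)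

    Σ-map : ∀ {b} {B : Set b} (f : A → ∣R∣) (g : B → A) xs → Σ⟨ map g xs ⟩ f ≡ Σ⟨ xs ⟩ (f ∘ g)
    Σ-map f g []       = ≡.refl
    Σ-map f g (x ∷ xs) = ≡.cong (λ s → f (g x) + s) (Σ-map f g xs)

    Σ-concatMap : ∀ {b} {B : Set b} (f : A → ∣R∣) (g : B → List A) xs →
                  Σ⟨ concatMap g xs ⟩ f ≈ Σ⟨ xs ⟩ (λ x → Σ⟨ g x ⟩ f)
    Σ-concatMap f g []       = refl
    Σ-concatMap f g (x ∷ xs) = trans (Σ-++ f (g x) _) (+-congˡ (Σ-concatMap f g xs))

  Σ-swap : ∀ {a b} {A : Set a} {B : Set b} (f : A → B → ∣R∣) xs ys →
           Σ⟨ xs ⟩ (λ x → Σ⟨ ys ⟩ (f x)) ≈ Σ⟨ ys ⟩ (λ y → Σ⟨ xs ⟩ (λ x → f x y))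
  Σ-swap f []       ys = sym (Σ-0 ys)
  Σ-swap f (x ∷ xs) ys = trans (+-congˡ (Σ-swap f xs ys)) (sym (Σ-+ _ _ ys))

  Σ-upTo-suc : ∀ (f : ℕ → ∣R∣) n → Σ⟨ upTo (suc n) ⟩ f ≈ Σ⟨ upTo n ⟩ f + f n
  Σ-upTo-suc f n = begin
    Σ⟨ upTo (suc n) ⟩ f             ≡⟨ ≡.cong (λ xs → Σ⟨ xs ⟩ f) (LP.upTo-∷ʳ n) ⟨
    Σ⟨ upTo n ++ n ∷ [] ⟩ f         ≈⟨ Σ-++ f (upTo n) _ ⟩
    Σ⟨ upTo n ⟩ f + (f n + 0#)      ≈⟨ +-congˡ (+-identityʳ _) ⟩
    Σ⟨ upTo n ⟩ f + f n             ∎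

  Σ-upTo-head : ∀ (f : ℕ → ∣R∣) n → Σ⟨ upTo (suc n) ⟩ f ≈ f 0 + Σ⟨ upTo n ⟩ (f ∘ suc)
  Σ-upTo-head f n = +-congˡ (reflexive (≡.trans
    (≡.cong (λ xs → Σ⟨ xs ⟩ f) (≡.sym (LP.map-upTo suc n))) (Σ-map f suc (upTo n))))

-- A rational power series and its logarithmic derivative.

module RationalSeries {c ℓ} (R : CommutativeRing c ℓ) where
  open Kit R
  open import Relation.Binary.Reasoning.Setoid setoid
  open import Algebra.Properties.Semiring.Exp semiring public using (_^_)
  open Solver

  geo : ∣R∣ → ℕ → ∣R∣
  geo q zero    = 0#
  geo q (suc n) = geo q n + q ^ n

  geo-closed : ∀ q n → (1# - q) * geo q n ≈ 1# - q ^ n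
  geo-closed q zero    = solve 1 (λ q → (con (+ 1) :- q) :* con (+ 0) := con (+ 1) :- con (+ 1)) refl q
  geo-closed q (suc n) = begin
    (1# - q) * (geo q n + q ^ n)             ≈⟨ distribˡ _ _ _ ⟩
    (1# - q) * geo q n + (1# - q) * q ^ n    ≈⟨ +-congʳ (geo-closed q n) ⟩
    1# - q ^ n + (1# - q) * q ^ n            ≈⟨ solve 2 (λ q x → con (+ 1) :- x :+ (con (+ 1) :- q) :* x := con (+ 1) :- q :* x) refl q (q ^ n) ⟩
    1# - q ^ suc n                           ∎

  -- The quotient (p^n - r^n)/(p - r), formed without the division, just as `geo` is (1 - q^n)/(1 -
  -- q).
  mix : ∣R∣ → ∣R∣ → ℕ → ∣R∣
  mix p r zero    = 0#
  mix p r (suc n) = p * mix p r n + r ^ n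

  mix-suc : ∀ p r n → mix p r (suc n) ≈ r * mix p r n + p ^ n
  mix-suc p r zero    = solve 2 (λ p r → p :* con (+ 0) :+ con (+ 1) := r :* con (+ 0) :+ con (+ 1)) refl p r
  mix-suc p r (suc n) = begin
    p * mix p r (suc n) + r * r ^ n                 ≈⟨ +-congʳ (*-congˡ (mix-suc p r n)) ⟩
    p * (r * mix p r n + p ^ n) + r * r ^ n         ≈⟨ solve 5 (λ p r m P Q → p :* (r :* m :+ P) :+ r :* Q := r :* (p :* m :+ Q) :+ p :* P) refl p r (mix p r n) (p ^ n) (r ^ n) ⟩
    r * (p * mix p r n + r ^ n) + p * p ^ n         ∎

  mix-sym : ∀ p r n → mix p r n ≈ mix r p n
  mix-sym p r zero    = refl
  mix-sym p r (suc n) = trans (mix-suc p r n) (+-congʳ (*-congˡ (mix-sym p r n)))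

  mix-closed : ∀ p r n → (p - r) * mix p r n ≈ p ^ n - r ^ n
  mix-closed p r zero    = solve 2 (λ p r → (p :- r) :* con (+ 0) := con (+ 1) :- con (+ 1)) refl p r
  mix-closed p r (suc n) = begin
    (p - r) * (p * mix p r n + r ^ n)
      ≈⟨ solve 4 (λ p r m Q → (p :- r) :* (p :* m :+ Q) := p :* ((p :- r) :* m) :+ (p :- r) :* Q) refl p r (mix p r n) (r ^ n) ⟩
    p * ((p - r) * mix p r n) + (p - r) * r ^ n
      ≈⟨ +-congʳ (*-congˡ (mix-closed p r n)) ⟩
    p * (p ^ n - r ^ n) + (p - r) * r ^ n
      ≈⟨ solve 4 (λ p r P Q → p :* (P :- Q) :+ (p :- r) :* Q := p :* P :- r :* Q) refl p r (p ^ n) (r ^ n) ⟩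
    p ^ suc n - r ^ suc n ∎

  -- The coefficient of x^k in x F'/F for F = (1 - x)(1 - p r x)/((1 - p x)(1 - r x)): the logarithm
  -- gives p^k + r^k - 1 - (p r)^k, which factors.
  σ : ∣R∣ → ∣R∣ → ℕ → ∣R∣
  σ p r k = - ((1# - p ^ k) * (1# - r ^ k))

  σ-sym : ∀ p r k → σ p r k ≈ σ r p k
  σ-sym p r k = -‿cong (*-comm _ _)

  -- Expanding the product in `σ` leaves a constant sum and three geometric ones. The index 0 can be
  -- kept in the range because `σ p r 0` vanishes.
  σ-Σ : ∀ p r n → Σ⟨ upTo n ⟩ (λ k → σ p r k * p ^ (n ∸ k)) ≈
        fromℤ (+ n) * p ^ n - p * geo p n + p * mix p r n - p ^ n * geo r n
  σ-Σ p r zero    = solve 1 (λ p → con (+ 0) := con (+ 0) :* con (+ 1) :- p :* con (+ 0) :+ p :* con (+ 0) :- con (+ 1) :* con (+ 0)) refl p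
  σ-Σ p r (suc n) = begin
    Σ⟨ upTo (suc n) ⟩ (λ k → σ p r k * p ^ (suc n ∸ k))
      ≈⟨ Σ-upTo-suc _ n ⟩
    Σ⟨ upTo n ⟩ (λ k → σ p r k * p ^ (suc n ∸ k)) + σ p r n * p ^ (suc n ∸ n)
      ≈⟨ +-cong (Σ-congᴬ (AllP.applyUpTo⁺₁ (λ i → i) n shift))
                (*-congˡ (trans (reflexive (≡.cong (p ^_) (ℕP.m+n∸n≡m 1 n))) (*-identityʳ p))) ⟩
    Σ⟨ upTo n ⟩ (λ k → p * (σ p r k * p ^ (n ∸ k))) + σ p r n * p
      ≈⟨ +-congʳ (trans (sym (*-Σ p _ (upTo n))) (*-congˡ (σ-Σ p r n))) ⟩
    p * (N * P - p * geo p n + p * mix p r n - P * geo r n) + σ p r n * p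
      ≈⟨ solve 7 (λ p N P Q g m g' →
           p :* (N :* P :- p :* g :+ p :* m :- P :* g') :+ (:- ((con (+ 1) :- P) :* (con (+ 1) :- Q))) :* p :=
           (con (+ 1) :+ N) :* (p :* P) :- p :* (con (+ 1) :+ p :* g) :+ p :* (p :* m :+ Q) :- p :* P :* (g' :+ Q))
           refl p N P (r ^ n) (geo p n) (mix p r n) (geo r n) ⟩
    (1# + N) * (p * P) - p * (1# + p * geo p n) + p * mix p r (suc n) - p * P * geo r (suc n)
      ≈⟨ +-congʳ (+-congʳ (+-cong (*-congʳ (sym (fromℤ-+ (+ 1) (+ n)))) (-‿cong (*-congˡ (sym geo-suc))))) ⟩
    fromℤ (+ suc n) * p ^ suc n - p * geo p (suc n) + p * mix p r (suc n) - p ^ suc n * geo r (suc n) ∎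
    where
    N = fromℤ (+ n)
    P = p ^ n
    
    geo-suc : geo p (suc n) ≈ 1# + p * geo p n
    geo-suc = begin
      geo p n + p ^ n                                   ≈⟨ solve 3 (λ p g P → g :+ P := (con (+ 1) :- p) :* g :+ (p :* g :+ P)) refl p (geo p n) P ⟩
      (1# - p) * geo p n + (p * geo p n + P)          ≈⟨ +-congʳ (geo-closed p n) ⟩
      1# - P + (p * geo p n + P)                      ≈⟨ solve 2 (λ g P → con (+ 1) :- P :+ (g :+ P) := con (+ 1) :+ g) refl (p * geo p n) P ⟩
      1# + p * geo p n                                ∎
    shift : ∀ {i} → i < n → σ p r i * p ^ (suc n ∸ i) ≈ p * (σ p r i * p ^ (n ∸ i))
    shift {i} i<n = begin
      σ p r i * p ^ (suc n ∸ i)     ≡⟨ ≡.cong (λ j → σ p r i * p ^ j) (ℕP.+-∸-assoc 1 (ℕP.<⇒≤ i<n)) ⟩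
      σ p r i * (p * p ^ (n ∸ i))   ≈⟨ solve 3 (λ x y z → x :* (y :* z) := y :* (x :* z)) refl _ _ _ ⟩
      p * (σ p r i * p ^ (n ∸ i))   ∎

  -- The expansion of (1 - x)(1 - p r x)/((1 - p x)(1 - r x)), by partial fractions.
  module Fraction (p r κ : ∣R∣) (κ-spec : κ * (p - r) ≈ - ((1# - p) * (1# - r))) where

    f : ℕ → ∣R∣
    f zero    = 1#
    f (suc n) = κ * (p ^ suc n - r ^ suc n)

    private
      -- The partial-fraction formula continued to the index 0, where it gives 0 in place of the
      -- constant term 1. The convolution with `σ` thereby loses its last term, hence the
      -- `- σ p r n` in `σ-f₀`.
      f₀ : ℕ → ∣R∣
      f₀ n = κ * (p ^ n - r ^ n)

      f-pos : ∀ {n} → 0 < n → f n ≡ f₀ n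
      f-pos (s≤s _) = ≡.refl

      σ-f₀ : ∀ n → Σ⟨ upTo n ⟩ (λ k → σ p r k * f₀ (n ∸ k)) ≈ fromℤ (+ n) * f₀ n - σ p r n
      σ-f₀ n = begin
        Σ⟨ upTo n ⟩ (λ k → σ p r k * f₀ (n ∸ k))
          ≈⟨ Σ-cong (upTo n) (λ k → solve 4 (λ s k P Q → s :* (k :* (P :- Q)) := k :* (s :* P :+ :- (s :* Q))) refl (σ p r k) κ (p ^ (n ∸ k)) (r ^ (n ∸ k))) ⟩
        Σ⟨ upTo n ⟩ (λ k → κ * (σ p r k * p ^ (n ∸ k) + - (σ p r k * r ^ (n ∸ k))))
          ≈⟨ trans (sym (*-Σ κ _ (upTo n))) (*-congˡ (trans (Σ-+ _ _ (upTo n)) (+-congˡ (Σ-neg _ (upTo n))))) ⟩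
        κ * (Σ⟨ upTo n ⟩ (λ k → σ p r k * p ^ (n ∸ k)) - Σ⟨ upTo n ⟩ (λ k → σ p r k * r ^ (n ∸ k)))
          ≈⟨ *-congˡ (+-cong (σ-Σ p r n) (-‿cong (trans (Σ-cong (upTo n) (λ k → *-congʳ (σ-sym p r k))) (σ-Σ r p n)))) ⟩
        κ * (N * P - p * gp + p * mix p r n - P * gr - (N * Q - r * gr + r * mix r p n - Q * gp))
          ≈⟨ *-congˡ (+-congˡ (-‿cong (+-congʳ (+-congˡ (*-congˡ (mix-sym r p n)))))) ⟩
        κ * (N * P - p * gp + p * m - P * gr - (N * Q - r * gr + r * m - Q * gp))
          ≈⟨ solve 9 (λ κ N P Q p r gp gr m →
               κ :* (N :* P :- p :* gp :+ p :* m :- P :* gr :- (N :* Q :- r :* gr :+ r :* m :- Q :* gp)) :=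
               N :* (κ :* (P :- Q)) :+ κ :* (((con (+ 1) :- p) :* gp :- (con (+ 1) :- r) :* gr) :+ (p :- r) :* m)
               :- κ :* (gp :* (con (+ 1) :- Q) :- gr :* (con (+ 1) :- P)))
               refl κ N P Q p r gp gr m ⟩
        N * (κ * (P - Q)) + κ * (((1# - p) * gp - (1# - r) * gr) + (p - r) * m) - κ * (gp * (1# - Q) - gr * (1# - P))
          ≈⟨ +-cong (+-congˡ (*-congˡ (+-cong (+-cong (geo-closed p n) (-‿cong (geo-closed r n))) (mix-closed p r n))))
                    (-‿cong (*-congˡ (+-cong (*-congˡ (sym (geo-closed r n))) (-‿cong (*-congˡ (sym (geo-closed p n))))))) ⟩
        N * (κ * (P - Q)) + κ * ((1# - P - (1# - Q)) + (P - Q)) - κ * (gp * ((1# - r) * gr) - gr * ((1# - p) * gp))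
          ≈⟨ solve 8 (λ κ N P Q p r gp gr →
               N :* (κ :* (P :- Q)) :+ κ :* ((con (+ 1) :- P :- (con (+ 1) :- Q)) :+ (P :- Q))
               :- κ :* (gp :* ((con (+ 1) :- r) :* gr) :- gr :* ((con (+ 1) :- p) :* gp)) :=
               N :* (κ :* (P :- Q)) :- (κ :* (p :- r)) :* (gp :* gr)) refl κ N P Q p r gp gr ⟩
        N * f₀ n - κ * (p - r) * (gp * gr)
          ≈⟨ +-congˡ (-‿cong (begin
               κ * (p - r) * (gp * gr)                    ≈⟨ *-congʳ κ-spec ⟩
               - ((1# - p) * (1# - r)) * (gp * gr)        ≈⟨ solve 4 (λ a b c d → (:- (a :* b)) :* (c :* d) := :- ((a :* c) :* (b :* d))) refl _ _ _ _ ⟩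
               - ((1# - p) * gp * ((1# - r) * gr))        ≈⟨ -‿cong (*-cong (geo-closed p n) (geo-closed r n)) ⟩
               σ p r n ∎)) ⟩
        N * f₀ n - σ p r n ∎
        where
        N = fromℤ (+ n)
        P = p ^ n
        Q = r ^ n
        gp = geo p n
        gr = geo r n
        m = mix p r n

    -- The equation x F' = F times the sum of σ_k x^k, read off coefficientwise. It is the recursion
    -- that the degree 0 values in `G-diagonal` satisfy.
    f-newton : ∀ n → fromℤ (+ n) * f n ≈ Σ⟨ upTo n ⟩ (λ k → σ p r (suc k) * f (n ∸ suc k))
    f-newton zero    = zeroˡ _
    f-newton (suc j) = begin
      N * f₀ J
        ≈⟨ solve 2 (λ x s → x := x :- s :+ s) refl (N * f₀ J) (σ p r J) ⟩
      N * f₀ J - σ p r J + σ p r J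
        ≈⟨ +-congʳ (σ-f₀ J) ⟨
      Σ⟨ upTo J ⟩ (λ k → σ p r k * f₀ (J ∸ k)) + σ p r J
        ≈⟨ +-congʳ (Σ-upTo-head (λ k → σ p r k * f₀ (J ∸ k)) j) ⟩
      σ p r 0 * f₀ J + Σ⟨ upTo j ⟩ (λ k → σ p r (suc k) * f₀ (j ∸ k)) + σ p r J
        ≈⟨ +-cong (+-congʳ (trans (*-congʳ σ-0) (zeroˡ _))) refl ⟩
      0# + Σ⟨ upTo j ⟩ (λ k → σ p r (suc k) * f₀ (j ∸ k)) + σ p r J
        ≈⟨ +-cong (trans (+-identityˡ _) (Σ-congᴬ (AllP.applyUpTo⁺₁ (λ i → i) j
             (λ {i} i<j → reflexive (≡.cong (σ p r (suc i) *_) (≡.sym (f-pos (ℕP.m<n⇒0<n∸m i<j))))))))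
             (trans (sym (*-identityʳ _)) (reflexive (≡.cong (λ i → σ p r J * f i) (≡.sym (ℕP.n∸n≡0 j))))) ⟩
      Σ⟨ upTo j ⟩ (λ k → σ p r (suc k) * f (j ∸ k)) + σ p r J * f (j ∸ j)
        ≈⟨ Σ-upTo-suc (λ k → σ p r (suc k) * f (j ∸ k)) j ⟨
      Σ⟨ upTo J ⟩ (λ k → σ p r (suc k) * f (j ∸ k)) ∎
      where
      J = suc j
      N = fromℤ (+ J)
      σ-0 : σ p r 0 ≈ 0#
      σ-0 = trans (-‿cong (trans (*-congʳ (-‿inverseʳ 1#)) (zeroˡ _))) -0#≈0#

-- Powers of q and quantum integers.

record QPower {c ℓ} (R : CommutativeRing c ℓ) : Set (c ⊔ ℓ) where
  open Kit R
  field
    x   : ℤ → ∣R∣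
    x-0 : x (+ 0) ≈ 1#
    x-+ : ∀ i j → x (i ℤ.+ j) ≈ x i * x j

module QuantumIntegers {c ℓ} (R : CommutativeRing c ℓ) (Q : QPower R) where
  open Kit R
  open QPower Q
  open import Relation.Binary.Reasoning.Setoid setoid
  open Solver

  qsum : ℕ → ℤ → ∣R∣
  qsum zero    i = 0#
  qsum (suc u) i = x (i ℤ.* + u) + qsum u i

  qsum-+ : ∀ u v i → qsum (u ℕ.+ v) i ≈ qsum u i + x (i ℤ.* + u) * qsum v i
  qsum-+ u zero i = trans (reflexive (≡.cong (λ n → qsum n i) (ℕP.+-identityʳ u)))
    (sym (trans (+-congˡ (zeroʳ _)) (+-identityʳ _)))
  qsum-+ u (suc v) i = begin
    qsum (u ℕ.+ suc v) i                              ≡⟨ ≡.cong (λ n → qsum n i) (ℕP.+-suc u v) ⟩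
    x (i ℤ.* + (u ℕ.+ v)) + qsum (u ℕ.+ v) i          ≈⟨ +-cong (trans (reflexive (≡.cong x (ℤP.*-distribˡ-+ i (+ u) (+ v)))) (x-+ _ _)) (qsum-+ u v i) ⟩
    x (i ℤ.* + u) * x (i ℤ.* + v) + (qsum u i + x (i ℤ.* + u) * qsum v i)
      ≈⟨ solve 4 (λ a b c d → a :* b :+ (c :+ a :* d) := c :+ a :* (b :+ d)) refl _ _ _ _ ⟩
    qsum u i + x (i ℤ.* + u) * qsum (suc v) i ∎

  qsum-closed : ∀ u i → (1# - x i) * qsum u i ≈ 1# - x (i ℤ.* + u)
  qsum-closed zero i = begin
    (1# - x i) * 0#          ≈⟨ zeroʳ _ ⟩
    0#                       ≈⟨ -‿inverseʳ 1# ⟨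
    1# - 1#                  ≈⟨ +-congˡ (-‿cong (trans (reflexive (≡.cong x (ℤP.*-zeroʳ i))) x-0)) ⟨
    1# - x (i ℤ.* + 0)       ∎
  qsum-closed (suc u) i = begin
    (1# - x i) * (x (i ℤ.* + u) + qsum u i)                ≈⟨ distribˡ _ _ _ ⟩
    (1# - x i) * x (i ℤ.* + u) + (1# - x i) * qsum u i     ≈⟨ +-congˡ (qsum-closed u i) ⟩
    (1# - x i) * x (i ℤ.* + u) + (1# - x (i ℤ.* + u))      ≈⟨ solve 2 (λ x Q → (con (+ 1) :- x) :* Q :+ (con (+ 1) :- Q) := con (+ 1) :- x :* Q) refl _ _ ⟩
    1# - x i * x (i ℤ.* + u)                               ≈⟨ +-congˡ (-‿cong (trans (reflexive (≡.cong x (ℤP.*-suc i (+ u)))) (x-+ _ _))) ⟨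
    1# - x (i ℤ.* + suc u)                                 ∎

  qsum-head : ∀ u i → qsum (suc u) i ≈ 1# + x i * qsum u i
  qsum-head u i = trans (qsum-+ 1 u i) (+-cong (trans (+-identityʳ _) (trans (reflexive (≡.cong x (ℤP.*-zeroʳ i))) x-0))
    (*-congʳ (reflexive (≡.cong x (ℤP.*-identityʳ i)))))

  -- Reversing the order of summation exchanges q and 1/q at the cost of one power of q. This is
  -- what carries the alphabet [m]_t over to [m]_q.
  qsum-reverse : ∀ u i → x (i ℤ.* + u) * qsum (suc u) (ℤ.- i) ≈ qsum (suc u) i
  qsum-reverse zero i = begin
    x (i ℤ.* + 0) * (x (ℤ.- i ℤ.* + 0) + 0#)   ≈⟨ *-cong (at0 i) (+-congʳ (at0 (ℤ.- i))) ⟩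
    1# * (1# + 0#)                             ≈⟨ *-identityˡ _ ⟩
    1# + 0#                                    ≈⟨ +-congʳ (at0 i) ⟨
    x (i ℤ.* + 0) + 0#                         ∎
    where
    at0 : ∀ i → x (i ℤ.* + 0) ≈ 1#
    at0 i = trans (reflexive (≡.cong x (ℤP.*-zeroʳ i))) x-0
  qsum-reverse (suc u) i = begin
    X * (Y + qsum (suc u) (ℤ.- i))                      ≈⟨ distribˡ _ _ _ ⟩
    X * Y + X * qsum (suc u) (ℤ.- i)                    ≈⟨ +-cong XY (*-congʳ (trans (reflexive (≡.cong x (ℤP.*-suc i (+ u)))) (x-+ _ _))) ⟩
    1# + x i * x (i ℤ.* + u) * qsum (suc u) (ℤ.- i)     ≈⟨ +-congˡ (trans (*-assoc _ _ _) (*-congˡ (qsum-reverse u i))) ⟩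
    1# + x i * qsum (suc u) i                           ≈⟨ qsum-head (suc u) i ⟨
    qsum (suc (suc u)) i                                ∎
    where
    X = x (i ℤ.* + suc u)
    Y = x (ℤ.- i ℤ.* + suc u)
    XY : X * Y ≈ 1#
    XY = trans (sym (x-+ _ _)) (trans (reflexive (≡.cong x (≡.trans (≡.cong (λ z → i ℤ.* + suc u ℤ.+ z)
      (≡.sym (ℤP.neg-distribˡ-* i (+ suc u)))) (ℤP.+-inverseʳ (i ℤ.* + suc u))))) x-0)

  record Weighting (sh al : ℕ → ℕ → ∣R∣) : Set ℓ where
    field
      sh-def : ∀ u k → sh u k ≈ (1# - x (ℤ.- + k)) * (1# - x (+ k)) * qsum u (+ k)
      al-def : ∀ u k → al u k ≈ - qsum u (ℤ.- + k)

  module Weights (sh al : ℕ → ℕ → ∣R∣) (def : Weighting sh al) where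
    open Weighting def

    private
      flip : ∀ u k → (ℤ.- + k) ℤ.* + u ≡ ℤ.- (+ u ℤ.* + k)
      flip u k = ≡.trans (≡.sym (ℤP.neg-distribˡ-* (+ k) (+ u))) (≡.cong ℤ.-_ (ℤP.*-comm (+ k) (+ u)))

    sh-+ : ∀ u v k → sh (u ℕ.+ v) k ≈ sh u k + x (+ u ℤ.* + k) * sh v k
    sh-+ u v k = begin
      sh (u ℕ.+ v) k                                   ≈⟨ trans (sh-def (u ℕ.+ v) k) (*-congˡ (qsum-+ u v (+ k))) ⟩
      C * (qsum u (+ k) + x (+ k ℤ.* + u) * qsum v (+ k))
        ≈⟨ solve 4 (λ c a x b → c :* (a :+ x :* b) := c :* a :+ x :* (c :* b)) refl _ _ _ _ ⟩
      C * qsum u (+ k) + x (+ k ℤ.* + u) * (C * qsum v (+ k))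
        ≈⟨ +-cong (sym (sh-def u k)) (*-cong (reflexive (≡.cong x (ℤP.*-comm (+ k) (+ u)))) (sym (sh-def v k))) ⟩
      sh u k + x (+ u ℤ.* + k) * sh v k                ∎
      where C = (1# - x (ℤ.- + k)) * (1# - x (+ k))

    al-+ : ∀ u v k → al (u ℕ.+ v) k ≈ al u k + x (ℤ.- (+ u ℤ.* + k)) * al v k
    al-+ u v k = begin
      al (u ℕ.+ v) k                                   ≈⟨ trans (al-def (u ℕ.+ v) k) (-‿cong (qsum-+ u v (ℤ.- + k))) ⟩
      - (qsum u (ℤ.- + k) + x ((ℤ.- + k) ℤ.* + u) * qsum v (ℤ.- + k))
        ≈⟨ solve 3 (λ a x b → :- (a :+ x :* b) := :- a :+ x :* (:- b)) refl _ _ _ ⟩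
      - qsum u (ℤ.- + k) + x ((ℤ.- + k) ℤ.* + u) * (- qsum v (ℤ.- + k))
        ≈⟨ +-cong (sym (al-def u k)) (*-cong (reflexive (≡.cong x (flip u k))) (sym (al-def v k))) ⟩
      al u k + x (ℤ.- (+ u ℤ.* + k)) * al v k          ∎

    -- The shift contains M as (1 - q^(-k))(1 - q^k); one factor telescopes [u]_q and the other
    -- [v]_t, so that no quotient remains. With p = q^u and r = q^(-v) the right side is `σ p r k`.
    sh-al : ∀ u v k → sh u k * al v k ≈ - ((1# - x (+ u ℤ.* + k)) * (1# - x (ℤ.- (+ v ℤ.* + k))))
    sh-al u v k = begin
      sh u k * al v k                                  ≈⟨ *-cong (sh-def u k) (al-def v k) ⟩
      (1# - x (ℤ.- + k)) * (1# - x (+ k)) * qsum u (+ k) * (- qsum v (ℤ.- + k))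
        ≈⟨ solve 4 (λ a b x y → a :* b :* x :* (:- y) := :- ((b :* x) :* (a :* y))) refl _ _ _ _ ⟩
      - (((1# - x (+ k)) * qsum u (+ k)) * ((1# - x (ℤ.- + k)) * qsum v (ℤ.- + k)))
        ≈⟨ -‿cong (*-cong (qsum-closed u (+ k)) (qsum-closed v (ℤ.- + k))) ⟩
      - ((1# - x (+ k ℤ.* + u)) * (1# - x ((ℤ.- + k) ℤ.* + v)))
        ≡⟨ ≡.cong₂ (λ j l → - ((1# - x j) * (1# - x l))) (ℤP.*-comm (+ k) (+ u)) (flip v k) ⟩
      - ((1# - x (+ u ℤ.* + k)) * (1# - x (ℤ.- (+ v ℤ.* + k)))) ∎

-- Scalar identities, kept over an abstract ring so that the solver never unfolds fractions.
module Scalars {c ℓ} (R : CommutativeRing c ℓ) where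
  open Kit R
  open import Relation.Binary.Reasoning.Setoid setoid
  open Solver

  sub-* : ∀ c x y → c * x - c * y ≈ c * (x - y)
  sub-* = solve 3 (λ c x y → c :* x :- c :* y := c :* (x :- y)) refl

  *-swap : ∀ c x y → c * (x * y) ≈ x * (c * y)
  *-swap = solve 3 (λ c x y → c :* (x :* y) := x :* (c :* y)) refl

  -- M = (1-1/q)(1-q) = -(1-q)²/q.
  inverse-M : ∀ i q t w → w ≈ (1# - t) * (1# - q) → q * t ≈ 1# → w * i ≈ 1# → i * ((1# - q) * (1# - q)) ≈ - q
  inverse-M i q t w w≈ qt wi = begin
    i * ((1# - q) * (1# - q))
      ≈⟨ solve 2 (λ i q → i :* ((con 1ℤ :- q) :* (con 1ℤ :- q)) := :- (i :* ((q :- con 1ℤ) :* (con 1ℤ :- q)))) refl i q ⟩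
    - (i * ((q - 1#) * (1# - q)))
      ≈⟨ -‿cong (*-congˡ (*-congʳ (+-congˡ (-‿cong (sym qt))))) ⟩
    - (i * ((q - q * t) * (1# - q)))
      ≈⟨ solve 3 (λ i q t → :- (i :* ((q :- q :* t) :* (con 1ℤ :- q))) := :- (q :* ((con 1ℤ :- t) :* (con 1ℤ :- q) :* i))) refl i q t ⟩
    - (q * ((1# - t) * (1# - q) * i))
      ≈⟨ -‿cong (trans (*-congˡ (trans (*-congʳ (sym w≈)) wi)) (*-identityʳ q)) ⟩
    - q ∎

  -- Here `i` is 1/M, `δ` is 1 - q, `dU` and `dV` are 1 - q^U and 1 - q^V, `eM` is 1/(1 - q^(U+V)),
  -- `S` is q^(Ub) and `G` is q^g. The numerators of the commutator constant cancel the denominators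
  -- of the two closed forms, and its sign cancels that of 1/M.
  commutator-scalar : ∀ i δ q q₁ q₂ dU eU dV eV eM S G → i * (δ * δ) ≈ - q → dU * eU ≈ 1# → dV * eV ≈ 1# →
    i * (q₁ * δ * eU * (q₂ * δ * eV) * (- (dU * dV * eM) * (S - S * G))) ≈ q * q₁ * q₂ * S * (1# - G) * eM
  commutator-scalar i δ q q₁ q₂ dU eU dV eV eM S G iδ du dv = begin
    i * (q₁ * δ * eU * (q₂ * δ * eV) * (- (dU * dV * eM) * (S - S * G)))
      ≈⟨ solve 11 (λ i q₁ δ eU q₂ eV dU dV eM S G →
           i :* (q₁ :* δ :* eU :* (q₂ :* δ :* eV) :* (:- (dU :* dV :* eM) :* (S :- S :* G))) :=
           :- (i :* (δ :* δ)) :* (dU :* eU) :* (dV :* eV) :* (q₁ :* q₂ :* S :* (con 1ℤ :- G) :* eM)) refl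
           i q₁ δ eU q₂ eV dU dV eM S G ⟩
    - (i * (δ * δ)) * (dU * eU) * (dV * eV) * (q₁ * q₂ * S * (1# - G) * eM)
      ≈⟨ *-congʳ (*-cong (*-cong (-‿cong iδ) du) dv) ⟩
    - (- q) * 1# * 1# * (q₁ * q₂ * S * (1# - G) * eM)
      ≈⟨ solve 6 (λ q q₁ q₂ S G E → :- (:- q) :* con 1ℤ :* con 1ℤ :* (q₁ :* q₂ :* S :* G :* E) := q :* q₁ :* q₂ :* S :* G :* E) refl
           q q₁ q₂ S (1# - G) eM ⟩
    q * q₁ * q₂ * S * (1# - G) * eM ∎

  pull-scalars : ∀ i kA kB x y r E → x - y ≈ r * E →
    i * (kA * (kB * x) - kB * (kA * y)) ≈ i * (kA * kB * r) * E
  pull-scalars i kA kB x y r E eq = begin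
    i * (kA * (kB * x) - kB * (kA * y))   ≈⟨ solve 5 (λ i a b x y → i :* (a :* (b :* x) :- b :* (a :* y)) := i :* (a :* b :* (x :- y))) refl i kA kB x y ⟩
    i * (kA * kB * (x - y))               ≈⟨ *-congˡ (*-congˡ eq) ⟩
    i * (kA * kB * (r * E))               ≈⟨ solve 4 (λ i k r e → i :* (k :* (r :* e)) := i :* (k :* r) :* e) refl i (kA * kB) r E ⟩
    i * (kA * kB * r) * E                 ∎

  signed-step : ∀ {X Y P s al qb Q} → X * al ≈ - qb → Y * P ≈ s * Q → X * Y * (al * P) ≈ - s * (qb * Q)
  signed-step {X} {Y} {P} {s} {al} {qb} {Q} eq eq' = begin
    X * Y * (al * P)     ≈⟨ solve 4 (λ X Y a P → X :* Y :* (a :* P) := (X :* a) :* (Y :* P)) refl X Y al P ⟩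
    X * al * (Y * P)     ≈⟨ *-cong eq eq' ⟩
    - qb * (s * Q)       ≈⟨ solve 3 (λ q s Q → :- q :* (s :* Q) := :- s :* (q :* Q)) refl qb s Q ⟩
    - s * (qb * Q)       ∎

  neg-cancel : ∀ {s t u} → s * t ≈ u → - s * - t ≈ u
  neg-cancel {s} {t} eq = trans (solve 2 (λ s t → :- s :* :- t := s :* t) refl s t) eq

  weight : ∀ {g X z A f s B t} → X * A ≈ s * B → g * s ≈ t → g * X * (z * A * f) ≈ t * z * B * f
  weight {g} {X} {z} {A} {f} {s} {B} {t} eq eq' = begin
    g * X * (z * A * f)    ≈⟨ solve 5 (λ g X z A f → g :* X :* (z :* A :* f) := g :* (X :* A) :* (z :* f)) refl g X z A f ⟩
    g * (X * A) * (z * f)  ≈⟨ *-congʳ (trans (*-congˡ eq) (sym (*-assoc _ _ _))) ⟩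
    g * s * B * (z * f)    ≈⟨ *-congʳ (*-congʳ eq') ⟩
    t * B * (z * f)        ≈⟨ solve 4 (λ t B z f → t :* B :* (z :* f) := t :* z :* B :* f) refl t B z f ⟩
    t * z * B * f          ∎

  collect : ∀ {E c δ e g H X r S} → E * c ≈ X → δ * e ≈ r → g * X * H ≈ S → E * (c * δ * e * (g * H + 0#)) ≈ r * S
  collect {E} {c} {δ} {e} {g} {H} {X} {r} {S} Ec δe gXH = begin
    E * (c * δ * e * (g * H + 0#))   ≈⟨ solve 6 (λ E c δ e g H → E :* (c :* δ :* e :* (g :* H :+ con 0ℤ)) := (δ :* e) :* (g :* (E :* c) :* H)) refl E c δ e g H ⟩
    δ * e * (g * (E * c) * H)        ≈⟨ *-cong δe (trans (*-congʳ (*-congˡ Ec)) gXH) ⟩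
    r * S                            ∎

  drop-units : ∀ a b → a * 1# * b * 1# ≈ a * (1# * b * 1#)
  drop-units = solve 2 (λ a b → a :* con 1ℤ :* b :* con 1ℤ := a :* (con 1ℤ :* b :* con 1ℤ)) refl

  quotient : ∀ {r δ k M e dk dM} → r * M ≈ k → δ * k ≈ dk → δ * M ≈ dM → dM * e ≈ 1# → dk * e ≈ r
  quotient {r} {δ} {k} {M} {e} {dk} {dM} rM δk δM dMe = begin
    dk * e             ≈⟨ *-congʳ (trans (sym δk) (*-congˡ (sym rM))) ⟩
    δ * (r * M) * e    ≈⟨ solve 4 (λ δ r M e → δ :* (r :* M) :* e := r :* ((δ :* M) :* e)) refl δ r M e ⟩
    r * (δ * M * e)    ≈⟨ *-congˡ (trans (*-congʳ δM) dMe) ⟩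
    r * 1#             ≈⟨ *-identityʳ r ⟩
    r                  ∎

-- Insertion into partitions, multiplicities and the enumeration of partitions.

insertP-≥ : ∀ {x y} ys → y ≤ x → insertP x (y ∷ ys) ≡ x ∷ y ∷ ys
insertP-≥ {x} {y} ys y≤x with y ≤ᵇ x | ℕP.≤ᵇ-reflects-≤ y x
... | true  | _        = ≡.refl
... | false | ofⁿ y≰x = contradiction y≤x y≰x

insertP-< : ∀ {x y} ys → x < y → insertP x (y ∷ ys) ≡ y ∷ insertP x ys
insertP-< {x} {y} ys x<y with y ≤ᵇ x | ℕP.≤ᵇ-reflects-≤ y x
... | true  | ofʸ y≤x = contradiction y≤x (ℕP.<⇒≱ x<y)
... | false | _        = ≡.refl

private
  insertP-comm-< : ∀ {x y} → x < y → ∀ l → insertP x (insertP y l) ≡ insertP y (insertP x l)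
  insertP-comm-< x<y [] = ≡.trans (insertP-< [] x<y) (≡.sym (insertP-≥ [] (ℕP.<⇒≤ x<y)))
  insertP-comm-< {x} {y} x<y (z ∷ zs) with ℕP.≤-<-connex z x | ℕP.≤-<-connex z y
  ... | inj₁ z≤x | _ = begin
    insertP x (insertP y (z ∷ zs))  ≡⟨ ≡.cong (insertP x) (insertP-≥ zs (ℕP.≤-trans z≤x (ℕP.<⇒≤ x<y))) ⟩
    insertP x (y ∷ z ∷ zs)          ≡⟨ insertP-< (z ∷ zs) x<y ⟩
    y ∷ insertP x (z ∷ zs)          ≡⟨ ≡.cong (y ∷_) (insertP-≥ zs z≤x) ⟩
    y ∷ x ∷ z ∷ zs                  ≡⟨ insertP-≥ (z ∷ zs) (ℕP.<⇒≤ x<y) ⟨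
    insertP y (x ∷ z ∷ zs)          ≡⟨ ≡.cong (insertP y) (insertP-≥ zs z≤x) ⟨
    insertP y (insertP x (z ∷ zs))  ∎
    where open ≡.≡-Reasoning
  ... | inj₂ x<z | inj₁ z≤y = begin
    insertP x (insertP y (z ∷ zs))  ≡⟨ ≡.cong (insertP x) (insertP-≥ zs z≤y) ⟩
    insertP x (y ∷ z ∷ zs)          ≡⟨ insertP-< (z ∷ zs) x<y ⟩
    y ∷ insertP x (z ∷ zs)          ≡⟨ ≡.cong (y ∷_) (insertP-< zs x<z) ⟩
    y ∷ z ∷ insertP x zs            ≡⟨ insertP-≥ (insertP x zs) z≤y ⟨
    insertP y (z ∷ insertP x zs)    ≡⟨ ≡.cong (insertP y) (insertP-< zs x<z) ⟨
    insertP y (insertP x (z ∷ zs))  ∎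
    where open ≡.≡-Reasoning
  ... | inj₂ x<z | inj₂ y<z = begin
    insertP x (insertP y (z ∷ zs))  ≡⟨ ≡.cong (insertP x) (insertP-< zs y<z) ⟩
    insertP x (z ∷ insertP y zs)    ≡⟨ insertP-< (insertP y zs) x<z ⟩
    z ∷ insertP x (insertP y zs)    ≡⟨ ≡.cong (z ∷_) (insertP-comm-< x<y zs) ⟩
    z ∷ insertP y (insertP x zs)    ≡⟨ insertP-< (insertP x zs) y<z ⟨
    insertP y (z ∷ insertP x zs)    ≡⟨ ≡.cong (insertP y) (insertP-< zs x<z) ⟨
    insertP y (insertP x (z ∷ zs))  ∎
    where open ≡.≡-Reasoning

-- The list need not be sorted, since insertion only looks for the first entry that is not larger.
-- Functionals can thus be shifted by p_k and p_l in either order at every list.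
insertP-comm : ∀ x y l → insertP x (insertP y l) ≡ insertP y (insertP x l)
insertP-comm x y l with ℕP.<-cmp x y
... | tri< x<y _ _    = insertP-comm-< x<y l
... | tri≈ _ ≡.refl _ = ≡.refl
... | tri> _ _ y<x    = ≡.sym (insertP-comm-< y<x l)

insertP-top : ∀ {k} ν → All (_≤ k) ν → insertP k ν ≡ k ∷ ν
insertP-top []      _         = ≡.refl
insertP-top (x ∷ ν) (x≤k ∷ _) = insertP-≥ ν x≤k

mult-here : ∀ k ν → mult k (k ∷ ν) ≡ suc (mult k ν)
mult-here k ν = ≡.cong length (LP.filter-accept (ℕP._≟ k) ≡.refl)

mult-there : ∀ {k p} ν → p ≢ k → mult k (p ∷ ν) ≡ mult k ν
mult-there {k} ν p≢k = ≡.cong length (LP.filter-reject (ℕP._≟ k) p≢k)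

mult-insertP : ∀ {k p} ν → p ≢ k → mult k (insertP p ν) ≡ mult k ν
mult-insertP []      p≢k = mult-there [] p≢k
mult-insertP {k} {p} (x ∷ ν) p≢k with x ≤ᵇ p
... | true  = mult-there (x ∷ ν) p≢k
... | false with x ℕP.≟ k
...   | yes ≡.refl = ≡.trans (mult-here x (insertP p ν)) (≡.trans (≡.cong suc (mult-insertP ν p≢k)) (≡.sym (mult-here x ν)))
...   | no  x≢k    = ≡.trans (mult-there (insertP p ν) x≢k) (≡.trans (mult-insertP ν p≢k) (≡.sym (mult-there ν x≢k)))

mult-absent : ∀ {k ν} → All (_≢ k) ν → mult k ν ≡ 0
mult-absent []               = ≡.refl
mult-absent (_∷_ {xs = ν} p≢k ps) = ≡.trans (mult-there ν p≢k) (mult-absent ps)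

parts≤sum : ∀ μ → All (_≤ sum μ) μ
parts≤sum []      = []
parts≤sum (p ∷ μ) = ℕP.m≤m+n p (sum μ) ∷ All.map (λ q≤ → ℕP.≤-trans q≤ (ℕP.m≤n+m (sum μ) p)) (parts≤sum μ)

IsPart : ℕ → ℕ → List ℕ → Set
IsPart n m μ = All (1 ≤_) μ × All (_≤ m) μ × sum μ ≡ n

partsB-bounded : ∀ f n m → All (IsPart n m) (partsB f n m)
partsB-bounded f       zero    m = ([] , [] , ≡.refl) ∷ []
partsB-bounded zero    (suc n) m = []
partsB-bounded (suc f) (suc n) m =
  AllP.concat⁺ (AllP.map⁺ (AllP.map⁺ (All.map add (AllP.applyUpTo⁺₁ (λ i → i) (m ℕ.⊓ suc n) (λ i<l → i<l)))))
  where
  add : ∀ {i} → i < m ℕ.⊓ suc n → All (IsPart (suc n) m) (map (suc i ∷_) (partsB f (n ∸ i) (suc i)))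
  add {i} i<l = AllP.map⁺ (All.map
    (λ { (pos , bd , sm) → s≤s z≤n ∷ pos , i<m ∷ All.map (λ q≤ → ℕP.≤-trans q≤ i<m) bd
       , ≡.trans (≡.cong (suc i ℕ.+_) sm) (≡.cong suc (ℕP.m+[n∸m]≡n i≤n)) })
    (partsB-bounded f (n ∸ i) (suc i)))
    where
    i<m = ℕP.≤-trans i<l (ℕP.m⊓n≤m m (suc n))
    i≤n = ℕP.≤-pred (ℕP.≤-trans i<l (ℕP.m⊓n≤n m (suc n)))

partsB-large : ∀ f {n m} → n ≤ m → partsB f n m ≡ partsB f n n
partsB-large f       {zero}  n≤m = ≡.refl
partsB-large zero    {suc n} n≤m = ≡.refl
partsB-large (suc f) {suc n} {m} n≤m =
  ≡.cong (λ l → concatMap (λ p → map (p ∷_) (partsB f (suc n ∸ p) p)) (map suc (upTo l)))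
    (≡.trans (ℕP.m≥n⇒m⊓n≡n n≤m) (≡.sym (ℕP.⊓-idem (suc n))))

partsB-fuel : ∀ {f f'} n m → n ≤ f → n ≤ f' → partsB f n m ≡ partsB f' n m
partsB-fuel zero m _ _ = ≡.refl
partsB-fuel {suc f} {suc f'} (suc n) m (s≤s n≤f) (s≤s n≤f') =
  ≡.trans (LP.concatMap-map _ suc (upTo l))
    (≡.trans (LP.concatMap-cong (λ i → ≡.cong (map (suc i ∷_))
        (partsB-fuel (n ∸ i) (suc i) (ℕP.≤-trans (ℕP.m∸n≤m n i) n≤f) (ℕP.≤-trans (ℕP.m∸n≤m n i) n≤f'))) (upTo l))
      (≡.sym (LP.concatMap-map _ suc (upTo l))))
  where l = m ℕ.⊓ suc n

-- iz μ stands for 1/z_μ; prepending k multiplies z by k (m_k + 1).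
record PartitionWeights {c ℓ} (R : CommutativeRing c ℓ) : Set (c ⊔ ℓ) where
  open Kit R
  field
    inv      : ℕ → ∣R∣
    inv-spec : ∀ n → fromℤ (+ suc n) * inv (suc n) ≈ 1#
    iz       : List ℕ → ∣R∣
    iz-[]    : iz [] ≈ 1#
    iz-∷     : ∀ k ν → fromℤ (+ (suc k ℕ.* suc (mult (suc k) ν))) * iz (suc k ∷ ν) ≈ iz ν

-- Newton's identity for sums over partitions.

module PartitionSums {c ℓ} (R : CommutativeRing c ℓ) (PW : PartitionWeights R) where
  open Kit R
  open PartitionWeights PW
  open import Relation.Binary.Reasoning.Setoid setoid

  Fn : Set c
  Fn = List ℕ → ∣R∣

  Π⟨_⟩ : List ℕ → (ℕ → ∣R∣) → ∣R∣
  Π⟨ μ ⟩ a = foldr _*_ 1# (map a μ)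

  Σ-top : ∀ f m r g → Σ⟨ partsB (suc f) (suc m ℕ.+ r) (suc m) ⟩ g ≈
          Σ⟨ partsB (suc f) (suc m ℕ.+ r) m ⟩ g + Σ⟨ partsB f r (suc m) ⟩ (g ∘ (suc m ∷_))
  Σ-top f m r g = begin
    Σ⟨ partsB (suc f) (suc m ℕ.+ r) (suc m) ⟩ g
      ≡⟨ ≡.cong (λ l → Σ⟨ concatMap h (map suc (upTo l)) ⟩ g) (ℕP.m≤n⇒m⊓n≡m (ℕP.m≤m+n (suc m) r)) ⟩
    Σ⟨ concatMap h (map suc (upTo (suc m))) ⟩ g
      ≡⟨ ≡.cong (λ l → Σ⟨ l ⟩ g) (LP.concatMap-map h suc (upTo (suc m))) ⟩
    Σ⟨ concatMap (h ∘ suc) (upTo (suc m)) ⟩ g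
      ≈⟨ Σ-concatMap g (h ∘ suc) (upTo (suc m)) ⟩
    Σ⟨ upTo (suc m) ⟩ (λ i → Σ⟨ h (suc i) ⟩ g)
      ≈⟨ Σ-upTo-suc _ m ⟩
    Σ⟨ upTo m ⟩ (λ i → Σ⟨ h (suc i) ⟩ g) + Σ⟨ h (suc m) ⟩ g
      ≈⟨ +-cong (sym (Σ-concatMap g (h ∘ suc) (upTo m))) (reflexive last) ⟩
    Σ⟨ concatMap (h ∘ suc) (upTo m) ⟩ g + Σ⟨ partsB f r (suc m) ⟩ (g ∘ (suc m ∷_))
      ≡⟨ ≡.cong (λ l → Σ⟨ l ⟩ g + Σ⟨ partsB f r (suc m) ⟩ (g ∘ (suc m ∷_))) (LP.concatMap-map h suc (upTo m)) ⟨
    Σ⟨ concatMap h (map suc (upTo m)) ⟩ g + Σ⟨ partsB f r (suc m) ⟩ (g ∘ (suc m ∷_))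
      ≡⟨ ≡.cong (λ l → Σ⟨ concatMap h (map suc (upTo l)) ⟩ g + Σ⟨ partsB f r (suc m) ⟩ (g ∘ (suc m ∷_)))
           (≡.sym (ℕP.m≤n⇒m⊓n≡m (ℕP.≤-trans (ℕP.n≤1+n m) (ℕP.m≤m+n (suc m) r)))) ⟩
    Σ⟨ partsB (suc f) (suc m ℕ.+ r) m ⟩ g + Σ⟨ partsB f r (suc m) ⟩ (g ∘ (suc m ∷_)) ∎
    where
    h : ℕ → List (List ℕ)
    h p = map (p ∷_) (partsB f (suc m ℕ.+ r ∸ p) p)
    last : Σ⟨ h (suc m) ⟩ g ≡ Σ⟨ partsB f r (suc m) ⟩ (g ∘ (suc m ∷_))
    last = ≡.trans (≡.cong (λ s → Σ⟨ map (suc m ∷_) (partsB f s (suc m)) ⟩ g) (ℕP.m+n∸m≡n m r))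
                   (Σ-map g (suc m ∷_) (partsB f r (suc m)))

  -- The share of the parts `k` in the size of `μ`. By `iz-∷` it is also the factor by which z drops
  -- when one leading part `k` is removed.
  cnt : ℕ → List ℕ → ∣R∣
  cnt k μ = fromℤ (+ (k ℕ.* mult k μ))

  Σ-vanish : ∀ f n m k (g : Fn) → m < k ⊎ n < k → Σ⟨ partsB f n m ⟩ (λ μ → cnt k μ * g μ) ≈ 0#
  Σ-vanish f n m k g lt = trans (Σ-congᴬ (All.map vanish (partsB-bounded f n m))) (Σ-0 (partsB f n m))
    where
    absent : m < k ⊎ n < k → ∀ {μ} → IsPart n m μ → All (_≢ k) μ
    absent (inj₁ m<k) (_ , bd , _) = All.map (λ { q≤m ≡.refl → ℕP.<⇒≱ m<k q≤m }) bd
    absent (inj₂ n<k) {μ} (_ , _ , ≡.refl) = All.map (λ { q≤n ≡.refl → ℕP.<⇒≱ n<k q≤n }) (parts≤sum μ)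
    vanish : ∀ {μ} → IsPart n m μ → cnt k μ * g μ ≈ 0#
    vanish {μ} p = trans (*-congʳ {g μ} (reflexive (≡.cong (λ j → fromℤ (+ j))
      (≡.trans (≡.cong (k ℕ.*_) (mult-absent (absent lt p))) (ℕP.*-zeroʳ k))))) (zeroˡ _)

  module Weighted (a : ℕ → ∣R∣) where

    w : List ℕ → ∣R∣
    w μ = iz μ * Π⟨ μ ⟩ a

    w-here : ∀ k ν → cnt (suc k) (suc k ∷ ν) * w (suc k ∷ ν) ≈ a (suc k) * w ν
    w-here k ν = begin
      cnt (suc k) (suc k ∷ ν) * (iz (suc k ∷ ν) * (a (suc k) * Π⟨ ν ⟩ a))
        ≡⟨ ≡.cong (λ j → fromℤ (+ (suc k ℕ.* j)) * w (suc k ∷ ν)) (mult-here (suc k) ν) ⟩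
      fromℤ (+ (suc k ℕ.* suc (mult (suc k) ν))) * (iz (suc k ∷ ν) * (a (suc k) * Π⟨ ν ⟩ a))
        ≈⟨ solve 4 (λ n i x p → n :* (i :* (x :* p)) := x :* ((n :* i) :* p)) refl _ _ _ _ ⟩
      a (suc k) * (fromℤ (+ (suc k ℕ.* suc (mult (suc k) ν))) * iz (suc k ∷ ν) * Π⟨ ν ⟩ a)
        ≈⟨ *-congˡ (*-congʳ (iz-∷ k ν)) ⟩
      a (suc k) * w ν ∎
      where open Solver

    -- w (p ∷ ν) = w ν · ratio p (mult p ν): inserting a part other than p does not change the ratio.
    ratio : ℕ → ℕ → ∣R∣
    ratio p j = a p * inv (p ℕ.* suc j)

    w-∷ : ∀ k ν → w (suc k ∷ ν) ≈ w ν * ratio (suc k) (mult (suc k) ν)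
    w-∷ k ν = begin
      iz (suc k ∷ ν) * (a (suc k) * Π⟨ ν ⟩ a)
        ≈⟨ *-identityˡ _ ⟨
      1# * (iz (suc k ∷ ν) * (a (suc k) * Π⟨ ν ⟩ a))
        ≈⟨ *-congʳ (inv-spec _) ⟨
      fromℤ N * inv (suc k ℕ.* suc (mult (suc k) ν)) * (iz (suc k ∷ ν) * (a (suc k) * Π⟨ ν ⟩ a))
        ≈⟨ solve 5 (λ n v i x p → n :* v :* (i :* (x :* p)) := (n :* i) :* p :* (x :* v)) refl _ _ _ _ _ ⟩
      fromℤ N * iz (suc k ∷ ν) * Π⟨ ν ⟩ a * ratio (suc k) (mult (suc k) ν)
        ≈⟨ *-congʳ (*-congʳ (iz-∷ k ν)) ⟩
      w ν * ratio (suc k) (mult (suc k) ν) ∎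
      where open Solver
            N = + (suc k ℕ.* suc (mult (suc k) ν))

    -- The part-k component of Newton's identity: k ∂/∂p_k multiplies h by a k.
    newton-part : ∀ f f' m k r → suc k ≤ m → suc k ℕ.+ r ≤ f → r ≤ f' → ∀ (φ : Fn) →
      Σ⟨ partsB f (suc k ℕ.+ r) m ⟩ (λ μ → cnt (suc k) μ * (w μ * φ μ)) ≈
      a (suc k) * Σ⟨ partsB f' r m ⟩ (λ ν → w ν * φ (insertP (suc k) ν))
    newton-part (suc f) f' (suc m) k r k≤m (s≤s n≤f) r≤f' φ with ℕP.m≤n⇒m<n∨m≡n k≤m
    ... | inj₂ ≡.refl = begin
      Σ⟨ partsB (suc f) (suc k ℕ.+ r) (suc k) ⟩ F
        ≈⟨ Σ-top f k r F ⟩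
      Σ⟨ partsB (suc f) (suc k ℕ.+ r) k ⟩ F + Σ⟨ partsB f r (suc k) ⟩ (F ∘ (suc k ∷_))
        ≈⟨ +-congʳ (Σ-vanish (suc f) (suc k ℕ.+ r) k (suc k) (λ μ → w μ * φ μ) (inj₁ ℕP.≤-refl)) ⟩
      0# + Σ⟨ partsB f r (suc k) ⟩ (F ∘ (suc k ∷_))
        ≈⟨ +-identityˡ _ ⟩
      Σ⟨ partsB f r (suc k) ⟩ (F ∘ (suc k ∷_))
        ≡⟨ ≡.cong (λ l → Σ⟨ l ⟩ (F ∘ (suc k ∷_))) (partsB-fuel r (suc k) (ℕP.≤-trans (ℕP.m≤n+m r k) n≤f) r≤f') ⟩
      Σ⟨ partsB f' r (suc k) ⟩ (F ∘ (suc k ∷_))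
        ≈⟨ Σ-congᴬ (All.map (λ {ν} p → step ν (proj₁ (proj₂ p))) (partsB-bounded f' r (suc k))) ⟩
      Σ⟨ partsB f' r (suc k) ⟩ (λ ν → a (suc k) * (w ν * φ (insertP (suc k) ν)))
        ≈⟨ *-Σ _ _ (partsB f' r (suc k)) ⟨
      a (suc k) * Σ⟨ partsB f' r (suc k) ⟩ (λ ν → w ν * φ (insertP (suc k) ν)) ∎
      where
      F : Fn
      F μ = cnt (suc k) μ * (w μ * φ μ)
      step : ∀ ν → All (_≤ suc k) ν → F (suc k ∷ ν) ≈ a (suc k) * (w ν * φ (insertP (suc k) ν))
      step ν bd = begin
        cnt (suc k) (suc k ∷ ν) * (w (suc k ∷ ν) * φ (suc k ∷ ν))  ≈⟨ *-assoc _ _ _ ⟨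
        cnt (suc k) (suc k ∷ ν) * w (suc k ∷ ν) * φ (suc k ∷ ν)    ≈⟨ *-congʳ (w-here k ν) ⟩
        a (suc k) * w ν * φ (suc k ∷ ν)                            ≡⟨ ≡.cong (λ l → a (suc k) * w ν * φ l) (insertP-top ν bd) ⟨
        a (suc k) * w ν * φ (insertP (suc k) ν)                    ≈⟨ *-assoc _ _ _ ⟩
        a (suc k) * (w ν * φ (insertP (suc k) ν))                  ∎
    ... | inj₁ k<M@(s≤s k<m) = split (ℕP.≤-<-connex (suc m) r) (ℕP.≤-<-connex (suc m) (suc k ℕ.+ r))
      where
      M = suc m
      F G φ' : Fn
      F μ = cnt (suc k) μ * (w μ * φ μ)
      G ν = w ν * φ (insertP (suc k) ν)
      -- A largest part `M` is split off and its weight is moved into the functional; the weights of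
      -- what remains have the original form, so the recursion applies with `φ'`.
      φ' ν = ratio M (mult M ν) * φ (M ∷ ν)

      F-M : ∀ ν → F (M ∷ ν) ≈ cnt (suc k) ν * (w ν * φ' ν)
      F-M ν = *-cong
        (reflexive (≡.cong (λ j → fromℤ (+ (suc k ℕ.* j))) (mult-there ν (λ e → ℕP.<⇒≢ k<M (≡.sym e)))))
        (trans (*-congʳ (w-∷ m ν)) (*-assoc _ _ _))

      G-M : ∀ ν → w ν * φ' (insertP (suc k) ν) ≈ G (M ∷ ν)
      G-M ν = begin
        w ν * (ratio M (mult M (insertP (suc k) ν)) * φ (M ∷ insertP (suc k) ν))
          ≡⟨ ≡.cong₂ (λ j l → w ν * (ratio M j * φ l)) (mult-insertP ν (ℕP.<⇒≢ k<M)) (≡.sym (insertP-< ν k<M)) ⟩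
        w ν * (ratio M (mult M ν) * φ (insertP (suc k) (M ∷ ν)))  ≈⟨ *-assoc _ _ _ ⟨
        w ν * ratio M (mult M ν) * φ (insertP (suc k) (M ∷ ν))    ≈⟨ *-congʳ (w-∷ m ν) ⟨
        G (M ∷ ν) ∎

      IH : Σ⟨ partsB (suc f) (suc k ℕ.+ r) m ⟩ F ≈ a (suc k) * Σ⟨ partsB f' r m ⟩ G
      IH = newton-part (suc f) f' m k r k<m (s≤s n≤f) r≤f' φ

      small : r < M → Σ⟨ partsB f' r m ⟩ G ≈ Σ⟨ partsB f' r M ⟩ G
      small r<M = reflexive (≡.cong (λ l → Σ⟨ l ⟩ G)
        (≡.trans (partsB-large f' (ℕP.≤-pred r<M)) (≡.sym (partsB-large f' (ℕP.<⇒≤ r<M)))))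

      top : ∀ {n s} → M ℕ.+ s ≡ n →
            Σ⟨ partsB (suc f) n M ⟩ F ≈
            Σ⟨ partsB (suc f) n m ⟩ F + Σ⟨ partsB f s M ⟩ (λ ν → cnt (suc k) ν * (w ν * φ' ν))
      top {s = s} ≡.refl = trans (Σ-top f m s F) (+-congˡ (Σ-cong (partsB f s M) F-M))

      split : M ≤ r ⊎ r < M → M ≤ suc k ℕ.+ r ⊎ suc k ℕ.+ r < M →
              Σ⟨ partsB (suc f) (suc k ℕ.+ r) M ⟩ F ≈ a (suc k) * Σ⟨ partsB f' r M ⟩ G
      split (inj₁ M≤r) _ = large f' r≤f' (ℕP.m+[n∸m]≡n M≤r)
        where
        s = r ∸ M
        large : ∀ f' → r ≤ f' → M ℕ.+ s ≡ r → Σ⟨ partsB (suc f) (suc k ℕ.+ r) M ⟩ F ≈ a (suc k) * Σ⟨ partsB f' r M ⟩ G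
        large zero r≤0 eq = contradiction (ℕP.≤-trans M≤r r≤0) λ ()
        large (suc f') r≤f' eq = begin
          Σ⟨ partsB (suc f) (suc k ℕ.+ r) M ⟩ F
            ≈⟨ top eq' ⟩
          Σ⟨ partsB (suc f) (suc k ℕ.+ r) m ⟩ F + Σ⟨ partsB f (suc k ℕ.+ s) M ⟩ (λ ν → cnt (suc k) ν * (w ν * φ' ν))
            ≈⟨ +-cong (newton-part (suc f) (suc f') m k r k<m (s≤s n≤f) r≤f' φ)
                      (newton-part f f' M k s k≤m ks≤f s≤f' φ') ⟩
          a (suc k) * Σ⟨ partsB (suc f') r m ⟩ G + a (suc k) * Σ⟨ partsB f' s M ⟩ (λ ν → w ν * φ' (insertP (suc k) ν))
            ≈⟨ distribˡ _ _ _ ⟨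
          a (suc k) * (Σ⟨ partsB (suc f') r m ⟩ G + Σ⟨ partsB f' s M ⟩ (λ ν → w ν * φ' (insertP (suc k) ν)))
            ≈⟨ *-congˡ (+-congˡ (Σ-cong (partsB f' s M) G-M)) ⟩
          a (suc k) * (Σ⟨ partsB (suc f') r m ⟩ G + Σ⟨ partsB f' s M ⟩ (G ∘ (M ∷_)))
            ≈⟨ *-congˡ (≡.subst (λ r → Σ⟨ partsB (suc f') r M ⟩ G ≈ Σ⟨ partsB (suc f') r m ⟩ G + Σ⟨ partsB f' s M ⟩ (G ∘ (M ∷_))) eq (Σ-top f' m s G)) ⟨
          a (suc k) * Σ⟨ partsB (suc f') r M ⟩ G ∎
          where
          eq' : M ℕ.+ (suc k ℕ.+ s) ≡ suc k ℕ.+ r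
          eq' = ≡.trans (≡.sym (ℕP.+-assoc M (suc k) s)) (≡.trans (≡.cong (ℕ._+ s) (ℕP.+-comm M (suc k)))
                 (≡.trans (ℕP.+-assoc (suc k) M s) (≡.cong (suc k ℕ.+_) eq)))
          ks≤f : suc k ℕ.+ s ≤ f
          ks≤f = ℕP.≤-trans (ℕP.m≤n+m _ m) (ℕP.≤-pred (≡.subst (_≤ suc f) (≡.sym eq') (s≤s n≤f)))
          s≤f' : s ≤ f'
          s≤f' = ℕP.≤-trans (ℕP.m≤n+m s m) (ℕP.≤-pred (≡.subst (_≤ suc f') (≡.sym eq) r≤f'))
      split (inj₂ r<M) (inj₂ n<M) = begin
        Σ⟨ partsB (suc f) (suc k ℕ.+ r) M ⟩ F
          ≡⟨ ≡.cong (λ l → Σ⟨ l ⟩ F) (≡.trans (partsB-large (suc f) (ℕP.<⇒≤ n<M)) (≡.sym (partsB-large (suc f) (ℕP.≤-pred n<M)))) ⟩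
        Σ⟨ partsB (suc f) (suc k ℕ.+ r) m ⟩ F    ≈⟨ IH ⟩
        a (suc k) * Σ⟨ partsB f' r m ⟩ G         ≈⟨ *-congˡ (small r<M) ⟩
        a (suc k) * Σ⟨ partsB f' r M ⟩ G         ∎
      -- A partition that contains `M` leaves less than `suc k` for its other parts, so `suc k` does
      -- not occur and the second sum vanishes.
      split (inj₂ r<M) (inj₁ M≤n) = begin
        Σ⟨ partsB (suc f) (suc k ℕ.+ r) M ⟩ F
          ≈⟨ top (ℕP.m+[n∸m]≡n M≤n) ⟩
        Σ⟨ partsB (suc f) (suc k ℕ.+ r) m ⟩ F + Σ⟨ partsB f (suc k ℕ.+ r ∸ M) M ⟩ (λ ν → cnt (suc k) ν * (w ν * φ' ν))
          ≈⟨ +-cong IH (Σ-vanish f (suc k ℕ.+ r ∸ M) M (suc k) (λ ν → w ν * φ' ν) (inj₂ lt)) ⟩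
        a (suc k) * Σ⟨ partsB f' r m ⟩ G + 0#    ≈⟨ +-identityʳ _ ⟩
        a (suc k) * Σ⟨ partsB f' r m ⟩ G         ≈⟨ *-congˡ (small r<M) ⟩
        a (suc k) * Σ⟨ partsB f' r M ⟩ G         ∎
        where
        lt : suc k ℕ.+ r ∸ M < suc k
        lt = ℕP.+-cancelˡ-< M _ _ (≡.subst₂ _<_ (≡.sym (ℕP.m+[n∸m]≡n M≤n)) (ℕP.+-comm (suc k) M) (ℕP.+-monoʳ-< (suc k) r<M))

    -- The value of the functional `φ` at h_n[A X], where p_k[A X] = `a k` p_k. Integer degrees are
    -- needed because the recursions step below 0.
    h : ℤ → Fn → ∣R∣
    h (+ n)    φ = Σ⟨ partitions n ⟩ (λ μ → w μ * φ μ)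
    h -[1+ _ ] φ = 0#

    private
      h-⊖ : ∀ n k φ → a (suc k) * h (n ⊖ suc k) (φ ∘ insertP (suc k)) ≈
                      Σ⟨ partitions n ⟩ (λ μ → cnt (suc k) μ * (w μ * φ μ))
      h-⊖ n k φ with ℕP.≤-<-connex (suc k) n
      ... | inj₂ n<k = begin
        a (suc k) * h (n ⊖ suc k) φ'  ≡⟨ ≡.cong (λ i → a (suc k) * h i φ') (ℤP.⊖-< n<k) ⟩
        a (suc k) * h (ℤ.- + (suc k ∸ n)) φ' ≡⟨ ≡.cong (λ i → a (suc k) * h (ℤ.- + i) φ') (ℕP.+-∸-assoc 1 (ℕP.≤-pred n<k)) ⟩
        a (suc k) * 0#                ≈⟨ zeroʳ _ ⟩
        0#                            ≈⟨ Σ-vanish n n n (suc k) (λ μ → w μ * φ μ) (inj₂ n<k) ⟨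
        Σ⟨ partitions n ⟩ (λ μ → cnt (suc k) μ * (w μ * φ μ)) ∎
        where φ' = φ ∘ insertP (suc k)
      ... | inj₁ k<n = begin
        a (suc k) * h (n ⊖ suc k) φ'  ≡⟨ ≡.cong (λ i → a (suc k) * h i φ') (ℤP.⊖-≥ k<n) ⟩
        a (suc k) * Σ⟨ partsB r r r ⟩ (λ μ → w μ * φ' μ)
          ≡⟨ ≡.cong (λ l → a (suc k) * Σ⟨ l ⟩ (λ μ → w μ * φ' μ)) (partsB-large r (ℕP.m∸n≤m n (suc k))) ⟨
        a (suc k) * Σ⟨ partsB r r n ⟩ (λ μ → w μ * φ' μ)
          ≈⟨ newton-part n r n k r k<n (ℕP.≤-reflexive eq) ℕP.≤-refl φ ⟨
        Σ⟨ partsB n (suc k ℕ.+ r) n ⟩ (λ μ → cnt (suc k) μ * (w μ * φ μ))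
          ≡⟨ ≡.cong (λ j → Σ⟨ partsB n j n ⟩ (λ μ → cnt (suc k) μ * (w μ * φ μ))) eq ⟩
        Σ⟨ partitions n ⟩ (λ μ → cnt (suc k) μ * (w μ * φ μ)) ∎
        where
        φ' = φ ∘ insertP (suc k)
        r  = n ∸ suc k
        eq : suc k ℕ.+ r ≡ n
        eq = ℕP.m+[n∸m]≡n k<n

      Σ-delta : ∀ L p μ → suc p ≤ L → Σ⟨ upTo L ⟩ (λ k → cnt (suc k) (suc p ∷ μ)) ≈
                fromℤ (+ suc p) + Σ⟨ upTo L ⟩ (λ k → cnt (suc k) μ)
      Σ-delta (suc L) p μ p≤L with ℕP.m≤n⇒m<n∨m≡n p≤L
      ... | inj₂ ≡.refl = begin
        Σ⟨ upTo (suc L) ⟩ (λ k → cnt (suc k) (suc L ∷ μ))    ≈⟨ Σ-upTo-suc _ L ⟩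
        Σ⟨ upTo L ⟩ (λ k → cnt (suc k) (suc L ∷ μ)) + cnt (suc L) (suc L ∷ μ)
          ≈⟨ +-cong (Σ-congᴬ (AllP.applyUpTo⁺₁ (λ i → i) L other)) last ⟩
        Σ⟨ upTo L ⟩ (λ k → cnt (suc k) μ) + (fromℤ (+ suc L) + cnt (suc L) μ)
          ≈⟨ solve 3 (λ x y z → x :+ (y :+ z) := y :+ (x :+ z)) refl _ _ _ ⟩
        fromℤ (+ suc L) + (Σ⟨ upTo L ⟩ (λ k → cnt (suc k) μ) + cnt (suc L) μ)
          ≈⟨ +-congˡ (Σ-upTo-suc _ L) ⟨
        fromℤ (+ suc L) + Σ⟨ upTo (suc L) ⟩ (λ k → cnt (suc k) μ) ∎
        where
        open Solver
        other : ∀ {i} → i < L → cnt (suc i) (suc L ∷ μ) ≈ cnt (suc i) μ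
        other {i} i<L = reflexive (≡.cong (λ j → fromℤ (+ (suc i ℕ.* j))) (mult-there μ (λ e → ℕP.<⇒≢ (s≤s i<L) (≡.sym e))))
        last : cnt (suc L) (suc L ∷ μ) ≈ fromℤ (+ suc L) + cnt (suc L) μ
        last = trans (reflexive (≡.cong (λ j → fromℤ (+ j)) (≡.trans (≡.cong (suc L ℕ.*_) (mult-here (suc L) μ)) (ℕP.*-suc (suc L) _))))
                     (fromℤ-+ (+ suc L) (+ (suc L ℕ.* mult (suc L) μ)))
      ... | inj₁ (s≤s p<L) = begin
        Σ⟨ upTo (suc L) ⟩ (λ k → cnt (suc k) (suc p ∷ μ))    ≈⟨ Σ-upTo-suc _ L ⟩
        Σ⟨ upTo L ⟩ (λ k → cnt (suc k) (suc p ∷ μ)) + cnt (suc L) (suc p ∷ μ)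
          ≈⟨ +-cong (Σ-delta L p μ p<L)
               (reflexive (≡.cong (λ j → fromℤ (+ (suc L ℕ.* j))) (mult-there μ (ℕP.<⇒≢ (s≤s p<L))))) ⟩
        fromℤ (+ suc p) + Σ⟨ upTo L ⟩ (λ k → cnt (suc k) μ) + cnt (suc L) μ   ≈⟨ +-assoc _ _ _ ⟩
        fromℤ (+ suc p) + (Σ⟨ upTo L ⟩ (λ k → cnt (suc k) μ) + cnt (suc L) μ) ≈⟨ +-congˡ (Σ-upTo-suc _ L) ⟨
        fromℤ (+ suc p) + Σ⟨ upTo (suc L) ⟩ (λ k → cnt (suc k) μ) ∎

      Σ-cnt : ∀ L {μ} → All (1 ≤_) μ → All (_≤ L) μ → Σ⟨ upTo L ⟩ (λ k → cnt (suc k) μ) ≈ fromℤ (+ sum μ)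
      Σ-cnt L [] [] = trans (Σ-cong (upTo L) (λ k → reflexive (≡.cong (λ j → fromℤ (+ j)) (ℕP.*-zeroʳ (suc k))))) (Σ-0 (upTo L))
      Σ-cnt L (_∷_ {suc p} {μ} _ ps) (p≤ ∷ qs) = begin
        Σ⟨ upTo L ⟩ (λ k → cnt (suc k) (suc p ∷ μ))            ≈⟨ Σ-delta L p μ p≤ ⟩
        fromℤ (+ suc p) + Σ⟨ upTo L ⟩ (λ k → cnt (suc k) μ)    ≈⟨ +-congˡ (Σ-cnt L ps qs) ⟩
        fromℤ (+ suc p) + fromℤ (+ sum μ)                      ≈⟨ fromℤ-+ (+ suc p) (+ sum μ) ⟨
        fromℤ (+ (suc p ℕ.+ sum μ))                            ∎

    -- The parts of each partition of n add up to n, and `newton-part` treats the share of each part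
    -- size. The range `L` may exceed n, the further terms having negative degree; sums from
    -- different degrees can then share one range.
    newton : ∀ L n φ → n ℤ.≤ + L →
             fromℤ n * h n φ ≈ Σ⟨ upTo L ⟩ (λ k → a (suc k) * h (n ℤ.- + suc k) (φ ∘ insertP (suc k)))
    newton L -[1+ n ] φ _ = trans (zeroʳ _) (sym (trans (Σ-cong (upTo L) (λ k → zeroʳ (a (suc k)))) (Σ-0 (upTo L))))
    newton L (+ n) φ (ℤ.+≤+ n≤L) = begin
      fromℤ (+ n) * Σ⟨ partitions n ⟩ (λ μ → w μ * φ μ)
        ≈⟨ *-Σ _ _ (partitions n) ⟩
      Σ⟨ partitions n ⟩ (λ μ → fromℤ (+ n) * (w μ * φ μ))
        ≈⟨ Σ-congᴬ (All.map (λ {μ} → step μ) (partsB-bounded n n n)) ⟩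
      Σ⟨ partitions n ⟩ (λ μ → Σ⟨ upTo L ⟩ (λ k → cnt (suc k) μ * (w μ * φ μ)))
        ≈⟨ Σ-swap _ (partitions n) (upTo L) ⟩
      Σ⟨ upTo L ⟩ (λ k → Σ⟨ partitions n ⟩ (λ μ → cnt (suc k) μ * (w μ * φ μ)))
        ≈⟨ Σ-cong (upTo L) (λ k → h-⊖ n k φ) ⟨
      Σ⟨ upTo L ⟩ (λ k → a (suc k) * h (n ⊖ suc k) (φ ∘ insertP (suc k))) ∎
      where
      step : ∀ μ → IsPart n n μ → fromℤ (+ n) * (w μ * φ μ) ≈ Σ⟨ upTo L ⟩ (λ k → cnt (suc k) μ * (w μ * φ μ))
      step μ (pos , bd , sm) = begin
        fromℤ (+ n) * (w μ * φ μ)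
          ≡⟨ ≡.cong (λ j → fromℤ (+ j) * (w μ * φ μ)) sm ⟨
        fromℤ (+ sum μ) * (w μ * φ μ)
          ≈⟨ *-congʳ (Σ-cnt L pos (All.map (λ q → ℕP.≤-trans q n≤L) bd)) ⟨
        Σ⟨ upTo L ⟩ (λ k → cnt (suc k) μ) * (w μ * φ μ)
          ≈⟨ *-comm _ _ ⟩
        w μ * φ μ * Σ⟨ upTo L ⟩ (λ k → cnt (suc k) μ)
          ≈⟨ *-Σ _ _ (upTo L) ⟩
        Σ⟨ upTo L ⟩ (λ k → w μ * φ μ * cnt (suc k) μ)
          ≈⟨ Σ-cong (upTo L) (λ k → *-comm _ _) ⟩
        Σ⟨ upTo L ⟩ (λ k → cnt (suc k) μ * (w μ * φ μ)) ∎

-- Vertex operators acting on functionals.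

module VertexOperators {c ℓ} (R : CommutativeRing c ℓ) (PW : PartitionWeights R) where
  open Kit R
  open PartitionWeights PW
  open import Relation.Binary.Reasoning.Setoid setoid
  open PartitionSums R PW public
  open Weighted using (h; newton) public

  infix 4 _≋_
  _≋_ : Fn → Fn → Set ℓ
  φ ≋ ψ = ∀ μ → φ μ ≈ ψ μ

  fromℤ-cancel : ∀ n {r s} → fromℤ (+ suc n) * r ≈ fromℤ (+ suc n) * s → r ≈ s
  fromℤ-cancel n {r} {s} eq = begin
    r                                      ≈⟨ unit r ⟨
    inv (suc n) * (fromℤ (+ suc n) * r)    ≈⟨ *-congˡ eq ⟩
    inv (suc n) * (fromℤ (+ suc n) * s)    ≈⟨ unit s ⟩
    s                                      ∎
    where
    unit : ∀ r → inv (suc n) * (fromℤ (+ suc n) * r) ≈ r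
    unit r = trans (sym (*-assoc _ _ _)) (trans (*-congʳ (trans (*-comm _ _) (inv-spec n))) (*-identityˡ r))

  h-cong : ∀ a n {φ ψ} → φ ≋ ψ → h a n φ ≈ h a n ψ
  h-cong a (+ n)    eq = Σ-cong (partitions n) (λ μ → *-congˡ (eq μ))
  h-cong a -[1+ n ] eq = refl

  h-linear : ∀ a n r φ ψ → h a n (λ μ → φ μ + r * ψ μ) ≈ h a n φ + r * h a n ψ
  h-linear a -[1+ n ] r φ ψ = sym (trans (+-identityˡ _) (zeroʳ r))
  h-linear a (+ n) r φ ψ = begin
    Σ⟨ partitions n ⟩ (λ μ → w μ * (φ μ + r * ψ μ))
      ≈⟨ Σ-cong (partitions n) (λ μ → solve 4 (λ w f r g → w :* (f :+ r :* g) := w :* f :+ r :* (w :* g)) refl _ _ _ _) ⟩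
    Σ⟨ partitions n ⟩ (λ μ → w μ * φ μ + r * (w μ * ψ μ))
      ≈⟨ Σ-+ _ _ (partitions n) ⟩
    h a (+ n) φ + Σ⟨ partitions n ⟩ (λ μ → r * (w μ * ψ μ))
      ≈⟨ +-congˡ (*-Σ r _ (partitions n)) ⟨
    h a (+ n) φ + r * h a (+ n) ψ ∎
    where open Solver
          open Weighted a using (w)

  h-0 : ∀ a φ → h a (+ 0) φ ≈ φ []
  h-0 a φ = begin
    iz [] * 1# * φ [] + 0#   ≈⟨ +-identityʳ _ ⟩
    iz [] * 1# * φ []        ≈⟨ *-congʳ (trans (*-identityʳ _) iz-[]) ⟩
    1# * φ []                ≈⟨ *-identityˡ _ ⟩
    φ []                     ∎

  h-neg : ∀ a {n} φ → n ℤ.< + 0 → h a n φ ≈ 0#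
  h-neg a { -[1+ _ ]} φ _ = refl
  h-neg a {+ n} φ (ℤ.+<+ ())

  -- dt s a v is the transpose of the operator F ↦ F[X + Σ s/z] Ω[a X z] |_{z^v}, defined through
  -- the rule D_v (p_k F) = p_k D_v F + s_k D_{v+k} F.
  dt : (ℕ → ∣R∣) → (ℕ → ∣R∣) → ℤ → Fn → Fn
  dt s a v φ []       = h a v φ
  dt s a v φ (k ∷ λs) = dt s a v (φ ∘ insertP k) λs + s k * dt s a (v ℤ.+ + k) φ λs

  dt-cong : ∀ s a v {φ ψ} → φ ≋ ψ → dt s a v φ ≋ dt s a v ψ
  dt-cong s a v eq []       = h-cong a v eq
  dt-cong s a v eq (k ∷ λs) = +-cong (dt-cong s a v (eq ∘ insertP k) λs) (*-congˡ (dt-cong s a _ eq λs))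

  dt-linear : ∀ s a v r φ ψ λs → dt s a v (λ μ → φ μ + r * ψ μ) λs ≈ dt s a v φ λs + r * dt s a v ψ λs
  dt-linear s a v r φ ψ []       = h-linear a v r φ ψ
  dt-linear s a v r φ ψ (k ∷ λs) = trans
    (+-cong (dt-linear s a v r _ _ λs) (*-congˡ (dt-linear s a _ r φ ψ λs)))
    (solve 6 (λ A B C D r s → (A :+ r :* B) :+ s :* (C :+ r :* D) := (A :+ s :* C) :+ r :* (B :+ s :* D)) refl _ _ _ _ _ _)
    where open Solver

  φ-comm : ∀ (φ : Fn) k l → φ ∘ insertP k ∘ insertP l ≋ φ ∘ insertP l ∘ insertP k
  φ-comm φ k l μ = reflexive (≡.cong φ (insertP-comm k l μ))

  dt-swap : ∀ s a v φ k l λs → dt s a v φ (k ∷ l ∷ λs) ≈ dt s a v φ (l ∷ k ∷ λs)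
  dt-swap s a v φ k l λs = begin
    A + s l * B + s k * (C + s l * dt s a (v ℤ.+ + k ℤ.+ + l) φ λs)
      ≈⟨ +-cong (+-congʳ (dt-cong s a v (φ-comm φ k l) λs))
           (*-congˡ (+-congˡ (*-congˡ (reflexive (≡.cong (λ i → dt s a i φ λs) (lem v (+ k) (+ l))))))) ⟩
    A' + s l * B + s k * (C + s l * E)
      ≈⟨ solve 6 (λ A B C E k l → A :+ l :* B :+ k :* (C :+ l :* E) := A :+ k :* C :+ l :* (B :+ k :* E)) refl A' B C E (s k) (s l) ⟩
    A' + s k * C + s l * (B + s k * E) ∎
    where
    open Solver
    A  = dt s a v (φ ∘ insertP k ∘ insertP l) λs
    A' = dt s a v (φ ∘ insertP l ∘ insertP k) λs
    B  = dt s a (v ℤ.+ + l) (φ ∘ insertP k) λs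
    C  = dt s a (v ℤ.+ + k) (φ ∘ insertP l) λs
    E  = dt s a (v ℤ.+ + l ℤ.+ + k) φ λs
    lem : ∀ v k l → v ℤ.+ k ℤ.+ l ≡ v ℤ.+ l ℤ.+ k
    lem = solve-∀

  -- `dt` removes parts in list order, whereas multiplication by p_k inserts in sorted position. By
  -- `dt-swap` neighbouring parts may be exchanged, so the position is immaterial and the defining
  -- rule holds for multiplication by p_k.
  dt-insertP : ∀ s a v φ k λs → dt s a v φ (insertP k λs) ≈ dt s a v φ (k ∷ λs)
  dt-insertP s a v φ k []       = refl
  dt-insertP s a v φ k (y ∷ ys) with y ≤ᵇ k
  ... | true  = refl
  ... | false = trans (+-cong (dt-insertP s a v _ k ys) (*-congˡ (dt-insertP s a _ φ k ys))) (dt-swap s a v φ y k ys)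

  -- G a b is the functional of D_a h_b, where D has shift s and exponential a, and h_b has weights β.
  module Euler (s α β : ℕ → ∣R∣) where

    G : ℤ → ℤ → Fn → ∣R∣
    G a b φ = h β b (dt s α a φ)

    G-cong : ∀ {a a' b b' φ ψ} → a ≡ a' → b ≡ b' → φ ≋ ψ → G a b φ ≈ G a' b' ψ
    G-cong {a} {b = b} ≡.refl ≡.refl eq = h-cong β b (dt-cong s α a eq)

    -- Newton's identity writes b h_b through p_k h_(b-k); moving p_k to the left of D creates the
    -- term with `s`.
    newton-G : ∀ L a b φ → b ℤ.≤ + L → fromℤ b * G a b φ ≈
      Σ⟨ upTo L ⟩ (λ k → β (suc k) * (G a (b ℤ.- + suc k) (φ ∘ insertP (suc k)) + s (suc k) * G (a ℤ.+ + suc k) (b ℤ.- + suc k) φ))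
    newton-G L a b φ b≤L = trans (newton β L b (dt s α a φ) b≤L) (Σ-cong (upTo L) λ k → *-congˡ (trans
      (h-cong β (b ℤ.- + suc k) (dt-insertP s α a φ (suc k)))
      (h-linear β (b ℤ.- + suc k) (s (suc k)) (dt s α a (φ ∘ insertP (suc k))) (dt s α (a ℤ.+ + suc k) φ))))

    G-0 : ∀ a φ → G a (+ 0) φ ≈ h α a φ
    G-0 a φ = h-0 β (dt s α a φ)

    private
      i-suc≤i : ∀ i k → i ℤ.- + suc k ℤ.≤ i
      i-suc≤i i k = ℤP.i-j≤i i (+ suc k)

      pred≤ : ∀ {n N} k → n ≤ suc N → + n ℤ.- + suc k ℤ.≤ + N
      pred≤ {n} {N} k n≤N = ℤP.≤-trans (ℤP.+-monoˡ-≤ (ℤ.- + suc k) (ℤ.+≤+ n≤N)) (i-suc≤' N k)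
        where
        i-suc≤' : ∀ N k → suc N ⊖ suc k ℤ.≤ + N
        i-suc≤' N k = ≡.subst (ℤ._≤ + N) (≡.sym (ℤP.[1+m]⊖[1+n]≡m⊖n N k)) (ℤP.m⊖n≤m N k)

    -- In generating functions with z marking a and y marking b, applying D to the series of the h_b
    -- gives exp(Σ (α_k z^k + β_k y^k) p_k/k) times a factor that depends only on y/z. The Euler
    -- operator z d/dz + y d/dy annihilates that factor, which is why `s` does not occur on the
    -- right. `N` bounds the recursion on b.
    homogeneous : ∀ L N a b φ → b ℤ.≤ + N → b ℤ.≤ + L → a ℤ.+ b ℤ.≤ + L →
      fromℤ (a ℤ.+ b) * G a b φ ≈
      Σ⟨ upTo L ⟩ (λ k → α (suc k) * G (a ℤ.- + suc k) b (φ ∘ insertP (suc k)) + β (suc k) * G a (b ℤ.- + suc k) (φ ∘ insertP (suc k)))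
    homogeneous L N a -[1+ b ] φ _ _ _ = trans (zeroʳ _) (sym (trans
      (Σ-cong (upTo L) (λ k → trans (+-cong (zeroʳ _) (zeroʳ _)) (+-identityˡ 0#))) (Σ-0 (upTo L))))
    homogeneous L N a (+ zero) φ _ _ a≤L = begin
      fromℤ (a ℤ.+ + 0) * G a (+ 0) φ   ≈⟨ *-cong (reflexive (≡.cong fromℤ (ℤP.+-identityʳ a))) (G-0 a φ) ⟩
      fromℤ a * h α a φ                 ≈⟨ newton α L a φ (≡.subst (ℤ._≤ + L) (ℤP.+-identityʳ a) a≤L) ⟩
      Σ⟨ upTo L ⟩ (λ k → α (suc k) * h α (a ℤ.- + suc k) (φ ∘ insertP (suc k)))
        ≈⟨ Σ-cong (upTo L) (λ k → trans (+-cong (*-congˡ (G-0 (a ℤ.- + suc k) (φ ∘ insertP (suc k)))) (zeroʳ _)) (+-identityʳ _)) ⟨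
      _ ∎
    -- Multiplied by b, both sides expand by `newton-G`. The double sums agree after the exchange of
    -- k and l. The excess terms also agree: they come from a + b = k + (a + (b - k)) on the left
    -- and b = l + (b - l) on the right.
    homogeneous L (suc N) a b@(+ suc b') φ (ℤ.+≤+ b≤N) b≤L ab≤L = fromℤ-cancel b' (begin
      B * (fromℤ (a ℤ.+ b) * G a b φ)
        ≈⟨ solve 3 (λ x y z → x :* (y :* z) := y :* (x :* z)) refl _ _ _ ⟩
      fromℤ (a ℤ.+ b) * (B * G a b φ)
        ≈⟨ *-congˡ (newton-G L a b φ b≤L) ⟩
      fromℤ (a ℤ.+ b) * S (λ k → β (suc k) * (X k + s (suc k) * Y k))
        ≈⟨ *-Σ _ _ (upTo L) ⟩
      S (λ k → fromℤ (a ℤ.+ b) * (β (suc k) * (X k + s (suc k) * Y k)))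
        ≈⟨ Σ-cong (upTo L) left ⟩
      S (λ k → β (suc k) * (fromℤ (+ suc k) * X k) + S (U k))
        ≈⟨ Σ-+ _ _ (upTo L) ⟩
      S (λ k → β (suc k) * (fromℤ (+ suc k) * X k)) + S (λ k → S (U k))
        ≈⟨ +-congˡ (Σ-swap U (upTo L) (upTo L)) ⟩
      S (λ k → β (suc k) * (fromℤ (+ suc k) * X k)) + S (λ l → S (λ k → U k l))
        ≈⟨ Σ-+ _ _ (upTo L) ⟨
      S (λ l → β (suc l) * (fromℤ (+ suc l) * X l) + S (λ k → U k l))
        ≈⟨ Σ-cong (upTo L) right ⟨
      S (λ l → B * (α (suc l) * G (a ℤ.- + suc l) b (φ ∘ insertP (suc l)) + β (suc l) * X l))
        ≈⟨ *-Σ _ _ (upTo L) ⟨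
      B * S (λ l → α (suc l) * G (a ℤ.- + suc l) b (φ ∘ insertP (suc l)) + β (suc l) * X l) ∎)
      where
      open Solver
      B = fromℤ b
      S : (ℕ → ∣R∣) → ∣R∣
      S = Σ⟨ upTo L ⟩
      X Y : ℕ → ∣R∣
      X k = G a (b ℤ.- + suc k) (φ ∘ insertP (suc k))
      Y k = G (a ℤ.+ + suc k) (b ℤ.- + suc k) φ

      module _ (k l : ℕ) where
        g₁ g₂ g₃ g₄ U : ∣R∣
        g₁ = G (a ℤ.- + suc l) (b ℤ.- + suc k) (φ ∘ insertP (suc k) ∘ insertP (suc l))
        g₂ = G a (b ℤ.- + suc k ℤ.- + suc l) (φ ∘ insertP (suc k) ∘ insertP (suc l))
        g₃ = G (a ℤ.+ + suc k ℤ.- + suc l) (b ℤ.- + suc k) (φ ∘ insertP (suc l))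
        g₄ = G (a ℤ.+ + suc k) (b ℤ.- + suc k ℤ.- + suc l) (φ ∘ insertP (suc l))
        U = β (suc k) * (α (suc l) * g₁ + β (suc l) * g₂) + β (suc k) * (s (suc k) * (α (suc l) * g₃ + β (suc l) * g₄))

      eq₁ : ∀ a b k → a ℤ.+ b ≡ k ℤ.+ (a ℤ.+ (b ℤ.- k))
      eq₁ = solve-∀
      eq₂ : ∀ a b k → a ℤ.+ b ≡ (a ℤ.+ k) ℤ.+ (b ℤ.- k)
      eq₂ = solve-∀
      eq₃ : ∀ a b k → a ℤ.+ (b ℤ.- k) ≡ a ℤ.+ b ℤ.- k
      eq₃ = solve-∀
      eq₄ : ∀ a k l → a ℤ.- l ℤ.+ k ≡ a ℤ.+ k ℤ.- l
      eq₄ = solve-∀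
      eq₅ : ∀ b k l → b ℤ.- l ℤ.- k ≡ b ℤ.- k ℤ.- l
      eq₅ = solve-∀
      eq₆ : ∀ b l → b ≡ l ℤ.+ (b ℤ.- l)
      eq₆ = solve-∀

      b-k≤L : ∀ k → b ℤ.- + suc k ℤ.≤ + L
      b-k≤L k = ℤP.≤-trans (i-suc≤i b k) b≤L

      NX : ∀ k → fromℤ (a ℤ.+ b) * X k ≈ fromℤ (+ suc k) * X k + S (λ l → α (suc l) * g₁ k l + β (suc l) * g₂ k l)
      NX k = begin
        fromℤ (a ℤ.+ b) * X k
          ≡⟨ ≡.cong (λ i → fromℤ i * X k) (eq₁ a b (+ suc k)) ⟩
        fromℤ (+ suc k ℤ.+ (a ℤ.+ (b ℤ.- + suc k))) * X k
          ≈⟨ *-congʳ (fromℤ-+ (+ suc k) (a ℤ.+ (b ℤ.- + suc k))) ⟩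
        (fromℤ (+ suc k) + fromℤ (a ℤ.+ (b ℤ.- + suc k))) * X k
          ≈⟨ distribʳ _ _ _ ⟩
        fromℤ (+ suc k) * X k + fromℤ (a ℤ.+ (b ℤ.- + suc k)) * X k
          ≈⟨ +-congˡ (homogeneous L N a (b ℤ.- + suc k) (φ ∘ insertP (suc k)) (pred≤ k b≤N) (b-k≤L k)
               (≡.subst (ℤ._≤ + L) (≡.sym (eq₃ a b (+ suc k))) (ℤP.≤-trans (i-suc≤i _ k) ab≤L))) ⟩
        _ ∎

      NY : ∀ k → fromℤ (a ℤ.+ b) * Y k ≈ S (λ l → α (suc l) * g₃ k l + β (suc l) * g₄ k l)
      NY k = trans (*-congʳ (reflexive (≡.cong fromℤ (eq₂ a b (+ suc k)))))
        (homogeneous L N (a ℤ.+ + suc k) (b ℤ.- + suc k) φ (pred≤ k b≤N) (b-k≤L k)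
               (≡.subst (ℤ._≤ + L) (eq₂ a b (+ suc k)) ab≤L))

      left : ∀ k → fromℤ (a ℤ.+ b) * (β (suc k) * (X k + s (suc k) * Y k)) ≈ β (suc k) * (fromℤ (+ suc k) * X k) + S (U k)
      left k = begin
        fromℤ (a ℤ.+ b) * (β (suc k) * (X k + s (suc k) * Y k))
          ≈⟨ solve 5 (λ n b x s y → n :* (b :* (x :+ s :* y)) := b :* (n :* x) :+ b :* (s :* (n :* y))) refl _ _ _ _ _ ⟩
        β (suc k) * (fromℤ (a ℤ.+ b) * X k) + β (suc k) * (s (suc k) * (fromℤ (a ℤ.+ b) * Y k))
          ≈⟨ +-cong (*-congˡ (NX k)) (*-congˡ (*-congˡ (NY k))) ⟩
        β (suc k) * (fromℤ (+ suc k) * X k + S _) + β (suc k) * (s (suc k) * S _)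
          ≈⟨ +-cong (distribˡ _ _ _) (*-congˡ (*-Σ _ _ (upTo L))) ⟩
        β (suc k) * (fromℤ (+ suc k) * X k) + β (suc k) * S _ + β (suc k) * S _
          ≈⟨ +-assoc _ _ _ ⟩
        β (suc k) * (fromℤ (+ suc k) * X k) + (β (suc k) * S _ + β (suc k) * S _)
          ≈⟨ +-congˡ (+-cong (*-Σ _ _ (upTo L)) (*-Σ _ _ (upTo L))) ⟩
        β (suc k) * (fromℤ (+ suc k) * X k) + (S _ + S _)
          ≈⟨ +-congˡ (Σ-+ _ _ (upTo L)) ⟨
        β (suc k) * (fromℤ (+ suc k) * X k) + S (U k) ∎

      right : ∀ l → B * (α (suc l) * G (a ℤ.- + suc l) b (φ ∘ insertP (suc l)) + β (suc l) * X l) ≈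
                    β (suc l) * (fromℤ (+ suc l) * X l) + S (λ k → U k l)
      right l = begin
        B * (α (suc l) * Z + β (suc l) * X l)
          ≈⟨ solve 5 (λ B a z b x → B :* (a :* z :+ b :* x) := a :* (B :* z) :+ b :* (B :* x)) refl _ _ _ _ _ ⟩
        α (suc l) * (B * Z) + β (suc l) * (B * X l)
          ≈⟨ +-cong (*-congˡ (newton-G L (a ℤ.- + suc l) b (φ ∘ insertP (suc l)) b≤L)) (*-congˡ BX) ⟩
        α (suc l) * S (λ k → β (suc k) * (g₁' k + s (suc k) * g₃' k)) +
        β (suc l) * (fromℤ (+ suc l) * X l + S (λ k → β (suc k) * (g₂' k + s (suc k) * g₄' k)))
          ≈⟨ solve 5 (λ a P b m Q → a :* P :+ b :* (m :+ Q) := b :* m :+ (a :* P :+ b :* Q)) refl (α (suc l)) _ (β (suc l)) (fromℤ (+ suc l) * X l) _ ⟩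
        β (suc l) * (fromℤ (+ suc l) * X l) + (α (suc l) * S _ + β (suc l) * S _)
          ≈⟨ +-congˡ (+-cong (*-Σ _ _ (upTo L)) (*-Σ _ _ (upTo L))) ⟩
        β (suc l) * (fromℤ (+ suc l) * X l) + (S _ + S _)
          ≈⟨ +-congˡ (Σ-+ _ _ (upTo L)) ⟨
        β (suc l) * (fromℤ (+ suc l) * X l) + S (λ k → α (suc l) * (β (suc k) * (g₁' k + s (suc k) * g₃' k)) + β (suc l) * (β (suc k) * (g₂' k + s (suc k) * g₄' k)))
          ≈⟨ +-congˡ (Σ-cong (upTo L) UU) ⟩
        β (suc l) * (fromℤ (+ suc l) * X l) + S (λ k → U k l) ∎
        where
        Z = G (a ℤ.- + suc l) b (φ ∘ insertP (suc l))
        g₁' g₂' g₃' g₄' : ℕ → ∣R∣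
        g₁' k = G (a ℤ.- + suc l) (b ℤ.- + suc k) (φ ∘ insertP (suc l) ∘ insertP (suc k))
        g₂' k = G a (b ℤ.- + suc l ℤ.- + suc k) (φ ∘ insertP (suc l) ∘ insertP (suc k))
        g₃' k = G (a ℤ.- + suc l ℤ.+ + suc k) (b ℤ.- + suc k) (φ ∘ insertP (suc l))
        g₄' k = G (a ℤ.+ + suc k) (b ℤ.- + suc l ℤ.- + suc k) (φ ∘ insertP (suc l))

        BX : B * X l ≈ fromℤ (+ suc l) * X l + S (λ k → β (suc k) * (g₂' k + s (suc k) * g₄' k))
        BX = begin
          B * X l
            ≡⟨ ≡.cong (λ i → fromℤ i * X l) (eq₆ b (+ suc l)) ⟩
          fromℤ (+ suc l ℤ.+ (b ℤ.- + suc l)) * X l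
            ≈⟨ *-congʳ (fromℤ-+ (+ suc l) (b ℤ.- + suc l)) ⟩
          (fromℤ (+ suc l) + fromℤ (b ℤ.- + suc l)) * X l
            ≈⟨ distribʳ _ _ _ ⟩
          fromℤ (+ suc l) * X l + fromℤ (b ℤ.- + suc l) * X l
            ≈⟨ +-congˡ (newton-G L a (b ℤ.- + suc l) (φ ∘ insertP (suc l)) (b-k≤L l)) ⟩
          _ ∎

        UU : ∀ k → α (suc l) * (β (suc k) * (g₁' k + s (suc k) * g₃' k)) + β (suc l) * (β (suc k) * (g₂' k + s (suc k) * g₄' k)) ≈ U k l
        UU k = begin
          α (suc l) * (β (suc k) * (g₁' k + s (suc k) * g₃' k)) + β (suc l) * (β (suc k) * (g₂' k + s (suc k) * g₄' k))
            ≈⟨ +-cong (*-congˡ (*-congˡ (+-cong (G-cong {a ℤ.- + suc l} {b = b ℤ.- + suc k} ≡.refl ≡.refl (φ-comm φ (suc l) (suc k)))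
                                                (*-congˡ (G-cong {b = b ℤ.- + suc k} {φ = φ ∘ insertP (suc l)} (eq₄ a (+ suc k) (+ suc l)) ≡.refl (λ _ → refl))))))
                      (*-congˡ (*-congˡ (+-cong (G-cong ≡.refl (eq₅ b (+ suc k) (+ suc l)) (φ-comm φ (suc l) (suc k)))
                                                (*-congˡ (G-cong {φ = φ ∘ insertP (suc l)} ≡.refl (eq₅ b (+ suc k) (+ suc l)) (λ _ → refl)))))) ⟩
          α (suc l) * (β (suc k) * (g₁ k l + s (suc k) * g₃ k l)) + β (suc l) * (β (suc k) * (g₂ k l + s (suc k) * g₄ k l))
            ≈⟨ solve 8 (λ al bk bl sk a b c d → al :* (bk :* (a :+ sk :* c)) :+ bl :* (bk :* (b :+ sk :* d)) :=
                         bk :* (al :* a :+ bl :* b) :+ bk :* (sk :* (al :* c :+ bl :* d))) refl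
                 (α (suc l)) (β (suc k)) (β (suc l)) (s (suc k)) (g₁ k l) (g₂ k l) (g₃ k l) (g₄ k l) ⟩
          U k l ∎

    -- D_a changes degrees by a, so D_a h_b would have negative degree. `N` bounds the recursion on
    -- b.
    G-neg : ∀ N a b φ → b ℤ.≤ + N → a ℤ.+ b ℤ.< + 0 → G a b φ ≈ 0#
    G-neg N a -[1+ b ] φ _ _ = refl
    G-neg N a (+ zero) φ _ a<0 = trans (G-0 a φ) (h-neg α φ (≡.subst (ℤ._< + 0) (ℤP.+-identityʳ a) a<0))
    G-neg (suc N) a b@(+ suc b') φ (ℤ.+≤+ b≤N) ab<0 = fromℤ-cancel b' (begin
      fromℤ b * G a b φ
        ≈⟨ newton-G (suc b') a b φ ℤP.≤-refl ⟩
      Σ⟨ upTo (suc b') ⟩ (λ k → β (suc k) * (G a (b ℤ.- + suc k) (φ ∘ insertP (suc k)) + s (suc k) * G (a ℤ.+ + suc k) (b ℤ.- + suc k) φ))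
        ≈⟨ Σ-cong (upTo (suc b')) zero-term ⟩
      Σ⟨ upTo (suc b') ⟩ (λ _ → 0#)   ≈⟨ Σ-0 (upTo (suc b')) ⟩
      0#                              ≈⟨ zeroʳ _ ⟨
      fromℤ b * 0#                    ∎)
      where
      eq₁ : ∀ a b k → a ℤ.+ b ℤ.- k ≡ a ℤ.+ (b ℤ.- k)
      eq₁ = solve-∀
      eq₂ : ∀ a b k → a ℤ.+ b ≡ (a ℤ.+ k) ℤ.+ (b ℤ.- k)
      eq₂ = solve-∀
      zero-term : ∀ k → β (suc k) * (G a (b ℤ.- + suc k) (φ ∘ insertP (suc k)) + s (suc k) * G (a ℤ.+ + suc k) (b ℤ.- + suc k) φ) ≈ 0#
      zero-term k = begin
        β (suc k) * (G a (b ℤ.- + suc k) (φ ∘ insertP (suc k)) + s (suc k) * G (a ℤ.+ + suc k) (b ℤ.- + suc k) φ)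
          ≈⟨ *-congˡ (+-cong
               (G-neg N a (b ℤ.- + suc k) _ (pred≤ k b≤N) (≡.subst (ℤ._< + 0) (eq₁ a b (+ suc k)) (ℤP.≤-<-trans (i-suc≤i _ k) ab<0)))
               (*-congˡ (G-neg N (a ℤ.+ + suc k) (b ℤ.- + suc k) φ (pred≤ k b≤N) (≡.subst (ℤ._< + 0) (eq₂ a b (+ suc k)) ab<0)))) ⟩
        β (suc k) * (0# + s (suc k) * 0#)
          ≈⟨ solve 2 (λ b s → b :* (con (+ 0) :+ s :* con (+ 0)) := con (+ 0)) refl _ _ ⟩
        0# ∎
        where open Solver

-- x i stands for q^i, sh u k for p_k[M[u]_q], and al u k for p_k[-[u]_t], t = 1/q.
record TorusData {c ℓ} (R : CommutativeRing c ℓ) : Set (c ⊔ ℓ) where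
  open Kit R
  field
    x      : ℤ → ∣R∣
    x-0    : x (+ 0) ≈ 1#
    x-+    : ∀ i j → x (i ℤ.+ j) ≈ x i * x j
    e      : ℕ → ∣R∣
    e-inv  : ∀ u → (1# - x (+ suc u)) * e (suc u) ≈ 1#
    sh al  : ℕ → ℕ → ∣R∣
    sh-+   : ∀ u v k → sh (u ℕ.+ v) k ≈ sh u k + x (+ u ℤ.* + k) * sh v k
    al-+   : ∀ u v k → al (u ℕ.+ v) k ≈ al u k + x (ℤ.- (+ u ℤ.* + k)) * al v k
    sh-al  : ∀ u v k → sh u k * al v k ≈ - ((1# - x (+ u ℤ.* + k)) * (1# - x (ℤ.- (+ v ℤ.* + k))))

-- The commutation relation of the operators D.

module QuantumTorus {c ℓ} (R : CommutativeRing c ℓ) (PW : PartitionWeights R) (T : TorusData R) where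
  open Kit R
  open TorusData T
  open import Relation.Binary.Reasoning.Setoid setoid
  open VertexOperators R PW public
  open RationalSeries R

  x-cong : ∀ {i j} → i ≡ j → x i ≈ x j
  x-cong = reflexive ∘ ≡.cong x

  x-inv : ∀ i → x i * x (ℤ.- i) ≈ 1#
  x-inv i = trans (sym (x-+ i (ℤ.- i))) (trans (x-cong (ℤP.+-inverseʳ i)) x-0)

  x-^ : ∀ i n → x (i ℤ.* + n) ≈ x i ^ n
  x-^ i zero    = trans (x-cong (ℤP.*-zeroʳ i)) x-0
  x-^ i (suc n) = trans (x-cong (ℤP.*-suc i (+ n))) (trans (x-+ i _) (*-congˡ (x-^ i n)))

  κ : ℕ → ℕ → ∣R∣
  κ u v = - ((1# - x (+ u)) * (1# - x (+ v)) * e (u ℕ.+ v))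

  κ-sym : ∀ u v → κ u v ≈ κ v u
  κ-sym u v = -‿cong (*-cong (*-comm _ _) (reflexive (≡.cong e (ℕP.+-comm u v))))

  -- With p = q^u, r = q^(-v) and y = q^v one has p - r = -r (1 - q^(u+v)) and r (1 - y) = -(1 - r).
  -- So the constant of the commutator is the partial-fraction constant, and 1 - q^(u+v) is its only
  -- denominator.
  κ-spec : ∀ u v → κ u (suc v) * (x (+ u) - x (ℤ.- + suc v)) ≈ - ((1# - x (+ u)) * (1# - x (ℤ.- + suc v)))
  κ-spec u v = begin
    - ((1# - p) * (1# - y) * E) * (p - r)
      ≈⟨ solve 4 (λ p r y E → :- ((con (+ 1) :- p) :* (con (+ 1) :- y) :* E) :* (p :- r) :=
                   :- ((con (+ 1) :- p) :* E :* (p :- r :- y :* p :+ y :* r))) refl p r y E ⟩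
    - ((1# - p) * E * (p - r - y * p + y * r))
      ≈⟨ -‿cong (*-congˡ (+-cong (+-congˡ (-‿cong y*p)) (x-inv (+ suc v)))) ⟩
    - ((1# - p) * E * (p - r - z + 1#))
      ≈⟨ solve 4 (λ p r E z → :- ((con (+ 1) :- p) :* E :* (p :- r :- z :+ con (+ 1))) :=
                   :- ((con (+ 1) :- p) :* ((p :- r) :* E :+ ((con (+ 1) :- z) :* E)))) refl p r E z ⟩
    - ((1# - p) * ((p - r) * E + ((1# - z) * E)))
      ≈⟨ -‿cong (*-congˡ (+-congˡ invE)) ⟩
    - ((1# - p) * ((p - r) * E + 1#))
      ≈⟨ -‿cong (*-congˡ (begin
           (p - r) * E + 1#              ≈⟨ +-congʳ (*-congʳ p-r) ⟩
           - (r * (1# - z)) * E + 1#     ≈⟨ solve 3 (λ r z E → :- (r :* (con (+ 1) :- z)) :* E :+ con (+ 1) := con (+ 1) :- r :* ((con (+ 1) :- z) :* E)) refl r z E ⟩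
           1# - r * ((1# - z) * E)       ≈⟨ +-congˡ (-‿cong (trans (*-congˡ invE) (*-identityʳ r))) ⟩
           1# - r ∎)) ⟩
    - ((1# - p) * (1# - r)) ∎
    where
    open Solver
    p = x (+ u)
    y = x (+ suc v)
    r = x (ℤ.- + suc v)
    z = x (+ (u ℕ.+ suc v))
    E = e (u ℕ.+ suc v)
    y*p : y * p ≈ z
    y*p = trans (sym (x-+ _ _)) (x-cong (≡.cong +_ (ℕP.+-comm (suc v) u)))
    invE : (1# - z) * E ≈ 1#
    invE = ≡.subst (λ n → (1# - x (+ n)) * e n ≈ 1#) (≡.sym (ℕP.+-suc u v)) (e-inv (u ℕ.+ v))
    p-r : p - r ≈ - (r * (1# - z))
    p-r = begin
      p - r                   ≈⟨ +-congʳ (trans (sym (*-identityˡ p)) (*-congʳ (sym (trans (*-comm r y) (x-inv (+ suc v)))))) ⟩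
      r * y * p - r           ≈⟨ +-congʳ (trans (*-assoc _ _ _) (*-congˡ y*p)) ⟩
      r * z - r               ≈⟨ solve 2 (λ r z → r :* z :- r := :- (r :* (con (+ 1) :- z))) refl r z ⟩
      - (r * (1# - z))        ∎

  module G (u v : ℕ) = Euler (sh u) (al u) (al v)

  private
    module Diag (u v : ℕ) where
      open Fraction (x (+ u)) (x (ℤ.- + suc v)) (κ u (suc v)) (κ-spec u v) public

    -J+K : ∀ J K → K ≤ J → ℤ.- + J ℤ.+ + K ≡ ℤ.- + (J ∸ K)
    -J+K J K K≤J = ≡.trans (ℤP.+-comm (ℤ.- + J) (+ K)) (≡.trans (ℤP.m-n≡m⊖n K J) (ℤP.⊖-≤ K≤J))

    J-K : ∀ J K → K ≤ J → + J ℤ.- + K ≡ + (J ∸ K)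
    J-K J K K≤J = ≡.trans (ℤP.m-n≡m⊖n J K) (ℤP.⊖-≥ K≤J)

  -- In `newton-G` the first summand has negative total degree and vanishes, while the second stays
  -- in degree 0 with the factor `al` times `sh`, which is `σ`. This leaves the recursion
  -- `f-newton`.
  G-diagonal : ∀ u v N J φ → J ≤ N → G.G u (suc v) (ℤ.- + J) (+ J) φ ≈ Diag.f u v J * φ []
  G-diagonal u v N zero φ _ = trans (G.G-0 u (suc v) (+ 0) φ) (trans (h-0 (al u) φ) (sym (*-identityˡ _)))
  G-diagonal u v (suc N) J@(suc j) φ (s≤s j≤N) = fromℤ-cancel j (begin
    fromℤ (+ J) * Gᵤ (ℤ.- + J) (+ J) φ
      ≈⟨ newton-G J (ℤ.- + J) (+ J) φ ℤP.≤-refl ⟩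
    Σ⟨ upTo J ⟩ (λ k → al v' (suc k) * (Gᵤ (ℤ.- + J) (+ J ℤ.- + suc k) (φ ∘ insertP (suc k)) + sh u (suc k) * Gᵤ (ℤ.- + J ℤ.+ + suc k) (+ J ℤ.- + suc k) φ))
      ≈⟨ Σ-congᴬ (AllP.applyUpTo⁺₁ (λ i → i) J term) ⟩
    Σ⟨ upTo J ⟩ (λ k → φ [] * (σ p r (suc k) * f (J ∸ suc k)))
      ≈⟨ *-Σ _ _ (upTo J) ⟨
    φ [] * Σ⟨ upTo J ⟩ (λ k → σ p r (suc k) * f (J ∸ suc k))
      ≈⟨ *-congˡ (f-newton J) ⟨
    φ [] * (fromℤ (+ J) * f J)
      ≈⟨ solve 3 (λ a b c → a :* (b :* c) := b :* (c :* a)) refl _ _ _ ⟩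
    fromℤ (+ J) * (f J * φ []) ∎)
    where
    open Solver
    v' = suc v
    open G u v' renaming (G to Gᵤ)
    open Diag u v
    p = x (+ u)
    r = x (ℤ.- + suc v)

    s·al : ∀ k → al v' k * sh u k ≈ σ p r k
    s·al k = trans (*-comm _ _) (trans (sh-al u v' k) (-‿cong (*-cong (+-congˡ (-‿cong (x-^ (+ u) k)))
      (+-congˡ (-‿cong (trans (x-cong (ℤP.neg-distribˡ-* (+ v') (+ k))) (x-^ (ℤ.- + v') k)))))))

    term : ∀ {k} → k < J → al v' (suc k) * (Gᵤ (ℤ.- + J) (+ J ℤ.- + suc k) (φ ∘ insertP (suc k)) + sh u (suc k) * Gᵤ (ℤ.- + J ℤ.+ + suc k) (+ J ℤ.- + suc k) φ) ≈
                      φ [] * (σ p r (suc k) * f (J ∸ suc k))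
    term {k} k<J = begin
      al v' (suc k) * (Gᵤ (ℤ.- + J) (+ J ℤ.- + suc k) (φ ∘ insertP (suc k)) + sh u (suc k) * Gᵤ (ℤ.- + J ℤ.+ + suc k) (+ J ℤ.- + suc k) φ)
        ≈⟨ *-congˡ (+-cong
             (trans (G-cong {ℤ.- + J} {φ = φ ∘ insertP (suc k)} ≡.refl (J-K J (suc k) k<J) (λ _ → refl))
                (G-neg (J ∸ suc k) (ℤ.- + J) (+ (J ∸ suc k)) (φ ∘ insertP (suc k)) ℤP.≤-refl
                neg-total))
             (*-congˡ (trans (G-cong {φ = φ} (-J+K J (suc k) k<J) (J-K J (suc k) k<J) (λ _ → refl))
                (G-diagonal u v N (J ∸ suc k) φ (ℕP.≤-trans (ℕP.m∸n≤m j k) j≤N))))) ⟩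
      al v' (suc k) * (0# + sh u (suc k) * (f (J ∸ suc k) * φ []))
        ≈⟨ solve 4 (λ a s f p → a :* (con (+ 0) :+ s :* (f :* p)) := p :* (a :* s :* f)) refl _ _ _ _ ⟩
      φ [] * (al v' (suc k) * sh u (suc k) * f (J ∸ suc k))
        ≈⟨ *-congˡ (*-congʳ (s·al (suc k))) ⟩
      φ [] * (σ p r (suc k) * f (J ∸ suc k)) ∎
      where
      neg-total : ℤ.- + J ℤ.+ + (j ∸ k) ℤ.< + 0
      neg-total = ≡.subst (ℤ.- + J ℤ.+ + (j ∸ k) ℤ.<_) (ℤP.+-inverseˡ (+ J))
        (ℤP.+-monoʳ-< (ℤ.- + J) (ℤ.+<+ (s≤s (ℕP.m∸n≤m j k))))

  private
    module Pair (u v : ℕ) where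
      U = suc u
      V = suc v
      open G U V using () renaming (G to Gᵤ; homogeneous to homᵤ; G-neg to negᵤ; G-cong to congᵤ) public
      open G V U using () renaming (G to Gᵥ; homogeneous to homᵥ; G-neg to negᵥ; G-cong to congᵥ) public
      γ = al (U ℕ.+ V)
      ξ : ℤ → ℤ → ∣R∣
      ξ a b = κ U V * (x (+ U ℤ.* b) - x (+ V ℤ.* a))

      -- Lowering a or b by k multiplies one of the two powers in `ξ` by exactly the twist in
      -- `al-+`. Collecting the two powers separately gives the weights of U + V and of V + U, which
      -- coincide, so `ξ` passes through the Newton recursion.
      ξ-weights : ∀ a b k → al U k * ξ (a ℤ.- + k) b + al V k * ξ a (b ℤ.- + k) ≈ ξ a b * γ k
      ξ-weights a b k = begin
        al U k * (κ' * (X - x (+ V ℤ.* (a ℤ.- + k)))) + al V k * (κ' * (x (+ U ℤ.* (b ℤ.- + k)) - Y))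
          ≈⟨ +-cong (*-congˡ (*-congˡ (+-congˡ (-‿cong (shift V a))))) (*-congˡ (*-congˡ (+-congʳ (shift U b)))) ⟩
        al U k * (κ' * (X - Y * s)) + al V k * (κ' * (X * r - Y))
          ≈⟨ solve 7 (λ a b c X Y r s → a :* (c :* (X :- Y :* s)) :+ b :* (c :* (X :* r :- Y)) :=
                       c :* (X :* (a :+ r :* b) :- Y :* (b :+ s :* a))) refl (al U k) (al V k) κ' X Y r s ⟩
        κ' * (X * (al U k + r * al V k) - Y * (al V k + s * al U k))
          ≈⟨ *-congˡ (+-cong (*-congˡ (sym (al-+ U V k))) (-‿cong (*-congˡ (trans (sym (al-+ V U k)) (reflexive (≡.cong (λ n → al n k) (ℕP.+-comm V U))))))) ⟩
        κ' * (X * γ k - Y * γ k)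
          ≈⟨ solve 4 (λ c X Y g → c :* (X :* g :- Y :* g) := c :* (X :- Y) :* g) refl κ' X Y (γ k) ⟩
        ξ a b * γ k ∎
        where
        open Solver
        κ' = κ U V
        X = x (+ U ℤ.* b)
        Y = x (+ V ℤ.* a)
        r = x (ℤ.- (+ U ℤ.* + k))
        s = x (ℤ.- (+ V ℤ.* + k))
        shift : ∀ U a → x (+ U ℤ.* (a ℤ.- + k)) ≈ x (+ U ℤ.* a) * x (ℤ.- (+ U ℤ.* + k))
        shift U a = trans (x-cong (lem (+ U) a (+ k))) (x-+ _ _)
          where
          lem : ∀ U a k → U ℤ.* (a ℤ.- k) ≡ U ℤ.* a ℤ.+ ℤ.- (U ℤ.* k)
          lem = solve-∀

      ξ-diag : ∀ J φ → κ U V * (x (+ U) ^ J - x (ℤ.- + V) ^ J) * φ [] ≈ ξ (ℤ.- + J) (+ J) * h γ (+ 0) φ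
      ξ-diag J φ = *-cong (*-congˡ (+-cong (sym (x-^ (+ U) J)) (-‿cong (trans (sym (x-^ (ℤ.- + V) J)) (x-cong lem))))) (sym (h-0 γ φ))
        where
        lem : (ℤ.- + V) ℤ.* + J ≡ + V ℤ.* (ℤ.- + J)
        lem = ≡.trans (≡.sym (ℤP.neg-distribˡ-* (+ V) (+ J))) (ℤP.neg-distribʳ-* (+ V) (+ J))

  -- The commutator identity applied to 1: D_{U,a} h_b - D_{V,b} h_a.
  G-commutator : ∀ u v N n a b φ → a ℤ.+ b ≡ n → n ℤ.≤ + N →
                 Pair.Gᵤ u v a b φ - Pair.Gᵥ u v b a φ ≈ Pair.ξ u v a b * h (al (suc u ℕ.+ suc v)) n φ
  G-commutator u v N -[1+ m ] a b φ ab≡n _ = begin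
    Gᵤ a b φ - Gᵥ b a φ   ≈⟨ +-cong (negᵤ ℤ.∣ b ∣ a b φ (i≤∣i∣ b) (≡.subst (ℤ._< + 0) (≡.sym ab≡n) ℤ.-<+))
                              (-‿cong (negᵥ ℤ.∣ a ∣ b a φ (i≤∣i∣ a) (≡.subst (ℤ._< + 0) (≡.sym (≡.trans (ℤP.+-comm b a) ab≡n)) ℤ.-<+))) ⟩
    0# - 0#               ≈⟨ -‿inverseʳ 0# ⟩
    0#                    ≈⟨ zeroʳ _ ⟨
    ξ a b * 0#            ∎
    where open Pair u v
  G-commutator u v N (+ 0) a b φ ab≡0 _ =
    ≡.subst (λ a → Gᵤ a b φ - Gᵥ b a φ ≈ ξ a b * h γ (+ 0) φ) (≡.sym a≡-b) (diag b)
    where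
    open Pair u v
    a≡-b : a ≡ ℤ.- b
    a≡-b = ≡.trans (lem a b) (≡.trans (≡.cong (ℤ._- b) ab≡0) (ℤP.+-identityˡ (ℤ.- b)))
      where
      lem : ∀ a b → a ≡ a ℤ.+ b ℤ.- b
      lem = solve-∀
    -- For b of either sign only one of the two products survives, as the other contains h of
    -- negative degree. At b = 0 both equal `φ []` and cancel, so the partial-fraction formula
    -- without its constant term holds for every integer b.
    diag : ∀ b → Gᵤ (ℤ.- b) b φ - Gᵥ b (ℤ.- b) φ ≈ ξ (ℤ.- b) b * h γ (+ 0) φ
    diag (+ 0) = begin
      Gᵤ (+ 0) (+ 0) φ - Gᵥ (+ 0) (+ 0) φ
        ≈⟨ +-cong (G-diagonal U v 0 0 φ z≤n) (-‿cong (G-diagonal V u 0 0 φ z≤n)) ⟩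
      1# * φ [] - 1# * φ []               ≈⟨ -‿inverseʳ _ ⟩
      0#                                  ≈⟨ solve 2 (λ k p → con (+ 0) := k :* (con (+ 1) :- con (+ 1)) :* p) refl (κ U V) (φ []) ⟩
      κ U V * (1# - 1#) * φ []            ≈⟨ ξ-diag 0 φ ⟩
      ξ (+ 0) (+ 0) * h γ (+ 0) φ         ∎
      where open Solver
    diag (+ suc j) = begin
      Gᵤ -[1+ j ] (+ suc j) φ - 0#        ≈⟨ trans (+-congˡ -0#≈0#) (+-identityʳ _) ⟩
      Gᵤ -[1+ j ] (+ suc j) φ             ≈⟨ G-diagonal U v (suc j) (suc j) φ ℕP.≤-refl ⟩
      κ U V * (x (+ U) ^ suc j - x (ℤ.- + V) ^ suc j) * φ []   ≈⟨ ξ-diag (suc j) φ ⟩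
      ξ -[1+ j ] (+ suc j) * h γ (+ 0) φ  ∎
    diag -[1+ j ] = begin
      0# - Gᵥ -[1+ j ] (+ suc j) φ
        ≈⟨ +-congˡ (-‿cong (trans (G-diagonal V u (suc j) (suc j) φ ℕP.≤-refl) (*-congʳ (*-congˡ (+-cong
             (sym (x-^ (+ V) (suc j))) (-‿cong (trans (sym (x-^ (ℤ.- + U) (suc j))) (x-cong lem)))))))) ⟩
      0# - κ V U * (x (+ V ℤ.* + suc j) - x (+ U ℤ.* -[1+ j ])) * φ []
        ≈⟨ solve 4 (λ k A B p → con (+ 0) :- k :* (A :- B) :* p := k :* (B :- A) :* p) refl _ _ _ _ ⟩
      κ V U * (x (+ U ℤ.* -[1+ j ]) - x (+ V ℤ.* + suc j)) * φ []
        ≈⟨ *-cong (*-congʳ (κ-sym V U)) (sym (h-0 γ φ)) ⟩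
      ξ (+ suc j) -[1+ j ] * h γ (+ 0) φ ∎
      where
      open Solver
      lem : (ℤ.- + U) ℤ.* + suc j ≡ + U ℤ.* -[1+ j ]
      lem = ≡.trans (≡.sym (ℤP.neg-distribˡ-* (+ U) (+ suc j))) (ℤP.neg-distribʳ-* (+ U) (+ suc j))
  G-commutator u v (suc N) n@(+ suc m) a b φ ab≡n (ℤ.+≤+ (s≤s m≤N)) = fromℤ-cancel m (begin
    fromℤ n * (Gᵤ a b φ - Gᵥ b a φ)
      ≈⟨ solve 3 (λ n a b → n :* (a :- b) := n :* a :- n :* b) refl _ _ _ ⟩
    fromℤ n * Gᵤ a b φ - fromℤ n * Gᵥ b a φ
      ≈⟨ +-cong (trans (*-congʳ (reflexive (≡.cong fromℤ (≡.sym ab≡n)))) (homᵤ L L a b φ b≤L b≤L ab≤L))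
           (-‿cong (trans (*-congʳ (reflexive (≡.cong fromℤ (≡.sym ba≡n)))) (homᵥ L L b a φ a≤L a≤L (≡.subst (ℤ._≤ + L) (ℤP.+-comm a b) ab≤L)))) ⟩
    S (λ k → al U (suc k) * Gᵤ (a ℤ.- + suc k) b (φ ∘ insertP (suc k)) + al V (suc k) * Gᵤ a (b ℤ.- + suc k) (φ ∘ insertP (suc k))) -
    S (λ k → al V (suc k) * Gᵥ (b ℤ.- + suc k) a (φ ∘ insertP (suc k)) + al U (suc k) * Gᵥ b (a ℤ.- + suc k) (φ ∘ insertP (suc k)))
      ≈⟨ +-congˡ (sym (Σ-neg _ (upTo L))) ⟩
    S _ + S _
      ≈⟨ Σ-+ _ _ (upTo L) ⟨
    S _
      ≈⟨ Σ-cong (upTo L) term ⟩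
    S (λ k → ξ a b * (γ (suc k) * h γ (n ℤ.- + suc k) (φ ∘ insertP (suc k))))
      ≈⟨ *-Σ _ _ (upTo L) ⟨
    ξ a b * S (λ k → γ (suc k) * h γ (n ℤ.- + suc k) (φ ∘ insertP (suc k)))
      ≈⟨ *-congˡ (newton γ L n φ (≡.subst (ℤ._≤ + L) ab≡n ab≤L)) ⟨
    ξ a b * (fromℤ n * h γ n φ)
      ≈⟨ solve 3 (λ a b c → a :* (b :* c) := b :* (a :* c)) refl _ _ _ ⟩
    fromℤ n * (ξ a b * h γ n φ) ∎)
    where
    open Solver
    open Pair u v
    -- `L` bounds a, b and a + b at once, so that all Newton sums run over the same range.
    L = ℤ.∣ a ∣ ℕ.+ ℤ.∣ b ∣
    S : (ℕ → ∣R∣) → ∣R∣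
    S = Σ⟨ upTo L ⟩
    a≤L = ℤP.≤-trans (i≤∣i∣ a) (ℤ.+≤+ (ℕP.m≤m+n ℤ.∣ a ∣ ℤ.∣ b ∣))
    b≤L = ℤP.≤-trans (i≤∣i∣ b) (ℤ.+≤+ (ℕP.m≤n+m ℤ.∣ b ∣ ℤ.∣ a ∣))
    ab≤L : a ℤ.+ b ℤ.≤ + L
    ab≤L = ℤP.+-mono-≤ (i≤∣i∣ a) (i≤∣i∣ b)
    ba≡n = ≡.trans (ℤP.+-comm b a) ab≡n
    n-k≤N : ∀ k → n ℤ.- + suc k ℤ.≤ + N
    n-k≤N k = ≡.subst (ℤ._≤ + N) (≡.sym (ℤP.[1+m]⊖[1+n]≡m⊖n m k)) (ℤP.≤-trans (ℤP.m⊖n≤m m k) (ℤ.+≤+ m≤N))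
    eq₁ : ∀ a b k → (a ℤ.- k) ℤ.+ b ≡ a ℤ.+ b ℤ.- k
    eq₁ = solve-∀
    eq₂ : ∀ a b k → a ℤ.+ (b ℤ.- k) ≡ a ℤ.+ b ℤ.- k
    eq₂ = solve-∀
    IH₁ : ∀ k φ → Gᵤ (a ℤ.- + suc k) b φ - Gᵥ b (a ℤ.- + suc k) φ ≈ ξ (a ℤ.- + suc k) b * h γ (n ℤ.- + suc k) φ
    IH₁ k φ = G-commutator u v N (n ℤ.- + suc k) (a ℤ.- + suc k) b φ
                (≡.trans (eq₁ a b (+ suc k)) (≡.cong (ℤ._- + suc k) ab≡n)) (n-k≤N k)
    IH₂ : ∀ k φ → Gᵤ a (b ℤ.- + suc k) φ - Gᵥ (b ℤ.- + suc k) a φ ≈ ξ a (b ℤ.- + suc k) * h γ (n ℤ.- + suc k) φ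
    IH₂ k φ = G-commutator u v N (n ℤ.- + suc k) a (b ℤ.- + suc k) φ
                (≡.trans (eq₂ a b (+ suc k)) (≡.cong (ℤ._- + suc k) ab≡n)) (n-k≤N k)
    term : ∀ k → (al U (suc k) * Gᵤ (a ℤ.- + suc k) b (φ ∘ insertP (suc k)) + al V (suc k) * Gᵤ a (b ℤ.- + suc k) (φ ∘ insertP (suc k))) -
                 (al V (suc k) * Gᵥ (b ℤ.- + suc k) a (φ ∘ insertP (suc k)) + al U (suc k) * Gᵥ b (a ℤ.- + suc k) (φ ∘ insertP (suc k))) ≈
                 ξ a b * (γ (suc k) * h γ (n ℤ.- + suc k) (φ ∘ insertP (suc k)))
    term k = begin
      _ ≈⟨ solve 6 (λ α β A B C E → (α :* A :+ β :* B) :- (β :* C :+ α :* E) := α :* (A :- E) :+ β :* (B :- C)) refl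
             (al U (suc k)) (al V (suc k)) (Gᵤ (a ℤ.- + suc k) b φ') (Gᵤ a (b ℤ.- + suc k) φ') (Gᵥ (b ℤ.- + suc k) a φ') (Gᵥ b (a ℤ.- + suc k) φ') ⟩
      al U (suc k) * (Gᵤ (a ℤ.- + suc k) b φ' - Gᵥ b (a ℤ.- + suc k) φ') + al V (suc k) * (Gᵤ a (b ℤ.- + suc k) φ' - Gᵥ (b ℤ.- + suc k) a φ')
        ≈⟨ +-cong (*-congˡ (IH₁ k φ')) (*-congˡ (IH₂ k φ')) ⟩
      al U (suc k) * (ξ (a ℤ.- + suc k) b * H) + al V (suc k) * (ξ a (b ℤ.- + suc k) * H)
        ≈⟨ solve 5 (λ a x b y h → a :* (x :* h) :+ b :* (y :* h) := (a :* x :+ b :* y) :* h) refl _ _ _ _ H ⟩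
      (al U (suc k) * ξ (a ℤ.- + suc k) b + al V (suc k) * ξ a (b ℤ.- + suc k)) * H
        ≈⟨ *-congʳ (ξ-weights a b (suc k)) ⟩
      ξ a b * γ (suc k) * H   ≈⟨ *-assoc _ _ _ ⟩
      ξ a b * (γ (suc k) * H) ∎
      where
      φ' = φ ∘ insertP (suc k)
      H  = h γ (n ℤ.- + suc k) φ'

  Dᵗ : ℕ → ℤ → Fn → Fn
  Dᵗ u = dt (sh u) (al u)

  -- Transposition reverses composition, so the first term belongs to D_(u,a) D_(v,b). Removing a
  -- part k yields the same commutator and two others, with a or b raised by k; they recombine
  -- because `sh` is additive with the opposite twists to those of `al`.
  commutator : ∀ u v λs a b φ →
    Dᵗ (suc v) b (Dᵗ (suc u) a φ) λs - Dᵗ (suc u) a (Dᵗ (suc v) b φ) λs ≈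
    κ (suc u) (suc v) * (x (+ suc u ℤ.* b) - x (+ suc v ℤ.* a)) * Dᵗ (suc u ℕ.+ suc v) (a ℤ.+ b) φ λs
  commutator u v [] a b φ = G-commutator u v ℤ.∣ a ℤ.+ b ∣ (a ℤ.+ b) a b φ ≡.refl (i≤∣i∣ (a ℤ.+ b))
  commutator u v (k ∷ λs) a b φ = begin
    Dᵗ V b (Dᵗ U a φ ∘ insertP k) λs + sh V k * Dᵗ V (b ℤ.+ + k) (Dᵗ U a φ) λs -
    (Dᵗ U a (Dᵗ V b φ ∘ insertP k) λs + sh U k * Dᵗ U (a ℤ.+ + k) (Dᵗ V b φ) λs)
      ≈⟨ +-cong (+-congʳ (push U V a b)) (-‿cong (+-congʳ (push V U b a))) ⟩
    Dᵗ V b (Dᵗ U a φ') λs + sh U k * Dᵗ V b (Dᵗ U (a ℤ.+ + k) φ) λs + sh V k * Dᵗ V (b ℤ.+ + k) (Dᵗ U a φ) λs -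
    (Dᵗ U a (Dᵗ V b φ') λs + sh V k * Dᵗ U a (Dᵗ V (b ℤ.+ + k) φ) λs + sh U k * Dᵗ U (a ℤ.+ + k) (Dᵗ V b φ) λs)
      ≈⟨ solve 8 (λ s t A B C A' B' C' → A :+ s :* B :+ t :* C :- (A' :+ t :* C' :+ s :* B') :=
                    (A :- A') :+ s :* (B :- B') :+ t :* (C :- C')) refl (sh U k) (sh V k)
           (Dᵗ V b (Dᵗ U a φ') λs) (Dᵗ V b (Dᵗ U (a ℤ.+ + k) φ) λs) (Dᵗ V (b ℤ.+ + k) (Dᵗ U a φ) λs)
           (Dᵗ U a (Dᵗ V b φ') λs) (Dᵗ U (a ℤ.+ + k) (Dᵗ V b φ) λs) (Dᵗ U a (Dᵗ V (b ℤ.+ + k) φ) λs) ⟩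
    (Dᵗ V b (Dᵗ U a φ') λs - Dᵗ U a (Dᵗ V b φ') λs) +
    sh U k * (Dᵗ V b (Dᵗ U (a ℤ.+ + k) φ) λs - Dᵗ U (a ℤ.+ + k) (Dᵗ V b φ) λs) +
    sh V k * (Dᵗ V (b ℤ.+ + k) (Dᵗ U a φ) λs - Dᵗ U a (Dᵗ V (b ℤ.+ + k) φ) λs)
      ≈⟨ +-cong (+-cong (commutator u v λs a b φ') (*-congˡ (commutator u v λs (a ℤ.+ + k) b φ)))
           (*-congˡ (commutator u v λs a (b ℤ.+ + k) φ)) ⟩
    ξ a b * E + sh U k * (ξ (a ℤ.+ + k) b * Dᵗ W (a ℤ.+ + k ℤ.+ b) φ λs) + sh V k * (ξ a (b ℤ.+ + k) * Dᵗ W (a ℤ.+ (b ℤ.+ + k)) φ λs)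
      ≈⟨ +-cong (+-congˡ (*-congˡ (*-congˡ (reflexive (≡.cong (λ i → Dᵗ W i φ λs) (eq₁ a b (+ k)))))))
           (*-congˡ (*-congˡ (reflexive (≡.cong (λ i → Dᵗ W i φ λs) (eq₂ a b (+ k)))))) ⟩
    ξ a b * E + sh U k * (ξ (a ℤ.+ + k) b * F) + sh V k * (ξ a (b ℤ.+ + k) * F)
      ≈⟨ solve 7 (λ X E s Y F t Z → X :* E :+ s :* (Y :* F) :+ t :* (Z :* F) := X :* E :+ (s :* Y :+ t :* Z) :* F) refl _ _ _ _ _ _ _ ⟩
    ξ a b * E + (sh U k * ξ (a ℤ.+ + k) b + sh V k * ξ a (b ℤ.+ + k)) * F
      ≈⟨ +-congˡ (*-congʳ weights) ⟩
    ξ a b * E + ξ a b * sh W k * F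
      ≈⟨ solve 4 (λ x e s f → x :* e :+ x :* s :* f := x :* (e :+ s :* f)) refl _ _ _ _ ⟩
    ξ a b * (E + sh W k * F) ∎
    where
    open Solver
    open Pair u v using (U; V; ξ)
    W = U ℕ.+ V
    φ' = φ ∘ insertP k
    E = Dᵗ W (a ℤ.+ b) φ' λs
    F = Dᵗ W (a ℤ.+ b ℤ.+ + k) φ λs
    eq₁ : ∀ a b k → a ℤ.+ k ℤ.+ b ≡ a ℤ.+ b ℤ.+ k
    eq₁ = solve-∀
    eq₂ : ∀ a b k → a ℤ.+ (b ℤ.+ k) ≡ a ℤ.+ b ℤ.+ k
    eq₂ = solve-∀
    push : ∀ U V a b → Dᵗ V b (Dᵗ U a φ ∘ insertP k) λs ≈ Dᵗ V b (Dᵗ U a φ') λs + sh U k * Dᵗ V b (Dᵗ U (a ℤ.+ + k) φ) λs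
    push U V a b = trans (dt-cong (sh V) (al V) b (dt-insertP (sh U) (al U) a φ k) λs)
      (dt-linear (sh V) (al V) b (sh U k) (Dᵗ U a φ') (Dᵗ U (a ℤ.+ + k) φ) λs)
    weights : sh U k * ξ (a ℤ.+ + k) b + sh V k * ξ a (b ℤ.+ + k) ≈ ξ a b * sh W k
    weights = begin
      sh U k * (κ' * (X - x (+ V ℤ.* (a ℤ.+ + k)))) + sh V k * (κ' * (x (+ U ℤ.* (b ℤ.+ + k)) - Y))
        ≈⟨ +-cong (*-congˡ (*-congˡ (+-congˡ (-‿cong (shift V a))))) (*-congˡ (*-congˡ (+-congʳ (shift U b)))) ⟩
      sh U k * (κ' * (X - Y * s)) + sh V k * (κ' * (X * r - Y))
        ≈⟨ solve 7 (λ a b c X Y r s → a :* (c :* (X :- Y :* s)) :+ b :* (c :* (X :* r :- Y)) :=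
                     c :* (X :* (a :+ r :* b) :- Y :* (b :+ s :* a))) refl (sh U k) (sh V k) κ' X Y r s ⟩
      κ' * (X * (sh U k + r * sh V k) - Y * (sh V k + s * sh U k))
        ≈⟨ *-congˡ (+-cong (*-congˡ (sym (sh-+ U V k))) (-‿cong (*-congˡ (trans (sym (sh-+ V U k)) (reflexive (≡.cong (λ n → sh n k) (ℕP.+-comm V U))))))) ⟩
      κ' * (X * sh W k - Y * sh W k)
        ≈⟨ solve 4 (λ c X Y g → c :* (X :* g :- Y :* g) := c :* (X :- Y) :* g) refl κ' X Y (sh W k) ⟩
      ξ a b * sh W k ∎
      where
      κ' = κ U V
      X = x (+ U ℤ.* b)
      Y = x (+ V ℤ.* a)
      r = x (+ U ℤ.* + k)
      s = x (+ V ℤ.* + k)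
      shift : ∀ U a → x (+ U ℤ.* (a ℤ.+ + k)) ≈ x (+ U ℤ.* a) * x (+ U ℤ.* + k)
      shift U a = trans (x-cong (ℤP.*-distribˡ-+ (+ U) a (+ k))) (x-+ _ _)

-- Fractions with cancellable denominators.

module FractionRing {c ℓ} (L : CommutativeRing c ℓ) where
  open Kit L
  open import Relation.Binary.Reasoning.Setoid setoid

  -- Cancellability of each denominator takes the place of an integral domain: transitivity of `_≃_`
  -- has to cancel only the middle denominator.
  Regular : ∣R∣ → Set (c ⊔ ℓ)
  Regular p = ∀ a b → p * a ≈ p * b → a ≈ b

  regular-1 : Regular 1#
  regular-1 a b eq = trans (sym (*-identityˡ a)) (trans eq (*-identityˡ b))

  regular-* : ∀ {p r} → Regular p → Regular r → Regular (p * r)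
  regular-* reg-p reg-r a b eq = reg-r a b (reg-p _ _ (trans (sym (*-assoc _ _ a)) (trans eq (*-assoc _ _ b))))

  regular-factor : ∀ {p} r {s} → r * p ≈ s → Regular s → Regular p
  regular-factor {p} r {s} rp≈s reg-s a b eq = reg-s a b (begin
    s * a        ≈⟨ *-congʳ rp≈s ⟨
    r * p * a    ≈⟨ *-assoc r p a ⟩
    r * (p * a)  ≈⟨ *-congˡ eq ⟩
    r * (p * b)  ≈⟨ *-assoc r p b ⟨
    r * p * b    ≈⟨ *-congʳ rp≈s ⟩
    s * b        ∎)

  record Frac : Set (c ⊔ ℓ) where
    constructor frac
    no-eta-equality
    field
      num den : ∣R∣
      regular : Regular den
  open Frac public

  infix 4 _≃_
  record _≃_ (x y : Frac) : Set ℓ where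
    constructor cross
    field uncross : num x * den y ≈ num y * den x
  open _≃_ public

  infixl 6 _⊕_
  infixl 7 _⊗_
  _⊕_ _⊗_ : Frac → Frac → Frac
  num (x ⊕ y)     = num x * den y + num y * den x
  den (x ⊕ y)     = den x * den y
  regular (x ⊕ y) = regular-* (regular x) (regular y)
  num (x ⊗ y)     = num x * num y
  den (x ⊗ y)     = den x * den y
  regular (x ⊗ y) = regular-* (regular x) (regular y)

  ⊖_ : Frac → Frac
  num (⊖ x)     = - num x
  den (⊖ x)     = den x
  regular (⊖ x) = regular x

  ι : ∣R∣ → Frac
  num (ι p)     = p
  den (ι p)     = 1#
  regular (ι p) = regular-1

  ≃-trans : ∀ {x y z} → x ≃ y → y ≃ z → x ≃ z
  ≃-trans {x} {y} {z} (cross p) (cross q) = cross (regular y _ _ (begin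
    den y * (num x * den z)   ≈⟨ solve 3 (λ d a f → d :* (a :* f) := (a :* d) :* f) refl _ _ _ ⟩
    num x * den y * den z     ≈⟨ *-congʳ p ⟩
    num y * den x * den z     ≈⟨ solve 3 (λ c b f → c :* b :* f := (c :* f) :* b) refl _ _ _ ⟩
    num y * den z * den x     ≈⟨ *-congʳ q ⟩
    num z * den y * den x     ≈⟨ solve 3 (λ e d b → e :* d :* b := d :* (e :* b)) refl _ _ _ ⟩
    den y * (num z * den x)   ∎))
    where open Solver

  ⊕-cong : ∀ {x x' y y'} → x ≃ x' → y ≃ y' → x ⊕ y ≃ x' ⊕ y'
  ⊕-cong {x} {x'} {y} {y'} (cross p) (cross q) = cross (begin
    (num x * den y + num y * den x) * (den x' * den y')
      ≈⟨ solve 6 (λ a b c d b' d' → (a :* d :+ c :* b) :* (b' :* d') := (a :* b') :* (d :* d') :+ (c :* d') :* (b :* b')) refl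
           (num x) (den x) (num y) (den y) (den x') (den y') ⟩
    num x * den x' * (den y * den y') + num y * den y' * (den x * den x')
      ≈⟨ +-cong (*-congʳ p) (*-congʳ q) ⟩
    num x' * den x * (den y * den y') + num y' * den y * (den x * den x')
      ≈⟨ solve 6 (λ a b c d b' d' → (a :* b) :* (d :* d') :+ (c :* d) :* (b :* b') := (a :* d' :+ c :* b') :* (b :* d)) refl
           (num x') (den x) (num y') (den y) (den x') (den y') ⟩
    (num x' * den y' + num y' * den x') * (den x * den y) ∎)
    where open Solver

  ⊗-cong : ∀ {x x' y y'} → x ≃ x' → y ≃ y' → x ⊗ y ≃ x' ⊗ y'
  ⊗-cong {x} {x'} {y} {y'} (cross p) (cross q) = cross (begin
    num x * num y * (den x' * den y')     ≈⟨ solve 4 (λ a b c d → a :* b :* (c :* d) := (a :* c) :* (b :* d)) refl _ _ _ _ ⟩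
    num x * den x' * (num y * den y')     ≈⟨ *-cong p q ⟩
    num x' * den x * (num y' * den y)     ≈⟨ solve 4 (λ a b c d → a :* b :* (c :* d) := (a :* c) :* (b :* d)) refl _ _ _ _ ⟩
    num x' * num y' * (den x * den y)     ∎)
    where open Solver

  fracRing : CommutativeRing _ _
  fracRing = record
    { Carrier = Frac ; _≈_ = _≃_ ; _+_ = _⊕_ ; _*_ = _⊗_ ; -_ = ⊖_ ; 0# = ι 0# ; 1# = ι 1#
    ; isCommutativeRing = record
      { isRing = record
        { +-isAbelianGroup = record
          { isGroup = record
            { isMonoid = record
              { isSemigroup = record
                { isMagma = record
                  { isEquivalence = record
                    { refl = cross refl ; sym = λ { (cross p) → cross (sym p) } ; trans = ≃-trans }
                  ; ∙-cong = ⊕-cong }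
                ; assoc = λ x y z → cross (solve 6 (λ a b c d e f →
                    ((a :* d :+ c :* b) :* f :+ e :* (b :* d)) :* (b :* (d :* f)) :=
                    (a :* (d :* f) :+ (c :* f :+ e :* d) :* b) :* ((b :* d) :* f)) refl (num x) (den x) (num y) (den y) (num z) (den z)) }
              ; identity = (λ x → cross (solve 2 (λ a b → (con 0ℤ :* b :+ a :* con 1ℤ) :* b := a :* (con 1ℤ :* b)) refl (num x) (den x)))
                         , (λ x → cross (solve 2 (λ a b → (a :* con 1ℤ :+ con 0ℤ :* b) :* b := a :* (b :* con 1ℤ)) refl (num x) (den x))) }
            ; inverse = (λ x → cross (solve 2 (λ a b → ((:- a) :* b :+ a :* b) :* con 1ℤ := con 0ℤ :* (b :* b)) refl (num x) (den x)))
                      , (λ x → cross (solve 2 (λ a b → (a :* b :+ (:- a) :* b) :* con 1ℤ := con 0ℤ :* (b :* b)) refl (num x) (den x)))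
            ; ⁻¹-cong = λ { {x} {y} (cross p) → cross (trans (sym (-‿distribˡ-* (num x) (den y))) (trans (-‿cong p) (-‿distribˡ-* (num y) (den x)))) } }
          ; comm = λ x y → cross (solve 4 (λ a b c d → (a :* d :+ c :* b) :* (d :* b) := (c :* b :+ a :* d) :* (b :* d)) refl (num x) (den x) (num y) (den y)) }
        ; *-cong = ⊗-cong
        ; *-assoc = λ x y z → cross (solve 6 (λ a b c d e f → ((a :* c) :* e) :* (b :* (d :* f)) := (a :* (c :* e)) :* ((b :* d) :* f)) refl (num x) (den x) (num y) (den y) (num z) (den z))
        ; *-identity = (λ x → cross (solve 2 (λ a b → con 1ℤ :* a :* b := a :* (con 1ℤ :* b)) refl (num x) (den x)))
                     , (λ x → cross (solve 2 (λ a b → a :* con 1ℤ :* b := a :* (b :* con 1ℤ)) refl (num x) (den x)))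
        ; distrib = (λ x y z → cross (solve 6 (λ a b c d e f →
                      (a :* (c :* f :+ e :* d)) :* ((b :* d) :* (b :* f)) := ((a :* c) :* (b :* f) :+ (a :* e) :* (b :* d)) :* (b :* (d :* f))) refl
                      (num x) (den x) (num y) (den y) (num z) (den z)))
                  , (λ x y z → cross (solve 6 (λ a b c d e f →
                      ((c :* f :+ e :* d) :* a) :* ((d :* b) :* (f :* b)) := ((c :* a) :* (f :* b) :+ (e :* a) :* (d :* b)) :* ((d :* f) :* b)) refl
                      (num x) (den x) (num y) (den y) (num z) (den z))) }
      ; *-comm = λ x y → cross (solve 4 (λ a b c d → (a :* c) :* (d :* b) := (c :* a) :* (b :* d)) refl (num x) (den x) (num y) (den y)) } }
    where open Solver

  ι-cong : ∀ {p r} → p ≈ r → ι p ≃ ι r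
  ι-cong eq = cross (*-congʳ eq)

  ι-+ : ∀ p r → ι (p + r) ≃ ι p ⊕ ι r
  ι-+ p r = cross (*-cong (sym (+-cong (*-identityʳ p) (*-identityʳ r))) (*-identityʳ 1#))

  ι-* : ∀ p r → ι (p * r) ≃ ι p ⊗ ι r
  ι-* p r = cross (*-congˡ (*-identityʳ 1#))

  ι-neg : ∀ p → ι (- p) ≃ ⊖ ι p
  ι-neg p = cross refl

  frac-inv : ∀ p reg → ι p ⊗ frac 1# p reg ≃ ι 1#
  frac-inv p reg = cross (trans (*-identityʳ _) (trans (*-identityʳ p) (sym (trans (*-identityˡ _) (*-identityˡ p)))))

-- Laurent polynomials form a commutative ring.

δ : ℤ → ℤ → ℤ → ℤ
δ c f e = if ⌊ f ℤP.≟ e ⌋ then c else 0ℤ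

private
  shift-to : ∀ i f e → i ℤ.+ f ≡ e → f ≡ e ℤ.- i
  shift-to i f e ≡.refl = lem i f
    where
    lem : ∀ i f → f ≡ i ℤ.+ f ℤ.- i
    lem = solve-∀

  shift-from : ∀ i f e → f ≡ e ℤ.- i → i ℤ.+ f ≡ e
  shift-from i f e ≡.refl = lem i e
    where
    lem : ∀ i e → i ℤ.+ (e ℤ.- i) ≡ e
    lem = solve-∀

δ-shift : ∀ c d i f e → δ (c ℤ.* d) (i ℤ.+ f) e ≡ c ℤ.* δ d f (e ℤ.- i)
δ-shift c d i f e with i ℤ.+ f ℤP.≟ e | f ℤP.≟ e ℤ.- i
... | yes _ | yes _ = ≡.refl
... | yes p | no ¬q = contradiction (shift-to i f e p) ¬q
... | no ¬p | yes q = contradiction (shift-from i f e q) ¬p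
... | no _  | no _  = ≡.sym (ℤP.*-zeroʳ c)

δ-flip : ∀ c d i j e → d ℤ.* δ c i (e ℤ.- j) ≡ c ℤ.* δ d j (e ℤ.- i)
δ-flip c d i j e with i ℤP.≟ e ℤ.- j | j ℤP.≟ e ℤ.- i
... | yes _ | yes _ = ℤP.*-comm d c
... | yes p | no ¬q = contradiction (shift-to i j e (≡.trans (ℤP.+-comm i j) (shift-from j i e p))) ¬q
... | no ¬p | yes q = contradiction (shift-to j i e (≡.trans (ℤP.+-comm j i) (shift-from i j e q))) ¬p
... | no _  | no _  = ≡.trans (ℤP.*-zeroʳ d) (≡.sym (ℤP.*-zeroʳ c))

coeffL-++ : ∀ p r e → coeffL (p ++ r) e ≡ coeffL p e ℤ.+ coeffL r e
coeffL-++ []            r e = ≡.sym (ℤP.+-identityˡ _)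
coeffL-++ ((c , f) ∷ p) r e = ≡.trans (≡.cong (λ z → δ c f e ℤ.+ z) (coeffL-++ p r e)) (≡.sym (ℤP.+-assoc (δ c f e) _ _))

coeffL-neg : ∀ p e → coeffL (negL p) e ≡ ℤ.- coeffL p e
coeffL-neg []            e = ≡.refl
coeffL-neg ((c , f) ∷ p) e = ≡.trans (≡.cong₂ ℤ._+_ (neg c f) (coeffL-neg p e)) (≡.sym (ℤP.neg-distrib-+ (δ c f e) _))
  where
  neg : ∀ c f → δ (ℤ.- c) f e ≡ ℤ.- δ c f e
  neg c f with f ℤP.≟ e
  ... | yes _ = ≡.refl
  ... | no _  = ≡.refl

-- Multiplication by a Laurent polynomial as an operator on arbitrary coefficient functions.
-- Products become compositions, which makes associativity and congruence immediate although lists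
-- of terms are not normalised.
act : Laur → (ℤ → ℤ) → ℤ → ℤ
act []            g e = 0ℤ
act ((c , i) ∷ p) g e = c ℤ.* g (e ℤ.- i) ℤ.+ act p g e

act-cong : ∀ p {g g'} → (∀ e → g e ≡ g' e) → ∀ e → act p g e ≡ act p g' e
act-cong []            eq e = ≡.refl
act-cong ((c , i) ∷ p) eq e = ≡.cong₂ (λ y z → c ℤ.* y ℤ.+ z) (eq (e ℤ.- i)) (act-cong p eq e)

act-+ : ∀ p g g' e → act p (λ i → g i ℤ.+ g' i) e ≡ act p g e ℤ.+ act p g' e
act-+ []            g g' e = ≡.refl
act-+ ((c , i) ∷ p) g g' e = ≡.trans (≡.cong (λ z → c ℤ.* (g (e ℤ.- i) ℤ.+ g' (e ℤ.- i)) ℤ.+ z) (act-+ p g g' e)) (lem c _ _ _ _)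
  where
  lem : ∀ c x y u v → c ℤ.* (x ℤ.+ y) ℤ.+ (u ℤ.+ v) ≡ (c ℤ.* x ℤ.+ u) ℤ.+ (c ℤ.* y ℤ.+ v)
  lem = solve-∀

act-++ : ∀ p r g e → act (p ++ r) g e ≡ act p g e ℤ.+ act r g e
act-++ []            r g e = ≡.sym (ℤP.+-identityˡ _)
act-++ ((c , i) ∷ p) r g e = ≡.trans (≡.cong (λ z → c ℤ.* g (e ℤ.- i) ℤ.+ z) (act-++ p r g e)) (≡.sym (ℤP.+-assoc (c ℤ.* g (e ℤ.- i)) _ _))

-- Stated for any t satisfying its equation because the pattern-matching λ inside _*L_ cannot be named.
module _ (c i : ℤ) {t : ℤ × ℤ → ℤ × ℤ} (t-def : ∀ d f → t (d , f) ≡ (c ℤ.* d , i ℤ.+ f)) where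
  coeffL-term : ∀ r e → coeffL (map t r) e ≡ c ℤ.* coeffL r (e ℤ.- i)
  coeffL-term []            e = ≡.sym (ℤP.*-zeroʳ c)
  coeffL-term ((d , f) ∷ r) e rewrite t-def d f =
    ≡.trans (≡.cong₂ ℤ._+_ (δ-shift c d i f e) (coeffL-term r e)) (≡.sym (ℤP.*-distribˡ-+ c (δ d f (e ℤ.- i)) _))

  act-term : ∀ r g e → act (map t r) g e ≡ c ℤ.* act r g (e ℤ.- i)
  act-term []            g e = ≡.sym (ℤP.*-zeroʳ c)
  act-term ((d , f) ∷ r) g e rewrite t-def d f = ≡.trans
    (≡.cong₂ (λ j z → c ℤ.* d ℤ.* g j ℤ.+ z) (ind e i f) (act-term r g e)) (lem c d _ _)
    where
    ind : ∀ e i f → e ℤ.- (i ℤ.+ f) ≡ e ℤ.- i ℤ.- f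
    ind = solve-∀
    lem : ∀ c d x y → c ℤ.* d ℤ.* x ℤ.+ c ℤ.* y ≡ c ℤ.* (d ℤ.* x ℤ.+ y)
    lem = solve-∀

coeffL-* : ∀ p r e → coeffL (p *L r) e ≡ act p (coeffL r) e
coeffL-* []            r e = ≡.refl
coeffL-* ((c , i) ∷ p) r e = ≡.trans (coeffL-++ (map _ r) (p *L r) e)
  (≡.cong₂ ℤ._+_ (coeffL-term c i (λ _ _ → ≡.refl) r e) (coeffL-* p r e))

act-* : ∀ p r g e → act (p *L r) g e ≡ act p (act r g) e
act-* []            r g e = ≡.refl
act-* ((c , i) ∷ p) r g e = ≡.trans (act-++ (map _ r) (p *L r) g e)
  (≡.cong₂ ℤ._+_ (act-term c i (λ _ _ → ≡.refl) r g e) (act-* p r g e))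

-- By bilinearity the claim comes down to two monomials, where it is `δ-flip`.
act-comm : ∀ p r e → act p (coeffL r) e ≡ act r (coeffL p) e
act-comm [] r e = ≡.sym (act-0 r e)
  where
  act-0 : ∀ r e → act r (λ _ → 0ℤ) e ≡ 0ℤ
  act-0 []            e = ≡.refl
  act-0 ((d , j) ∷ r) e = ≡.cong₂ ℤ._+_ (ℤP.*-zeroʳ d) (act-0 r e)
act-comm ((c , i) ∷ p) r e = ≡.trans
  (≡.cong₂ ℤ._+_ (≡.sym (act-δ r)) (act-comm p r e)) (≡.sym (act-+ r (δ c i) (coeffL p) e))
  where
  act-δ : ∀ r → act r (δ c i) e ≡ c ℤ.* coeffL r (e ℤ.- i)
  act-δ []            = ≡.sym (ℤP.*-zeroʳ c)
  act-δ ((d , j) ∷ r) = ≡.trans (≡.cong₂ ℤ._+_ (δ-flip c d i j e) (act-δ r))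
    (≡.sym (ℤP.*-distribˡ-+ c (δ d j (e ℤ.- i)) _))

*L-comm : ∀ p r → (p *L r) ≈L (r *L p)
*L-comm p r e = ≡.trans (coeffL-* p r e) (≡.trans (act-comm p r e) (≡.sym (coeffL-* r p e)))

*L-congˡ : ∀ p {r r'} → r ≈L r' → (p *L r) ≈L (p *L r')
*L-congˡ p {r} {r'} eq e = ≡.trans (coeffL-* p r e) (≡.trans (act-cong p eq e) (≡.sym (coeffL-* p r' e)))

*L-assoc : ∀ p r s → ((p *L r) *L s) ≈L (p *L (r *L s))
*L-assoc p r s e = ≡.trans (coeffL-* (p *L r) s e) (≡.trans (act-* p r (coeffL s) e)
  (≡.trans (act-cong p (λ i → ≡.sym (coeffL-* r s i)) e) (≡.sym (coeffL-* p (r *L s) e))))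

*L-identityˡ : ∀ p → (constL 1ℤ *L p) ≈L p
*L-identityˡ p e = ≡.trans (coeffL-* (constL 1ℤ) p e) (≡.trans (ℤP.+-identityʳ _)
  (≡.trans (ℤP.*-identityˡ _) (≡.cong (coeffL p) (ℤP.+-identityʳ e))))

*L-distribʳ : ∀ s p r → ((p +L r) *L s) ≈L ((p *L s) +L (r *L s))
*L-distribʳ s p r e = ≡.trans (coeffL-* (p ++ r) s e) (≡.trans (act-++ p r (coeffL s) e)
  (≡.trans (≡.cong₂ ℤ._+_ (≡.sym (coeffL-* p s e)) (≡.sym (coeffL-* r s e))) (≡.sym (coeffL-++ (p *L s) (r *L s) e))))

-- A record, so that both sides can be inferred from a proof.
infix 4 _≅_
record _≅_ (p r : Laur) : Set where
  constructor coeffwise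
  field at : p ≈L r
open _≅_ public

Laurᴿ : CommutativeRing 0ℓ 0ℓ
Laurᴿ = record
  { Carrier = Laur ; _≈_ = _≅_ ; _+_ = _+L_ ; _*_ = _*L_ ; -_ = negL ; 0# = [] ; 1# = constL 1ℤ
  ; isCommutativeRing = record
    { isRing = record
      { +-isAbelianGroup = record
        { isGroup = record
          { isMonoid = record
            { isSemigroup = record
              { isMagma = record
                { isEquivalence = record
                  { refl  = coeffwise λ _ → ≡.refl
                  ; sym   = λ p → coeffwise λ e → ≡.sym (at p e)
                  ; trans = λ p q → coeffwise λ e → ≡.trans (at p e) (at q e) }
                ; ∙-cong = λ {p} {p'} {r} {r'} eq eq' → coeffwise λ e → ≡.trans (coeffL-++ p r e)
                    (≡.trans (≡.cong₂ ℤ._+_ (at eq e) (at eq' e)) (≡.sym (coeffL-++ p' r' e))) }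
              ; assoc = λ p r s → coeffwise λ e → ≡.cong (λ l → coeffL l e) (LP.++-assoc p r s) }
            ; identity = (λ p → coeffwise λ e → ≡.refl) , (λ p → coeffwise λ e → ≡.cong (λ l → coeffL l e) (LP.++-identityʳ p)) }
          ; inverse = (λ p → coeffwise λ e → ≡.trans (coeffL-++ (negL p) p e) (≡.trans (≡.cong (λ z → z ℤ.+ coeffL p e) (coeffL-neg p e)) (ℤP.+-inverseˡ (coeffL p e))))
                    , (λ p → coeffwise λ e → ≡.trans (coeffL-++ p (negL p) e) (≡.trans (≡.cong (λ z → coeffL p e ℤ.+ z) (coeffL-neg p e)) (ℤP.+-inverseʳ (coeffL p e))))
          ; ⁻¹-cong = λ {p} {p'} eq → coeffwise λ e → ≡.trans (coeffL-neg p e) (≡.trans (≡.cong ℤ.-_ (at eq e)) (≡.sym (coeffL-neg p' e))) }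
        ; comm = λ p r → coeffwise λ e → ≡.trans (coeffL-++ p r e) (≡.trans (ℤP.+-comm (coeffL p e) (coeffL r e)) (≡.sym (coeffL-++ r p e))) }
      ; *-cong = λ {p} {p'} {r} {r'} eq eq' → coeffwise λ e → ≡.trans (*L-congˡ p (at eq') e)
          (≡.trans (*L-comm p r' e) (≡.trans (*L-congˡ r' (at eq) e) (*L-comm r' p' e)))
      ; *-assoc = λ p r s → coeffwise (*L-assoc p r s)
      ; *-identity = (λ p → coeffwise (*L-identityˡ p))
                   , (λ p → coeffwise λ e → ≡.trans (*L-comm p (constL 1ℤ) e) (*L-identityˡ p e))
      ; distrib = (λ s p r → coeffwise λ e → ≡.trans (*L-comm s (p ++ r) e) (≡.trans (*L-distribʳ s p r e)
                    (≡.trans (coeffL-++ (p *L s) (r *L s) e) (≡.trans (≡.cong₂ ℤ._+_ (*L-comm p s e) (*L-comm r s e))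
                      (≡.sym (coeffL-++ (s *L p) (s *L r) e))))))
                , (λ s p r → coeffwise (*L-distribʳ s p r)) }
    ; *-comm = λ p r → coeffwise (*L-comm p r) } }

open FractionRing Laurᴿ public

-- Cancellable Laurent polynomials.

regular-const : ∀ n → Regular (constL (+ suc n))
regular-const n a b (coeffwise eq) = coeffwise λ e → ≡.subst₂ (λ i j → coeffL a i ≡ coeffL b j) (ℤP.+-identityʳ e) (ℤP.+-identityʳ e)
  (ℤP.*-cancelˡ-≡ (+ suc n) _ _ (≡.trans (≡.sym (coeff a e)) (≡.trans (eq e) (coeff b e))))
  where
  coeff : ∀ a e → coeffL (constL (+ suc n) *L a) e ≡ + suc n ℤ.* coeffL a (e ℤ.- 0ℤ)
  coeff a e = ≡.trans (coeffL-* (constL (+ suc n)) a e) (ℤP.+-identityʳ _)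

private
  -- A crude bound on the support from below: no term, cancelled or not, has an exponent less than
  -- the negative of this number.
  low : Laur → ℕ
  low []            = 0
  low ((_ , f) ∷ p) = ℤ.∣ f ∣ ℕ.+ low p

  -∣i∣≤i : ∀ i → ℤ.- + ℤ.∣ i ∣ ℤ.≤ i
  -∣i∣≤i (+ n)    = ℤP.≤-trans (ℤP.neg-mono-≤ (ℤ.+≤+ z≤n)) (ℤ.+≤+ z≤n)
  -∣i∣≤i -[1+ n ] = ℤP.≤-refl

  low-spec : ∀ a e → e ℤ.< ℤ.- + low a → coeffL a e ≡ 0ℤ
  low-spec []            e lt = ≡.refl
  low-spec ((c , f) ∷ p) e lt with f ℤP.≟ e
  ... | yes ≡.refl = contradiction (ℤP.<-≤-trans lt (ℤP.≤-trans (ℤP.neg-mono-≤ (ℤ.+≤+ (ℕP.m≤m+n ℤ.∣ f ∣ (low p)))) (-∣i∣≤i f))) (ℤP.<-irrefl ≡.refl)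
  ... | no _       = ≡.trans (ℤP.+-identityˡ _) (low-spec p e (ℤP.<-≤-trans lt (ℤP.neg-mono-≤ (ℤ.+≤+ (ℕP.m≤n+m (low p) ℤ.∣ f ∣)))))

1-q^ : ℤ → Laur
1-q^ i = (1ℤ , 0ℤ) ∷ (-1ℤ , i) ∷ []

-- If (1 - q^s) d = 0 then the coefficients of d are s-periodic, hence 0 by finiteness of the support.
regular-1-q^ : ∀ m → Regular (1-q^ (+ suc m))
regular-1-q^ m a b (coeffwise eq) = coeffwise λ e → ℤP.i-j≡0⇒i≡j (coeffL a e) (coeffL b e)
  (≡.trans (periodic (N e) e) (≡.trans (≡.cong₂ ℤ._-_ (low-spec a _ (below e (low a) (ℕP.m≤m+n (low a) (low b)))) (low-spec b _ (below e (low b) (ℕP.m≤n+m (low b) (low a))))) ≡.refl))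
  where
  s = + suc m
  d : ℤ → ℤ
  d i = coeffL a i ℤ.- coeffL b i

  coeff : ∀ a i → coeffL (1-q^ s *L a) i ≡ coeffL a i ℤ.- coeffL a (i ℤ.- s)
  coeff a i = ≡.trans (coeffL-* (1-q^ s) a i) (≡.trans
    (lem (coeffL a (i ℤ.- 0ℤ)) (coeffL a (i ℤ.- s))) (≡.cong (λ j → coeffL a j ℤ.- coeffL a (i ℤ.- s)) (ℤP.+-identityʳ i)))
    where
    lem : ∀ x y → 1ℤ ℤ.* x ℤ.+ (-1ℤ ℤ.* y ℤ.+ 0ℤ) ≡ x ℤ.- y
    lem = solve-∀

  period : ∀ i → d i ≡ d (i ℤ.- s)
  period i = ≡.trans (lem₁ (coeffL a i) (coeffL b i) (coeffL a (i ℤ.- s)))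
    (≡.trans (≡.cong (λ z → z ℤ.+ (coeffL a (i ℤ.- s) ℤ.- coeffL b i)) (≡.trans (≡.sym (coeff a i)) (≡.trans (eq i) (coeff b i))))
      (lem₂ (coeffL b i) (coeffL b (i ℤ.- s)) (coeffL a (i ℤ.- s))))
    where
    lem₁ : ∀ x y z → x ℤ.- y ≡ x ℤ.- z ℤ.+ (z ℤ.- y)
    lem₁ = solve-∀
    lem₂ : ∀ y w z → y ℤ.- w ℤ.+ (z ℤ.- y) ≡ z ℤ.- w
    lem₂ = solve-∀

  periodic : ∀ n i → d i ≡ d (i ℤ.- + n ℤ.* s)
  periodic zero    i = ≡.cong d (lem i)
    where
    lem : ∀ i → i ≡ i ℤ.- + 0 ℤ.* s
    lem i = ≡.sym (≡.trans (≡.cong (λ z → i ℤ.- z) (ℤP.*-zeroˡ s)) (ℤP.+-identityʳ i))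
  periodic (suc n) i = ≡.trans (period i) (≡.trans (periodic n (i ℤ.- s)) (≡.cong d
    (≡.trans (lem i s (+ n)) (≡.cong (λ z → i ℤ.- z) (≡.sym (ℤP.suc-* (+ n) s))))))
    where
    lem : ∀ i s n → i ℤ.- s ℤ.- n ℤ.* s ≡ i ℤ.- (s ℤ.+ n ℤ.* s)
    lem = solve-∀

  -- Each period is at least 1, so this many of them lead from e to below the supports of both `a`
  -- and `b`.
  N : ℤ → ℕ
  N e = suc (ℤ.∣ e ∣ ℕ.+ (low a ℕ.+ low b))

  below : ∀ e l → l ℕ.≤ low a ℕ.+ low b → e ℤ.- + N e ℤ.* s ℤ.< ℤ.- + l
  below e l l≤ = ℤP.≤-<-trans
    (ℤP.≤-trans (ℤP.+-monoʳ-≤ e (ℤP.neg-mono-≤ N≤Ns)) (ℤP.+-monoˡ-≤ (ℤ.- + N e) (i≤∣i∣ e)))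
    (≡.subst (ℤ._< ℤ.- + l) (≡.sym final) (ℤP.neg-mono-< (ℤ.+<+ (s≤s l≤))))
    where
    N≤Ns : + N e ℤ.≤ + N e ℤ.* s
    N≤Ns = ≡.subst (+ N e ℤ.≤_) (ℤP.pos-* (N e) (suc m)) (ℤ.+≤+ (ℕP.m≤m*n (N e) (suc m)))
    final : + ℤ.∣ e ∣ ℤ.- + N e ≡ ℤ.- + suc (low a ℕ.+ low b)
    final = lem (+ ℤ.∣ e ∣) (+ (low a ℕ.+ low b))
      where
      lem : ∀ x y → x ℤ.- (1ℤ ℤ.+ (x ℤ.+ y)) ≡ ℤ.- (1ℤ ℤ.+ y)
      lem = solve-∀

q^ : ℤ → Laur
q^ = mono 1ℤ

constL-+ : ∀ i j → constL (i ℤ.+ j) ≅ (constL i +L constL j)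
constL-+ i j = coeffwise λ e → lem e
  where
  lem : ∀ e → δ (i ℤ.+ j) 0ℤ e ℤ.+ 0ℤ ≡ δ i 0ℤ e ℤ.+ (δ j 0ℤ e ℤ.+ 0ℤ)
  lem e with 0ℤ ℤP.≟ e
  ... | yes _ = ℤP.+-assoc i j 0ℤ
  ... | no _  = ≡.refl

constL-0 : constL 0ℤ ≅ []
constL-0 = coeffwise λ e → lem e
  where
  lem : ∀ e → δ 0ℤ 0ℤ e ℤ.+ 0ℤ ≡ 0ℤ
  lem e with 0ℤ ℤP.≟ e
  ... | yes _ = ≡.refl
  ... | no _  = ≡.refl

-- The recursion for the constants z.

zfactor : List ℕ → ℕ → ℕ
zfactor μ i = (i ℕ.^ mult i μ) ℕ.* (mult i μ) !

-- `zee` runs over part sizes up to the size of the partition, a range that changes when a part is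
-- added. A free cutoff lets two partitions be compared over one range; factors beyond the size are
-- 1.
zupTo : ℕ → List ℕ → ℕ
zupTo B μ = product (map (zfactor μ) (map suc (upTo B)))

zupTo-suc : ∀ B μ → zupTo (suc B) μ ≡ zupTo B μ ℕ.* zfactor μ (suc B)
zupTo-suc B μ = begin
  zupTo (suc B) μ                                               ≡⟨ ≡.cong (λ l → product (map (zfactor μ) (map suc l))) (LP.upTo-∷ʳ B) ⟨
  product (map (zfactor μ) (map suc (upTo B ++ B ∷ [])))        ≡⟨ ≡.cong (λ l → product (map (zfactor μ) l)) (LP.map-++ suc (upTo B) _) ⟩
  product (map (zfactor μ) (map suc (upTo B) ++ suc B ∷ []))    ≡⟨ ≡.cong product (LP.map-++ (zfactor μ) (map suc (upTo B)) _) ⟩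
  product (map (zfactor μ) (map suc (upTo B)) ++ zfactor μ (suc B) ∷ []) ≡⟨ product-++ (map (zfactor μ) (map suc (upTo B))) _ ⟩
  zupTo B μ ℕ.* (zfactor μ (suc B) ℕ.* 1)                       ≡⟨ ≡.cong (zupTo B μ ℕ.*_) (ℕP.*-identityʳ _) ⟩
  zupTo B μ ℕ.* zfactor μ (suc B)                               ∎
  where open ≡.≡-Reasoning

zupTo-large : ∀ d μ → zupTo (d ℕ.+ sum μ) μ ≡ zee μ
zupTo-large zero    μ = ≡.refl
zupTo-large (suc d) μ = ≡.trans (zupTo-suc (d ℕ.+ sum μ) μ) (≡.trans
  (≡.cong₂ ℕ._*_ (zupTo-large d μ) (≡.cong (λ m → (i ℕ.^ m) ℕ.* m !) (mult-absent absent)))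
  (ℕP.*-identityʳ _))
  where
  i = suc (d ℕ.+ sum μ)
  absent : All (_≢ i) μ
  absent = All.map (λ p≤ p≡i → ℕP.<⇒≱ (s≤s (ℕP.m≤n+m (sum μ) d)) (≡.subst (_≤ sum μ) p≡i p≤)) (parts≤sum μ)

zfactor-there : ∀ {p i} ν → p ≢ i → zfactor (p ∷ ν) i ≡ zfactor ν i
zfactor-there {i = i} ν p≢i = ≡.cong (λ m → (i ℕ.^ m) ℕ.* m !) (mult-there ν p≢i)

zfactor-here : ∀ p ν → zfactor (p ∷ ν) p ≡ p ℕ.* suc (mult p ν) ℕ.* zfactor ν p
zfactor-here p ν = ≡.trans (≡.cong (λ m → (p ℕ.^ m) ℕ.* m !) (mult-here p ν)) (lem p (p ℕ.^ mult p ν) (mult p ν) (mult p ν !))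
  where
  lem : ∀ p P m f → p ℕ.* P ℕ.* (f ℕ.+ m ℕ.* f) ≡ p ℕ.* (1 ℕ.+ m) ℕ.* (P ℕ.* f)
  lem = solve-∀ℕ

zupTo-below : ∀ B p ν → B < p → zupTo B (p ∷ ν) ≡ zupTo B ν
zupTo-below zero    p ν _   = ≡.refl
zupTo-below (suc B) p ν B<p = ≡.trans (zupTo-suc B (p ∷ ν)) (≡.trans
  (≡.cong₂ ℕ._*_ (zupTo-below B p ν (ℕP.<-trans (ℕP.n<1+n B) B<p)) (zfactor-there ν (λ e → ℕP.<⇒≢ B<p (≡.sym e))))
  (≡.sym (zupTo-suc B ν)))

zupTo-∷ : ∀ B p ν → suc p ≤ B → zupTo B (suc p ∷ ν) ≡ suc p ℕ.* suc (mult (suc p) ν) ℕ.* zupTo B ν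
zupTo-∷ (suc B) p ν p≤B with ℕP.m≤n⇒m<n∨m≡n p≤B
... | inj₂ ≡.refl = begin
  zupTo (suc p) (suc p ∷ ν)                                ≡⟨ zupTo-suc p (suc p ∷ ν) ⟩
  zupTo p (suc p ∷ ν) ℕ.* zfactor (suc p ∷ ν) (suc p)      ≡⟨ ≡.cong₂ ℕ._*_ (zupTo-below p (suc p) ν ℕP.≤-refl) (zfactor-here (suc p) ν) ⟩
  zupTo p ν ℕ.* (N ℕ.* zfactor ν (suc p))                  ≡⟨ lem (zupTo p ν) N _ ⟩
  N ℕ.* (zupTo p ν ℕ.* zfactor ν (suc p))                  ≡⟨ ≡.cong (N ℕ.*_) (zupTo-suc p ν) ⟨
  N ℕ.* zupTo (suc p) ν                                    ∎
  where
  open ≡.≡-Reasoning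
  N = suc p ℕ.* suc (mult (suc p) ν)
  lem : ∀ a b c → a ℕ.* (b ℕ.* c) ≡ b ℕ.* (a ℕ.* c)
  lem = solve-∀ℕ
... | inj₁ p<B = begin
  zupTo (suc B) (suc p ∷ ν)                                ≡⟨ zupTo-suc B (suc p ∷ ν) ⟩
  zupTo B (suc p ∷ ν) ℕ.* zfactor (suc p ∷ ν) (suc B)      ≡⟨ ≡.cong₂ ℕ._*_ (zupTo-∷ B p ν (ℕP.≤-pred p<B)) (zfactor-there ν (ℕP.<⇒≢ p<B)) ⟩
  N ℕ.* zupTo B ν ℕ.* zfactor ν (suc B)                    ≡⟨ ℕP.*-assoc N (zupTo B ν) (zfactor ν (suc B)) ⟩
  N ℕ.* (zupTo B ν ℕ.* zfactor ν (suc B))                  ≡⟨ ≡.cong (N ℕ.*_) (zupTo-suc B ν) ⟨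
  N ℕ.* zupTo (suc B) ν                                    ∎
  where
  open ≡.≡-Reasoning
  N = suc p ℕ.* suc (mult (suc p) ν)

zee-∷ : ∀ p ν → zee (suc p ∷ ν) ≡ suc p ℕ.* suc (mult (suc p) ν) ℕ.* zee ν
zee-∷ p ν = ≡.trans (zupTo-∷ (suc p ℕ.+ sum ν) p ν (ℕP.m≤m+n (suc p) (sum ν)))
  (≡.cong (suc p ℕ.* suc (mult (suc p) ν) ℕ.*_) (zupTo-large (suc p) ν))

zee≢0 : ∀ μ → NonZero (zee μ)
zee≢0 μ = product≢0 (AllP.map⁺ (AllP.map⁺ (All.universal (λ i → ℕP.m*n≢0 _ _ {{ℕP.m^n≢0 (suc i) (mult (suc i) μ)}} {{mult (suc i) μ ℕP.!≢0}}) (upTo (sum μ)))))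

-- Arithmetic of the splitting of the indices.

module Splitting where
  open import Data.Nat.Base using (_+_; _*_; _/_; _%_; _≡ᵇ_)
  open import Relation.Binary.PropositionalEquality using (refl; sym; trans; cong; subst)

  search-spec : ∀ (test : ℕ → Bool) (search : List ℕ → ℕ) →
    (∀ a as → search (a ∷ as) ≡ (if test a then a else search as)) →
    ∀ xs → Any (λ a → T (test a)) xs → search xs ∈ xs × T (test (search xs))
  search-spec test search eq (x ∷ xs) any rewrite eq x xs with test x in tx
  search-spec test search eq (x ∷ xs) any         | true  = here refl , subst T (sym tx) tt
  search-spec test search eq (x ∷ xs) (here t)    | false = contradiction (subst T tx t) λ ()
  search-spec test search eq (x ∷ xs) (there any) | false with search-spec test search eq xs any
  ... | in-xs , t = there in-xs , t

  -- The local search function of findA has no name: its definition is recovered by unification.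
  mutual
    findA-search : ℕ → ℕ → List ℕ → ℕ
    findA-search m n xs = _

    findA-unfold : ∀ m n → findA-search m n (map suc (upTo m)) ≡ findA m n
    findA-unfold m n with map suc (upTo m)
    ... | xs = refl

  findA-spec : ∀ m n → Any (λ a → T (((n * a) mod m) ≡ᵇ (1 mod m))) (map suc (upTo m)) →
               findA m n ∈ map suc (upTo m) × T (((n * findA m n) mod m) ≡ᵇ (1 mod m))
  findA-spec m n = search-spec (λ a → ((n * a) mod m) ≡ᵇ (1 mod m)) (findA-search m n) (λ _ _ → refl) (map suc (upTo m))

  reduce-mod : ∀ k n a → let m = suc (suc k) in (n * a) % m ≡ 1 % m →
               ∃ λ a → 1 ≤ a × a ≤ m × (n * a) % m ≡ 1 % m
  reduce-mod k n a eq = a % m , ℕP.n≢0⇒n>0 nonzero , ℕP.<⇒≤ (m%n<n a m) , eq'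
    where
    m = suc (suc k)
    eq' : (n * (a % m)) % m ≡ 1 % m
    eq' = trans (%-distribˡ-* n (a % m) m) (trans (cong (λ z → (n % m * z) % m) (m%n%n≡m%n a m)) (trans (sym (%-distribˡ-* n a m)) eq))
    nonzero : a % m ≢ 0
    nonzero a≡0 = contradiction (trans (sym (m<n⇒m%n≡m {m = 1} (s≤s (s≤s (z≤n {k}))))) (trans (sym eq')
      (trans (cong (λ z → (n * z) % m) a≡0) (cong (_% m) (ℕP.*-zeroʳ n))))) λ ()

  inverse-mod : ∀ m .{{_ : NonZero m}} n → Coprime m n → ∃ λ a → 1 ≤ a × a ≤ m × (n * a) % m ≡ 1 % m
  inverse-mod (suc zero) n _ = 1 , ℕP.≤-refl , ℕP.≤-refl , trans (n%1≡0 (n * 1)) (sym (n%1≡0 1))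
  inverse-mod m@(suc (suc k)) n coprime with coprime-Bézout coprime
  ... | Bézout.-+ x y eq = reduce-mod k n y (trans (cong (_% m) (trans (ℕP.*-comm n y) (sym eq))) ([m+kn]%n≡m%n 1 x m))
  -- Here y n is -1 modulo m, so the inverse is -y, represented by y (m - 1).
  ... | Bézout.+- x y eq = reduce-mod k n (y * suc k) (begin
      (n * (y * suc k)) % m                ≡⟨ [m+kn]%n≡m%n (n * (y * suc k)) 1 m ⟨
      (n * (y * suc k) + 1 * m) % m        ≡⟨ cong (_% m) (trans (lem n y k) (trans (cong (λ z → 1 + suc k * z) eq) (cong suc (sym (ℕP.*-assoc (suc k) x m))))) ⟩
      (1 + suc k * x * m) % m              ≡⟨ [m+kn]%n≡m%n 1 (suc k * x) m ⟩
      1 % m                                ∎)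
    where
    open ≡.≡-Reasoning
    lem : ∀ n y k → n * (y * suc k) + 1 * suc (suc k) ≡ 1 + suc k * (1 + y * n)
    lem = solve-∀ℕ

  findA-inverse : ∀ m .{{_ : NonZero m}} n → 1 ≤ n → Coprime m n → let a = findA m n; b = (n * a ∸ 1) div m in
                  1 ≤ a × a ≤ m × n * a ≡ 1 + m * b
  findA-inverse m@(suc m-1) n 1≤n coprime with inverse-mod m n coprime
  ... | suc a₀ , _ , a₀≤m , eq₀ with findA-spec m n (lose (∈-map⁺ suc (∈-upTo⁺ a₀≤m)) (ℕP.≡⇒≡ᵇ _ _ eq₀))
  ...   | in-range , test with ∈-map⁻ suc in-range
  ...     | i , i∈ , a≡ = 1≤a , subst (_≤ m) (sym a≡) (∈-upTo⁻ i∈) ,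
              trans (proj₂ k-spec) (cong suc (trans (ℕP.*-comm k m) (cong (m *_) (sym b≡k))))
    where
    a = findA m n
    1≤a : 1 ≤ a
    1≤a = subst (1 ≤_) (sym a≡) (s≤s z≤n)
    mod-eq : (n * a) % m ≡ 1 % m
    mod-eq = ℕP.≡ᵇ⇒≡ _ _ test
    quotient : ∀ m-1 c → 1 ≤ c → c % suc m-1 ≡ 1 % suc m-1 → ∃ λ k → c ≡ 1 + k * suc m-1
    -- Modulo 1 the congruence carries no information; positivity of c supplies the quotient.
    quotient zero    (suc c) _ _  = c , cong suc (sym (ℕP.*-identityʳ c))
    quotient (suc l) c       _ eq = c / suc (suc l) , trans (m≡m%n+[m/n]*n c (suc (suc l)))
      (cong (λ z → z + c / suc (suc l) * suc (suc l)) (trans eq (m<n⇒m%n≡m {m = 1} (s≤s (s≤s (z≤n {l}))))))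
    k-spec : ∃ λ k → n * a ≡ 1 + k * m
    k-spec = quotient m-1 (n * a) (ℕP.*-mono-≤ 1≤n 1≤a) mod-eq
    k = proj₁ k-spec
    b≡k : (n * a ∸ 1) div m ≡ k
    b≡k = trans (cong (λ c → (c ∸ 1) / m) (proj₂ k-spec)) (m*n/n≡m k m)

  -- Both (a, b) and (M - a, N - b) are primitive even if (M, N) is not. The recursion thus passes
  -- at once to coprime indices, and gcd M N survives only as the determinant.
  record Splits (M N a b : ℕ) : Set where
    field
      1≤a       : 1 ≤ a
      a<M       : a < M
      b<N       : b < N
      det       : N * a ≡ gcd M N + M * b
      coprime₁  : gcd a b ≡ 1
      coprime₂  : gcd (M ∸ a) (N ∸ b) ≡ 1

  det-shift : ∀ {M N a b} → Splits M N a b → a * (N ∸ b) ≡ (M ∸ a) * b + gcd M N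
  det-shift {M} {N} {a} {b} sp = ℕP.+-cancelʳ-≡ (a * b) _ _ (begin
    a * (N ∸ b) + a * b             ≡⟨ ℕP.*-distribˡ-+ a (N ∸ b) b ⟨
    a * (N ∸ b + b)                 ≡⟨ cong (a *_) (ℕP.m∸n+n≡m (ℕP.<⇒≤ b<N)) ⟩
    a * N                           ≡⟨ trans (ℕP.*-comm a N) det ⟩
    gcd M N + M * b                 ≡⟨ cong (λ w → gcd M N + w * b) (sym (ℕP.m∸n+n≡m (ℕP.<⇒≤ a<M))) ⟩
    gcd M N + (M ∸ a + a) * b       ≡⟨ lem (gcd M N) (M ∸ a) a b ⟩
    (M ∸ a) * b + gcd M N + a * b   ∎)
    where
    open Splits sp
    open ≡.≡-Reasoning
    lem : ∀ g x a b → g + (x + a) * b ≡ x * b + g + a * b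
    lem = solve-∀ℕ

  coprime-det : ∀ x y a b → x * a ≡ 1 + y * b → gcd a b ≡ 1
  coprime-det x y a b eq = ∣1⇒≡1 (∣m+n∣m⇒∣n
    (subst (gcd a b ∣_) (trans eq (ℕP.+-comm 1 (y * b))) (∣n⇒∣m*n x (gcd[m,n]∣m a b))) (∣n⇒∣m*n y (gcd[m,n]∣n a b)))

  div≡/ : ∀ x g .{{_ : NonZero g}} → x div g ≡ x / g
  div≡/ x (suc g) = refl

  splitting : ∀ M N → 2 ≤ M → 1 ≤ N → let g = gcd M N; m' = M div g; n' = N div g; a = findA m' n' in
           Splits M N a ((n' * a ∸ 1) div m')
  splitting M N 2≤M 1≤N = record
    { 1≤a = 1≤a ; a<M = a<M ; b<N = b<N ; det = det ; coprime₁ = coprime-det n' m' a b n'a≡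
    ; coprime₂ = trans (gcd-comm (M ∸ a) (N ∸ b)) (coprime-det m' n' (N ∸ b) (M ∸ a) complement) }
    where
    open ≡.≡-Reasoning
    instance
      M≢0 : NonZero M
      M≢0 = ℕ.>-nonZero (ℕP.<⇒≤ 2≤M)
      g≢0 : NonZero (gcd M N)
      g≢0 = ℕ.≢-nonZero (gcd[m,n]≢0 M N (inj₁ (ℕP.>⇒≢ (ℕP.<⇒≤ 2≤M))))
    g  = gcd M N
    m' = M div g
    n' = N div g
    M≡ : M ≡ m' * g
    M≡ = sym (trans (cong (_* g) (div≡/ M g)) (m/n*n≡m (gcd[m,n]∣m M N)))
    N≡ : N ≡ n' * g
    N≡ = sym (trans (cong (_* g) (div≡/ N g)) (m/n*n≡m (gcd[m,n]∣n M N)))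
    1≤m' : 1 ≤ m'
    1≤m' = ℕP.n≢0⇒n>0 (λ m'≡0 → ℕP.>⇒≢ (ℕP.<⇒≤ 2≤M) (trans M≡ (cong (_* g) m'≡0)))
    1≤n' : 1 ≤ n'
    1≤n' = ℕP.n≢0⇒n>0 (λ n'≡0 → ℕP.>⇒≢ 1≤N (trans N≡ (cong (_* g) n'≡0)))
    coprime' : Coprime m' n'
    coprime' = ≡.subst₂ Coprime (sym (div≡/ M g)) (sym (div≡/ N g)) (coprime-/gcd M N)
    instance
      m'≢0 : NonZero m'
      m'≢0 = ℕ.>-nonZero 1≤m'
    spec = findA-inverse m' n' 1≤n' coprime'
    a    = findA m' n'
    b    = (n' * a ∸ 1) div m'
    1≤a  = proj₁ spec
    a≤m' = proj₁ (proj₂ spec)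
    n'a≡ : n' * a ≡ 1 + m' * b
    n'a≡ = proj₂ (proj₂ spec)
    1≤g : 1 ≤ g
    1≤g = ℕP.n≢0⇒n>0 (ℕ.≢-nonZero⁻¹ g)

    det : N * a ≡ g + M * b
    det = begin
      N * a               ≡⟨ cong (_* a) N≡ ⟩
      n' * g * a          ≡⟨ lem₁ n' g a ⟩
      g * (n' * a)        ≡⟨ cong (g *_) n'a≡ ⟩
      g * (1 + m' * b)    ≡⟨ lem₂ g m' b ⟩
      g + m' * g * b      ≡⟨ cong (λ z → g + z * b) M≡ ⟨
      g + M * b           ∎
      where
      lem₁ : ∀ n g a → n * g * a ≡ g * (n * a)
      lem₁ = solve-∀ℕ
      lem₂ : ∀ g m b → g * (1 + m * b) ≡ g + m * g * b
      lem₂ = solve-∀ℕ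

    b<N : b < N
    b<N = ℕP.<-≤-trans (ℕP.*-cancelˡ-< m' b n' (ℕP.≤-trans (ℕP.≤-reflexive (sym n'a≡))
      (ℕP.≤-trans (ℕP.*-monoʳ-≤ n' a≤m') (ℕP.≤-reflexive (ℕP.*-comm n' m')))))
      (ℕP.≤-trans (ℕP.m≤m*n n' g) (ℕP.≤-reflexive (sym N≡)))

    a<M : a < M
    a<M with ℕP.m≤n⇒m<n∨m≡n (ℕP.≤-trans a≤m' (ℕP.≤-trans (ℕP.m≤m*n m' g) (ℕP.≤-reflexive (sym M≡))))
    ... | inj₁ lt = lt
    -- Since a is at most m', equality with M forces the gcd to be 1; then M divides both N a = 1 +
    -- M b and M b, hence 1.
    ... | inj₂ a≡M = contradiction (∣1⇒≡1 (∣m+n∣m⇒∣n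
        (subst (M ∣_) (trans det (trans (cong (λ z → z + M * b) g≡1) (ℕP.+-comm 1 (M * b)))) (subst (λ z → M ∣ N * z) (sym a≡M) (∣n⇒∣m*n N ∣-refl)))
        (∣m⇒∣m*n b ∣-refl))) (ℕP.>⇒≢ 2≤M)
      where
      g≡1 : g ≡ 1
      g≡1 = ℕP.≤-antisym (ℕP.*-cancelˡ-≤ m' (ℕP.≤-trans (ℕP.≤-reflexive (sym M≡))
        (ℕP.≤-trans (ℕP.≤-reflexive (sym a≡M)) (ℕP.≤-trans a≤m' (ℕP.≤-reflexive (sym (ℕP.*-identityʳ m'))))))) 1≤g

    -- As (M, N) is a multiple of (m', n'), subtracting (a, b) from it changes only the sign of the
    -- determinant against (m', n'), which stays a unit and proves the second coprimality.
    complement : m' * (N ∸ b) ≡ 1 + n' * (M ∸ a)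
    complement = ℕP.+-cancelʳ-≡ (m' * b) _ _ (begin
      m' * (N ∸ b) + m' * b        ≡⟨ ℕP.*-distribˡ-+ m' (N ∸ b) b ⟨
      m' * (N ∸ b + b)             ≡⟨ cong (m' *_) (trans (ℕP.m∸n+n≡m (ℕP.<⇒≤ b<N)) N≡) ⟩
      m' * (n' * g)                ≡⟨ lem m' n' g ⟩
      n' * (m' * g)                ≡⟨ cong (n' *_) (trans (sym M≡) (sym (ℕP.m∸n+n≡m (ℕP.<⇒≤ a<M)))) ⟩
      n' * (M ∸ a + a)             ≡⟨ ℕP.*-distribˡ-+ n' (M ∸ a) a ⟩
      n' * (M ∸ a) + n' * a        ≡⟨ cong (λ z → n' * (M ∸ a) + z) n'a≡ ⟩
      n' * (M ∸ a) + (1 + m' * b)  ≡⟨ lem₂ (n' * (M ∸ a)) (m' * b) ⟩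
      1 + n' * (M ∸ a) + m' * b    ∎)
      where
      lem : ∀ m n g → m * (n * g) ≡ n * (m * g)
      lem = solve-∀ℕ
      lem₂ : ∀ x y → x + (1 + y) ≡ 1 + x + y
      lem₂ = solve-∀ℕ

open Splitting

-- Specialisation to fractions of Laurent polynomials in q.

module KLaur = CommutativeRing Laurᴿ
module KKit = Kit fracRing
open KKit
open import Relation.Binary.Reasoning.Setoid setoid
open Scalars fracRing

regular-ℕ : ∀ n → .{{NonZero n}} → Regular (constL (+ n))
regular-ℕ (suc n) = regular-const n

fromℤ-const : ∀ n → fromℤ (+ n) ≈ ι (constL (+ n))
fromℤ-const zero    = ι-cong (KLaur.sym constL-0)
fromℤ-const (suc n) = begin
  fromℤ (+ suc n)                       ≈⟨ fromℤ-+ (+ 1) (+ n) ⟩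
  1# + fromℤ (+ n)                      ≈⟨ +-congˡ (fromℤ-const n) ⟩
  ι (constL 1ℤ) + ι (constL (+ n))      ≈⟨ ι-+ (constL 1ℤ) (constL (+ n)) ⟨
  ι (constL 1ℤ +L constL (+ n))         ≈⟨ ι-cong (constL-+ 1ℤ (+ n)) ⟨
  ι (constL (+ suc n))                  ∎

recip : ℕ → Frac
recip zero    = 0#
recip (suc n) = frac (constL 1ℤ) (constL (+ suc n)) (regular-const n)

recip-inverse : ∀ n → fromℤ (+ suc n) * recip (suc n) ≈ 1#
recip-inverse n = trans (*-congʳ (fromℤ-const (suc n))) (frac-inv _ (regular-const n))

invZ : List ℕ → Frac
invZ μ = frac (constL 1ℤ) (constL (+ zee μ)) (regular-ℕ (zee μ) {{zee≢0 μ}})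

invZ-∷ : ∀ k ν → fromℤ (+ (suc k ℕ.* suc (mult (suc k) ν))) * invZ (suc k ∷ ν) ≈ invZ ν
invZ-∷ k ν = begin
  fromℤ (+ N) * invZ (suc k ∷ ν)   ≈⟨ *-congʳ (fromℤ-const N) ⟩
  ι (constL (+ N)) * invZ (suc k ∷ ν)
    ≈⟨ cross (KLaur.reflexive (≡.cong constL (≡.trans (lem (+ N) (+ zee ν)) (≡.trans (≡.cong (λ z → + 1 ℤ.* z) (≡.trans (≡.sym (ℤP.pos-* N (zee ν))) (≡.cong +_ (≡.sym (zee-∷ k ν))))) (lem' (+ zee (suc k ∷ ν))))))) ⟩
  invZ ν                           ∎
  where
  N = suc k ℕ.* suc (mult (suc k) ν)
  lem : ∀ N z → N ℤ.* + 1 ℤ.* z ≡ + 1 ℤ.* (N ℤ.* z)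
  lem = solve-∀
  lem' : ∀ z → + 1 ℤ.* z ≡ + 1 ℤ.* (+ 1 ℤ.* z)
  lem' = solve-∀

qK : ℤ → Frac
qK i = ι (q^ i)

-- The value at 0 is a default, as 1 - q^0 has no inverse.
inv1-q^ : ℕ → Frac
inv1-q^ zero    = 0#
inv1-q^ (suc u) = frac (constL 1ℤ) (1-q^ (+ suc u)) (regular-1-q^ u)

1-qK : ∀ i → ι (1-q^ i) ≈ 1# - qK i
1-qK i = trans (ι-+ (constL 1ℤ) (negL (q^ i))) (+-congˡ (ι-neg (q^ i)))

inv1-q^-inverse : ∀ u → (1# - qK (+ suc u)) * inv1-q^ (suc u) ≈ 1#
inv1-q^-inverse u = trans (*-congʳ (sym (1-qK (+ suc u)))) (frac-inv _ (regular-1-q^ u))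

qK-0 : qK (+ 0) ≈ 1#
qK-0 = refl

qK-+ : ∀ i j → qK (i ℤ.+ j) ≈ qK i * qK j
qK-+ i j = ι-* (q^ i) (q^ j)

qPower : QPower fracRing
qPower = record { x = qK ; x-0 = qK-0 ; x-+ = qK-+ }

open QuantumIntegers fracRing qPower

qbr-qsum : ∀ u i → ι (qbrPos u i) ≈ qsum u i
qbr-qsum zero    i = refl
qbr-qsum (suc u) i = trans (ι-+ (q^ (i ℤ.* + u)) (qbrPos u i)) (+-congˡ (qbr-qsum u i))

shK alK : ℕ → ℕ → Frac
shK u k = ι ((1-q^ (ℤ.- + k) *L 1-q^ (+ k)) *L qbrPos u (+ k))
alK u k = - ι (qbrPos u (ℤ.- + k))

shK-def : ∀ u k → shK u k ≈ (1# - qK (ℤ.- + k)) * (1# - qK (+ k)) * qsum u (+ k)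
shK-def u k = trans (ι-* (1-q^ (ℤ.- + k) *L 1-q^ (+ k)) (qbrPos u (+ k)))
  (*-cong (trans (ι-* (1-q^ (ℤ.- + k)) (1-q^ (+ k))) (*-cong (1-qK (ℤ.- + k)) (1-qK (+ k)))) (qbr-qsum u (+ k)))

alK-def : ∀ u k → alK u k ≈ - qsum u (ℤ.- + k)
alK-def u k = -‿cong (qbr-qsum u (ℤ.- + k))

weighting : Weighting shK alK
weighting = record { sh-def = shK-def ; al-def = alK-def }

open Weights shK alK weighting

weights : PartitionWeights fracRing
weights = record { inv = recip ; inv-spec = recip-inverse ; iz = invZ ; iz-[] = cross KLaur.refl ; iz-∷ = invZ-∷ }

torus : TorusData fracRing
torus = record
  { x = qK ; x-0 = qK-0 ; x-+ = qK-+ ; e = inv1-q^ ; e-inv = inv1-q^-inverse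
  ; sh = shK ; al = alK ; sh-+ = sh-+ ; al-+ = al-+ ; sh-al = sh-al }

open QuantumTorus fracRing weights torus

-- Lifting symmetric functions and operators to cancellable coefficients.

toK : Frac → K
toK c = num c ⁄ den c

≈⇒≈K : ∀ {x y} → x ≈ y → toK x ≈K toK y
≈⇒≈K p = at (uncross p)

-- Lifts are required to match the given operations under `strip` up to propositional equality,
-- which can be substituted anywhere; no congruence of the given operators for `_≈S_` has to be
-- established.
SymF : Set
SymF = List (Frac × List ℕ)

strip : SymF → Sym
strip = map (λ t → toK (proj₁ t) , proj₂ t)

eval : SymF → Fn → Frac
eval F φ = Σ⟨ F ⟩ (λ t → proj₁ t * φ (proj₂ t))

-- Equality of all functionals gives equality of coefficients: use the indicator of mu.
eval-coeff : ∀ F G → (∀ φ → eval F φ ≈ eval G φ) → strip F ≈S strip G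
eval-coeff F G eq mu = ≡.subst₂ _≈K_ (coeffF-toK F) (coeffF-toK G)
  (≈⇒≈K (trans (coeffF-eval F) (trans (eq indicator) (sym (coeffF-eval G)))))
  where
  indicator : Fn
  indicator nu = if ⌊ LP.≡-dec ℕP._≟_ nu mu ⌋ then 1# else 0#

  coeffF : SymF → Frac
  coeffF []             = 0#
  coeffF ((c , nu) ∷ F) = (if ⌊ LP.≡-dec ℕP._≟_ nu mu ⌋ then c else 0#) + coeffF F

  if-toK : ∀ b c → toK (if b then c else 0#) ≡ (if b then toK c else 0K)
  if-toK true  c = ≡.refl
  if-toK false c = ≡.refl

  coeffF-toK : ∀ F → toK (coeffF F) ≡ coeffS (strip F) mu
  coeffF-toK []             = ≡.refl
  coeffF-toK ((c , nu) ∷ F) = ≡.cong₂ _+K_ (if-toK ⌊ LP.≡-dec ℕP._≟_ nu mu ⌋ c) (coeffF-toK F)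

  if-* : ∀ b c → (if b then c else 0#) ≈ c * (if b then 1# else 0#)
  if-* true  c = sym (*-identityʳ c)
  if-* false c = sym (zeroʳ c)

  coeffF-eval : ∀ F → coeffF F ≈ eval F indicator
  coeffF-eval []             = refl
  coeffF-eval ((c , nu) ∷ F) = +-cong (if-* ⌊ LP.≡-dec ℕP._≟_ nu mu ⌋ c) (coeffF-eval F)

scaleF : Frac → SymF → SymF
scaleF c = map (λ t → c * proj₁ t , proj₂ t)

strip-scale : ∀ c F → strip (scaleF c F) ≡ scaleS (toK c) (strip F)
strip-scale c []      = ≡.refl
strip-scale c (t ∷ F) = ≡.cong (_ ∷_) (strip-scale c F)

eval-scale : ∀ c F φ → eval (scaleF c F) φ ≈ c * eval F φ
eval-scale c F φ = trans (reflexive (Σ-map _ _ F)) (trans (Σ-cong F (λ t → *-assoc c (proj₁ t) _)) (sym (*-Σ c _ F)))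

commF : (SymF → SymF) → (SymF → SymF) → SymF → SymF
commF A B F = A (B F) ++ scaleF (- 1#) (B (A F))

eval-comm : ∀ A B F φ → eval (commF A B F) φ ≈ eval (A (B F)) φ - eval (B (A F)) φ
eval-comm A B F φ = trans (Σ-++ _ (A (B F)) _) (+-congˡ (trans (eval-scale (- 1#) (B (A F)) φ)
  (trans (sym (-‿distribˡ-* 1# _)) (-‿cong (*-identityˡ _)))))

Π-toK : ∀ {f} g → (∀ k → toK (g k) ≡ f k) → ∀ S → toK (Π⟨ S ⟩ g) ≡ prodK (map f S)
Π-toK g eq []      = ≡.refl
Π-toK g eq (k ∷ S) = ≡.cong₂ _*K_ (eq k) (Π-toK g eq S)

hF : ℕ → (ℕ → Frac) → SymF
hF j a = map (λ mu → invZ mu * Π⟨ mu ⟩ a , mu) (partitions j)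

hPartF : ℕ → ℤ → Frac → List ℕ → SymF
hPartF u (+ j)    c R = map (λ t → c * proj₁ t , mergeP R (proj₂ t)) (hF j (alK u))
hPartF u -[1+ _ ] c R = []

DF : ℕ → ℤ → SymF → SymF
DF u v = concatMap λ t → concatMap
  (λ SR → hPartF u (v ℤ.+ + sum (proj₁ SR)) (proj₁ t * Π⟨ proj₁ SR ⟩ (shK u)) (proj₂ SR)) (splits (proj₂ t))

strip-hPart : ∀ u v c R → strip (hPartF u v c R) ≡ hPart (+ u) v (toK c) R
strip-hPart u -[1+ _ ] c R = ≡.refl
strip-hPart u (+ j)    c R = ≡.trans (go (partitions j)) (≡.sym (LP.++-identityʳ _))
  where
  go : ∀ ps → strip (map (λ t → c * proj₁ t , mergeP R (proj₂ t)) (map (λ mu → invZ mu * Π⟨ mu ⟩ (alK u) , mu) ps)) ≡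
              map _ (map (λ mu → invZee mu *K prodK (map (minusUt (+ u)) mu) , mu) ps)
  go []        = ≡.refl
  go (mu ∷ ps) = ≡.cong₂ _∷_
    (≡.cong (λ z → toK c *K (invZee mu *K z) , mergeP R mu) (Π-toK (alK u) (λ _ → ≡.refl) mu)) (go ps)

strip-D : ∀ u v F → strip (DF u v F) ≡ D (+ u) v (strip F)
strip-D u v F = ≡.trans (LP.map-concatMap _ _ F) (≡.trans (LP.concatMap-cong term F) (≡.sym (LP.concatMap-map _ _ F)))
  where
  term : ∀ t → strip (concatMap (λ SR → hPartF u (v ℤ.+ + sum (proj₁ SR)) (proj₁ t * Π⟨ proj₁ SR ⟩ (shK u)) (proj₂ SR)) (splits (proj₂ t))) ≡
         concatMap _ (splits (proj₂ t))
  term (c , lam) = ≡.trans (LP.map-concatMap _ _ (splits lam)) (LP.concatMap-cong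
    (λ { (S , R) → ≡.trans (strip-hPart u (v ℤ.+ + sum S) (c * Π⟨ S ⟩ (shK u)) R)
      (≡.cong (λ z → hPart (+ u) (v ℤ.+ + sum S) (toK c *K z) R) (Π-toK (shK u) (λ _ → ≡.refl) S)) }) (splits lam))

eval-hPart : ∀ u v c R φ → eval (hPartF u v c R) φ ≈ c * h (alK u) v (φ ∘ mergeP R)
eval-hPart u -[1+ _ ] c R φ = sym (zeroʳ c)
eval-hPart u (+ j)    c R φ = trans (reflexive (≡.trans (Σ-map _ _ (hF j (alK u))) (Σ-map _ _ (partitions j))))
  (trans (Σ-cong (partitions j) (λ mu → *-assoc c _ _)) (sym (*-Σ c _ (partitions j))))

private
  splitTerm : ℕ → ℤ → Fn → List ℕ × List ℕ → Frac
  splitTerm u v φ (S , R) = Π⟨ S ⟩ (shK u) * h (alK u) (v ℤ.+ + sum S) (φ ∘ mergeP R)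

  -- Each part either joins S, which raises the index of h and contributes a shift factor, or stays
  -- in R, which multiplies the result by its power sum. Deciding this for the first part is the
  -- recursion that defines `dt`.
  Σ-splits : ∀ u v φ lam → Σ⟨ splits lam ⟩ (splitTerm u v φ) ≈ Dᵗ u v φ lam
  Σ-splits u v φ [] = trans (+-identityʳ _) (trans (*-identityˡ _) (reflexive (≡.cong (λ i → h (alK u) i φ) (ℤP.+-identityʳ v))))
  Σ-splits u v φ (x ∷ xs) = begin
    Σ⟨ splits (x ∷ xs) ⟩ (splitTerm u v φ)
      ≈⟨ Σ-concatMap (splitTerm u v φ) _ (splits xs) ⟩
    Σ⟨ splits xs ⟩ _
      ≈⟨ Σ-cong (splits xs) (λ { (S , R) → step S R }) ⟩
    Σ⟨ splits xs ⟩ (λ SR → splitTerm u v (φ ∘ insertP x) SR + shK u x * splitTerm u (v ℤ.+ + x) φ SR)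
      ≈⟨ Σ-+ _ _ (splits xs) ⟩
    Σ⟨ splits xs ⟩ (splitTerm u v (φ ∘ insertP x)) + Σ⟨ splits xs ⟩ (λ SR → shK u x * splitTerm u (v ℤ.+ + x) φ SR)
      ≈⟨ +-cong (Σ-splits u v (φ ∘ insertP x) xs) (trans (sym (*-Σ (shK u x) _ (splits xs))) (*-congˡ (Σ-splits u (v ℤ.+ + x) φ xs))) ⟩
    Dᵗ u v φ (x ∷ xs) ∎
    where
    open Solver
    step : ∀ S R → splitTerm u v φ (x ∷ S , R) + (splitTerm u v φ (S , x ∷ R) + 0#) ≈
                   splitTerm u v (φ ∘ insertP x) (S , R) + shK u x * splitTerm u (v ℤ.+ + x) φ (S , R)
    step S R = trans (+-congʳ (*-congˡ (reflexive (≡.cong (λ i → h (alK u) i (φ ∘ mergeP R)) (≡.sym (ℤP.+-assoc v (+ x) (+ sum S)))))))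
      (solve 4 (λ s P H T → s :* P :* H :+ (T :+ con (+ 0)) := T :+ s :* (P :* H)) refl _ _ _ _)

eval-D : ∀ u v F φ → eval (DF u v F) φ ≈ eval F (Dᵗ u v φ)
eval-D u v F φ = trans (Σ-concatMap _ _ F) (Σ-cong F λ { (c , lam) → term c lam })
  where
  term : ∀ c lam → Σ⟨ concatMap (λ SR → hPartF u (v ℤ.+ + sum (proj₁ SR)) (c * Π⟨ proj₁ SR ⟩ (shK u)) (proj₂ SR)) (splits lam) ⟩
                     (λ t → proj₁ t * φ (proj₂ t)) ≈ c * Dᵗ u v φ lam
  term c lam = trans (Σ-concatMap _ _ (splits lam)) (trans
    (Σ-cong (splits lam) (λ { (S , R) → trans (eval-hPart u (v ℤ.+ + sum S) (c * Π⟨ S ⟩ (shK u)) R φ) (*-assoc c _ _) }))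
    (trans (sym (*-Σ c _ (splits lam))) (*-congˡ (Σ-splits u v φ lam))))

-- The closed form of the operators Q.

d : ℕ → Frac
d u = 1# - qK (+ u)

eval-difference : ∀ F φ ψ {r χ} → (∀ μ → φ μ - ψ μ ≈ r * χ μ) → eval F φ - eval F ψ ≈ r * eval F χ
eval-difference F φ ψ {r} {χ} eq = begin
  eval F φ - eval F ψ                                              ≈⟨ +-congˡ (Σ-neg _ F) ⟨
  eval F φ + Σ⟨ F ⟩ (λ t → - (proj₁ t * ψ (proj₂ t)))              ≈⟨ Σ-+ _ _ F ⟨
  Σ⟨ F ⟩ (λ t → proj₁ t * φ (proj₂ t) - proj₁ t * ψ (proj₂ t))     ≈⟨ Σ-cong F (λ t → term (proj₁ t) (proj₂ t)) ⟩
  Σ⟨ F ⟩ (λ t → r * (proj₁ t * χ (proj₂ t)))                       ≈⟨ *-Σ r _ F ⟨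
  r * eval F χ                                                     ∎
  where
  term : ∀ c μ → c * φ μ - c * ψ μ ≈ r * (c * χ μ)
  term c μ = begin
    c * φ μ - c * ψ μ   ≈⟨ sub-* _ _ _ ⟩
    c * (φ μ - ψ μ)     ≈⟨ *-congˡ (eq μ) ⟩
    c * (r * χ μ)       ≈⟨ *-swap _ _ _ ⟩
    r * (c * χ μ)       ∎

regular-M : Regular Mlaur
regular-M = regular-* {1-q^ -1ℤ} {1-q^ 1ℤ}
  -- The factor 1 - 1/q of M divides 1 - q, with cofactor -q.
  (regular-factor {1-q^ -1ℤ} (negL (q^ 1ℤ)) {1-q^ 1ℤ} (KLaur.+-comm (mono -1ℤ 1ℤ) (constL 1ℤ)) (regular-1-q^ 0)) (regular-1-q^ 0)

invMF : Frac
invMF = frac (constL 1ℤ) Mlaur regular-M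

invM-d² : invMF * (d 1 * d 1) ≈ - qK 1ℤ
invM-d² = inverse-M invMF (qK 1ℤ) (qK -1ℤ) (ι Mlaur)
  (trans (ι-* (1-q^ -1ℤ) (1-q^ 1ℤ)) (*-cong (1-qK -1ℤ) (1-qK 1ℤ))) (x-inv 1ℤ) (frac-inv Mlaur regular-M)

-- op agrees with q^c [g]/[M] D_{M,N}, g = gcd M N, where [g]/[M] = (1-q^g)/(1-q^M).
-- (A Σ-type, because the positivity check of a record would unfold the field arithmetic.)
Closed : ℕ → ℕ → Op → Set
Closed M N op = Σ[ lift ∈ (SymF → SymF) ] Σ[ c ∈ ℤ ]
  (∀ F → strip (lift F) ≡ op (strip F)) ×
  + 2 ℤ.* c ≡ (+ M ℤ.- 1ℤ) ℤ.* (+ N ℤ.+ 1ℤ) ℤ.- (+ gcd M N ℤ.- 1ℤ) ×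
  (∀ F φ → eval (lift F) φ ≈ qK c * d (gcd M N) * inv1-q^ M * eval F (Dᵗ M (+ N) φ))

D-closed : ∀ N → Closed 1 N (D (+ 1) (+ N))
D-closed N = DF 1 (+ N) , 0ℤ , strip-D 1 (+ N) , ≡.cong (λ g → 0ℤ ℤ.- (+ g ℤ.- 1ℤ)) (≡.sym (gcd-zeroˡ N)) ,
  λ F φ → trans (eval-D 1 (+ N) F φ) (trans (sym (*-identityˡ _)) (*-congʳ (sym (scalar (gcd 1 N) (gcd-zeroˡ N)))))
  where
  scalar : ∀ g → g ≡ 1 → qK 0ℤ * d g * inv1-q^ 1 ≈ 1#
  scalar g ≡.refl = trans (*-congʳ (*-identityˡ (d 1))) (inv1-q^-inverse 0)

-- The determinant condition turns q^(Va) into q^(Ub) q^g, so the commutator contributes the power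
-- q^(Ub) and the numerator 1 - q^g. In the new exponent `c'` the summand 1 is the q of 1/M =
-- -q/(1-q)^2 and `s` is Ub. Substituting Va - Ub for g makes the formula for 2c a polynomial
-- identity.
comm-closed : ∀ {A B} u v a b → Closed (suc u) a A → Closed (suc v) b B →
  gcd (suc u) a ≡ 1 → gcd (suc v) b ≡ 1 →
  + suc v ℤ.* + a ≡ + suc u ℤ.* + b ℤ.+ + gcd (suc u ℕ.+ suc v) (a ℕ.+ b) →
  Closed (suc u ℕ.+ suc v) (a ℕ.+ b) (λ F → scaleS invM (comm A B F))
comm-closed {A} {B} u v a b (A' , cA , strip-A , cA-spec , eval-A) (B' , cB , strip-B , cB-spec , eval-B) gcdA gcdB det =
  (λ F → scaleF invMF (commF A' B' F)) , c' , strip-lift' , c-spec' , eval-lift'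
  where
  U = suc u
  V = suc v
  g = gcd (U ℕ.+ V) (a ℕ.+ b)
  s = + U ℤ.* + b
  c' = 1ℤ ℤ.+ cA ℤ.+ cB ℤ.+ s

  strip-lift' : ∀ F → strip (scaleF invMF (commF A' B' F)) ≡ scaleS invM (comm A B (strip F))
  strip-lift' F = ≡.trans (strip-scale invMF _) (≡.cong (scaleS invM) (≡.trans (LP.map-++ _ (A' (B' F)) _)
    (≡.cong₂ _++_ (≡.trans (strip-A (B' F)) (≡.cong A (strip-B F)))
      (≡.trans (strip-scale (- 1#) (B' (A' F))) (≡.cong negS (≡.trans (strip-B (A' F)) (≡.cong B (strip-A F))))))))

  c-spec' : + 2 ℤ.* c' ≡ (+ (U ℕ.+ V) ℤ.- 1ℤ) ℤ.* (+ (a ℕ.+ b) ℤ.+ 1ℤ) ℤ.- (+ g ℤ.- 1ℤ)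
  c-spec' = ≡.trans (split cA cB s)
    (≡.trans (≡.cong₂ (λ y z → + 2 ℤ.+ y ℤ.+ z ℤ.+ + 2 ℤ.* s)
        (≡.trans cA-spec (≡.cong (λ g → (+ U ℤ.- 1ℤ) ℤ.* (+ a ℤ.+ 1ℤ) ℤ.- (+ g ℤ.- 1ℤ)) gcdA))
        (≡.trans cB-spec (≡.cong (λ g → (+ V ℤ.- 1ℤ) ℤ.* (+ b ℤ.+ 1ℤ) ℤ.- (+ g ℤ.- 1ℤ)) gcdB)))
      (≡.trans (total (+ U) (+ V) (+ a) (+ b))
        (≡.cong (λ z → (+ U ℤ.+ + V ℤ.- 1ℤ) ℤ.* (+ a ℤ.+ + b ℤ.+ 1ℤ) ℤ.- (z ℤ.- 1ℤ)) g≡)))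
    where
    split : ∀ x y s → + 2 ℤ.* (1ℤ ℤ.+ x ℤ.+ y ℤ.+ s) ≡ + 2 ℤ.+ + 2 ℤ.* x ℤ.+ + 2 ℤ.* y ℤ.+ + 2 ℤ.* s
    split = solve-∀
    total : ∀ U V a b →
      + 2 ℤ.+ ((U ℤ.- 1ℤ) ℤ.* (a ℤ.+ 1ℤ) ℤ.- (1ℤ ℤ.- 1ℤ)) ℤ.+ ((V ℤ.- 1ℤ) ℤ.* (b ℤ.+ 1ℤ) ℤ.- (1ℤ ℤ.- 1ℤ)) ℤ.+ + 2 ℤ.* (U ℤ.* b) ≡
      (U ℤ.+ V ℤ.- 1ℤ) ℤ.* (a ℤ.+ b ℤ.+ 1ℤ) ℤ.- (V ℤ.* a ℤ.- U ℤ.* b ℤ.- 1ℤ)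
    total = solve-∀
    g≡ : + V ℤ.* + a ℤ.- + U ℤ.* + b ≡ + g
    g≡ = ≡.trans (≡.cong (λ z → z ℤ.- s) det) (lem s (+ g))
      where
      lem : ∀ s g → s ℤ.+ g ℤ.- s ≡ g
      lem = solve-∀

  kA kB : Frac
  kA = qK cA * d 1 * inv1-q^ U
  kB = qK cB * d 1 * inv1-q^ V

  evalA : ∀ F φ → eval (A' F) φ ≈ kA * eval F (Dᵗ U (+ a) φ)
  evalA F φ = trans (eval-A F φ) (*-congʳ (*-congʳ (*-congˡ (reflexive (≡.cong d gcdA)))))

  evalB : ∀ F φ → eval (B' F) φ ≈ kB * eval F (Dᵗ V (+ b) φ)
  evalB F φ = trans (eval-B F φ) (*-congʳ (*-congʳ (*-congˡ (reflexive (≡.cong d gcdB)))))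

  scalar : invMF * (kA * kB * (κ U V * (qK s - qK (+ V ℤ.* + a)))) ≈ qK c' * d g * inv1-q^ (U ℕ.+ V)
  scalar = begin
    invMF * (kA * kB * (κ U V * (qK s - qK (+ V ℤ.* + a))))
      ≈⟨ *-congˡ (*-congˡ (*-congˡ (+-congˡ (-‿cong (trans (x-cong det) (qK-+ s (+ g))))))) ⟩
    invMF * (q₁ * d 1 * eU * (q₂ * d 1 * eV) * (- (d U * d V * eM) * (qK s - qK s * qK (+ g))))
      ≈⟨ commutator-scalar invMF (d 1) (qK 1ℤ) q₁ q₂ (d U) eU (d V) eV eM (qK s) (qK (+ g))
           invM-d² (inv1-q^-inverse u) (inv1-q^-inverse v) ⟩
    qK 1ℤ * q₁ * q₂ * qK s * d g * eM
      ≈⟨ *-congʳ (*-congʳ (trans (*-congʳ (trans (*-congʳ (sym (qK-+ 1ℤ cA))) (sym (qK-+ (1ℤ ℤ.+ cA) cB))))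
           (sym (qK-+ (1ℤ ℤ.+ cA ℤ.+ cB) s)))) ⟩
    qK c' * d g * eM ∎
    where
    q₁ = qK cA
    q₂ = qK cB
    eU = inv1-q^ U
    eV = inv1-q^ V
    eM = inv1-q^ (U ℕ.+ V)

  eval-lift' : ∀ F φ → eval (scaleF invMF (commF A' B' F)) φ ≈
               qK c' * d g * inv1-q^ (U ℕ.+ V) * eval F (Dᵗ (U ℕ.+ V) (+ (a ℕ.+ b)) φ)
  eval-lift' F φ = begin
    eval (scaleF invMF (commF A' B' F)) φ
      ≈⟨ trans (eval-scale invMF (commF A' B' F) φ) (*-congˡ (eval-comm A' B' F φ)) ⟩
    invMF * (eval (A' (B' F)) φ - eval (B' (A' F)) φ)
      ≈⟨ *-congˡ (+-cong (trans (evalA (B' F) φ) (*-congˡ (evalB F (Dᵗ U (+ a) φ))))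
                         (-‿cong (trans (evalB (A' F) φ) (*-congˡ (evalA F (Dᵗ V (+ b) φ)))))) ⟩
    invMF * (kA * (kB * eval F (Dᵗ V (+ b) (Dᵗ U (+ a) φ))) - kB * (kA * eval F (Dᵗ U (+ a) (Dᵗ V (+ b) φ))))
      ≈⟨ pull-scalars invMF kA kB _ _ (κ U V * (qK s - qK (+ V ℤ.* + a))) E
           (eval-difference F _ _ (λ μ → commutator u v μ (+ a) (+ b) φ)) ⟩
    invMF * (kA * kB * (κ U V * (qK s - qK (+ V ℤ.* + a)))) * E
      ≈⟨ *-congʳ scalar ⟩
    qK c' * d g * inv1-q^ (U ℕ.+ V) * E ∎
    where
    E = eval F (Dᵗ (U ℕ.+ V) (+ (a ℕ.+ b)) φ)

-- The index N = 0 does occur, as in the splitting of (2, 1) into (1, 1) and (1, 0), but only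
-- together with M = 1: coprimality of M and 0 forces it.
QsF-closed : ∀ f M N → 1 ≤ M → M ≤ f → (2 ≤ M → 1 ≤ N) → Closed M N (QsF f M N)
QsF-closed (suc f) (suc zero)        N _ _ _ = D-closed N
QsF-closed (suc f) M@(suc (suc M-2)) N _ (s≤s M-1≤f) N≥1 =
  closed a b (splitting M N (s≤s (s≤s z≤n)) (N≥1 (s≤s (s≤s z≤n))))
  where
  m' = M div gcd M N
  n' = N div gcd M N
  a  = findA m' n'
  b  = ((n' ℕ.* a) ∸ 1) div m'

  nonzero : ∀ {x y} → gcd x y ≡ 1 → 2 ≤ x → 1 ≤ y
  nonzero {x} {zero}  eq 2≤x = contradiction (≡.trans (≡.sym (gcd-identityʳ x)) eq) (ℕP.>⇒≢ 2≤x)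
  nonzero {x} {suc y} eq _   = s≤s z≤n

  closed : ∀ a b → Splits M N a b → Closed M N (λ F → scaleS invM (comm (QsF f (M ∸ a) (N ∸ b)) (QsF f a b) F))
  closed a b sp = ≡.subst₂ (λ M N → Closed M N op) (ℕP.m∸n+n≡m (ℕP.<⇒≤ a<M)) (ℕP.m∸n+n≡m (ℕP.<⇒≤ b<N))
    (aux (M ∸ a) a (ℕP.m<n⇒0<n∸m a<M) 1≤a
      (QsF-closed f (M ∸ a) (N ∸ b) (ℕP.m<n⇒0<n∸m a<M)
        (ℕP.≤-trans (ℕP.≤-pred (ℕP.∸-monoʳ-< {M} {a} {0} 1≤a (ℕP.<⇒≤ a<M))) M-1≤f) (nonzero coprime₂))
      (QsF-closed f a b 1≤a (ℕP.≤-trans (ℕP.≤-pred a<M) M-1≤f) (nonzero coprime₁))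
      coprime₂ coprime₁ det')
    where
    open Splits sp
    op : Op
    op F = scaleS invM (comm (QsF f (M ∸ a) (N ∸ b)) (QsF f a b) F)
    aux : ∀ U V → 1 ≤ U → 1 ≤ V → Closed U (N ∸ b) (QsF f (M ∸ a) (N ∸ b)) → Closed V b (QsF f a b) →
          gcd U (N ∸ b) ≡ 1 → gcd V b ≡ 1 →
          + V ℤ.* + (N ∸ b) ≡ + U ℤ.* + b ℤ.+ + gcd (U ℕ.+ V) (N ∸ b ℕ.+ b) → Closed (U ℕ.+ V) (N ∸ b ℕ.+ b) op
    aux (suc u) (suc v) _ _ = comm-closed {QsF f (M ∸ a) (N ∸ b)} {QsF f a b} u v (N ∸ b) b
    det' : + a ℤ.* + (N ∸ b) ≡ + (M ∸ a) ℤ.* + b ℤ.+ + gcd (M ∸ a ℕ.+ a) (N ∸ b ℕ.+ b)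
    det' = ≡.trans (≡.sym (ℤP.pos-* a (N ∸ b))) (≡.trans (≡.cong +_ (det-shift sp))
      (≡.cong₂ ℤ._+_ (ℤP.pos-* (M ∸ a) b) (≡.cong +_ (≡.sym (≡.cong₂ gcd (ℕP.m∸n+n≡m (ℕP.<⇒≤ a<M)) (ℕP.m∸n+n≡m (ℕP.<⇒≤ b<N)))))))

-- Evaluation at a constant: from complete to elementary symmetric functions.

sgn : ℕ → Frac
sgn j = ι (constL (-1ℤ ℤ.^ j))

sgn-suc : ∀ j → sgn (suc j) ≈ - sgn j
sgn-suc j = trans (reflexive (≡.cong (λ z → ι (constL z)) (ℤP.-1*i≡-i (-1ℤ ℤ.^ j)))) (ι-neg (constL (-1ℤ ℤ.^ j)))

sgn-∸ : ∀ {l n} → l ≤ n → sgn n * sgn l ≈ sgn (n ∸ l)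
sgn-∸ {n = n} z≤n = *-identityʳ (sgn n)
sgn-∸ {suc l} {suc n} (s≤s l≤n) = trans (*-cong (sgn-suc n) (sgn-suc l)) (neg-cancel (sgn-∸ l≤n))

length≤sum : ∀ {μ} → All (1 ≤_) μ → length μ ≤ sum μ
length≤sum []       = z≤n
length≤sum (p ∷ ps) = ℕP.+-mono-≤ p (length≤sum ps)

qbrF : ℕ → ℕ → Frac
qbrF M i = ι (qbrPos M (+ i))

alK-reverse : ∀ U i → qK (+ U ℤ.* + i) * alK (suc U) i ≈ - qbrF (suc U) i
alK-reverse U i = trans (*-cong (x-cong (ℤP.*-comm (+ U) (+ i))) (alK-def (suc U) i))
  (trans (sym (-‿distribʳ-* _ _)) (-‿cong (trans (qsum-reverse U (+ i)) (sym (qbr-qsum (suc U) (+ i))))))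

-- Each part i contributes q^(Ui) and a sign, so the total power depends only on the size of μ and
-- can leave the sum over partitions, while the sign is that of the length. Together with the sign
-- of the constant this gives (-1)^n q^((m-1)n) h_n[-[m]_t X] = e_n[X[m]_q].
Π-reverse : ∀ U μ → qK (+ U ℤ.* + sum μ) * Π⟨ μ ⟩ (alK (suc U)) ≈ sgn (length μ) * Π⟨ μ ⟩ (qbrF (suc U))
Π-reverse U []      = *-congʳ (x-cong (ℤP.*-zeroʳ (+ U)))
Π-reverse U (i ∷ μ) = trans
  (*-congʳ (trans (x-cong (ℤP.*-distribˡ-+ (+ U) (+ i) (+ sum μ))) (qK-+ (+ U ℤ.* + i) (+ U ℤ.* + sum μ))))
  (trans (signed-step (alK-reverse U i) (Π-reverse U μ)) (*-congʳ (sym (sgn-suc (length μ)))))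

ι-injective : ∀ {p r} → ι p ≈ ι r → p ≅ r
ι-injective {p} {r} eq = KLaur.trans (KLaur.sym (KLaur.*-identityʳ p)) (KLaur.trans (uncross eq) (KLaur.*-identityʳ r))

qbr-closed : ∀ u → ι (1-q^ 1ℤ) * ι (qbrPos u 1ℤ) ≈ d u
qbr-closed u = trans (*-cong (1-qK 1ℤ) (qbr-qsum u 1ℤ)) (trans (qsum-closed u 1ℤ)
  (+-congˡ (-‿cong (x-cong (ℤP.*-identityˡ (+ u))))))

regular-qbr : ∀ u → Regular (qbrPos (suc u) 1ℤ)
regular-qbr u = regular-factor {qbrPos (suc u) 1ℤ} (1-q^ 1ℤ) {1-q^ (+ suc u)}
  (ι-injective (trans (ι-* (1-q^ 1ℤ) (qbrPos (suc u) 1ℤ)) (trans (qbr-closed (suc u)) (sym (1-qK (+ suc u))))))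
  (regular-1-q^ u)

-- The trivial factors reproduce the numerator and denominator that `_÷K_` computes, so that
-- forgetting regularity gives the prescribed scalar literally.
ratioF : ℕ → ℕ → Frac
num (ratioF k U)     = qbrPos k 1ℤ *L constL 1ℤ
den (ratioF k U)     = constL 1ℤ *L qbrPos (suc U) 1ℤ
regular (ratioF k U) = regular-* {constL 1ℤ} {qbrPos (suc U) 1ℤ} regular-1 (regular-qbr U)

ratioF-* : ∀ k U → ratioF k U * ι (qbrPos (suc U) 1ℤ) ≈ ι (qbrPos k 1ℤ)
ratioF-* k U = cross (Scalars.drop-units Laurᴿ (qbrPos k 1ℤ) (qbrPos (suc U) 1ℤ))

ratioF-d : ∀ k U → d k * inv1-q^ (suc U) ≈ ratioF k U
ratioF-d k U = quotient (ratioF-* k U) (qbr-closed k) (qbr-closed (suc U)) (inv1-q^-inverse U)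

half : ∀ Y x → + 2 ℤ.* Y ≡ + x → Y ≡ + (x div 2)
half (+ y) x eq = ≡.cong +_ (≡.trans (≡.sym (m*n/n≡m y 2)) (≡.cong (_div 2)
  (≡.trans (ℕP.*-comm y 2) (ℤP.+-injective (≡.trans (ℤP.pos-* 2 y) eq)))))
half -[1+ y ] x ()

-- The prescribed power is complementary to that of the closed form: half of (M-1)(N-1) + (k-1),
-- plus half of (M-1)(N+1) - (k-1), is (M-1)N, the power needed to pass from h to e. The integer c
-- also shows that the numerator is even, so `div` loses nothing.
exponent : ∀ U N k c → + 2 ℤ.* c ≡ (+ suc U ℤ.- 1ℤ) ℤ.* (+ suc N ℤ.+ 1ℤ) ℤ.- (+ suc k ℤ.- 1ℤ) →
           + ((U ℕ.* N ℕ.+ k) div 2) ℤ.+ c ≡ + U ℤ.* + suc N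
exponent U N k c eq = ≡.trans (≡.cong (λ z → z ℤ.+ c) (≡.sym (half (+ U ℤ.* + suc N ℤ.- c) (U ℕ.* N ℕ.+ k) twice))) (cancel (+ U ℤ.* + suc N) c)
  where
  cancel : ∀ x c → x ℤ.- c ℤ.+ c ≡ x
  cancel = solve-∀
  lem₁ : ∀ U N c → + 2 ℤ.* (U ℤ.* (1ℤ ℤ.+ N) ℤ.- c) ≡ + 2 ℤ.* (U ℤ.* (1ℤ ℤ.+ N)) ℤ.- + 2 ℤ.* c
  lem₁ = solve-∀
  lem₂ : ∀ U N k → + 2 ℤ.* (U ℤ.* (1ℤ ℤ.+ N)) ℤ.- (U ℤ.* (1ℤ ℤ.+ N ℤ.+ 1ℤ) ℤ.- k) ≡ U ℤ.* N ℤ.+ k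
  lem₂ = solve-∀
  twice : + 2 ℤ.* (+ U ℤ.* + suc N ℤ.- c) ≡ + (U ℕ.* N ℕ.+ k)
  twice = ≡.trans (lem₁ (+ U) (+ N) c) (≡.trans (≡.cong (λ z → + 2 ℤ.* (+ U ℤ.* + suc N) ℤ.- z) eq)
    (≡.trans (lem₂ (+ U) (+ N) (+ k)) (≡.cong (λ z → z ℤ.+ + k) (≡.sym (ℤP.pos-* U N)))))

eF : ℕ → (ℕ → Frac) → SymF
eF j a = map (λ mu → (sgn (j ∸ length mu) ⊗ invZ mu) ⊗ Π⟨ mu ⟩ a , mu) (partitions j)

strip-e : ∀ j M → strip (eF j (qbrF M)) ≡ ePl j (λ i → fromLaur (qbr (+ M) (+ i)))
strip-e j M = go (partitions j)
  where
  go : ∀ ps → strip (map (λ mu → (sgn (j ∸ length mu) ⊗ invZ mu) ⊗ Π⟨ mu ⟩ (qbrF M) , mu) ps) ≡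
              map (λ mu → (signK (j ∸ length mu) *K invZee mu) *K prodK (map (λ i → fromLaur (qbr (+ M) (+ i))) mu) , mu) ps
  go []        = ≡.refl
  go (mu ∷ ps) = ≡.cong₂ _∷_ (≡.cong (λ z → (signK (j ∸ length mu) *K invZee mu) *K z , mu) (Π-toK (qbrF M) (λ _ → ≡.refl) mu)) (go ps)

eval-e : ∀ U N φ → sgn N ⊗ qK (+ U ℤ.* + N) ⊗ h (alK (suc U)) (+ N) φ ≈ eval (eF N (qbrF (suc U))) φ
eval-e U N φ = trans (*-Σ (sgn N ⊗ qK (+ U ℤ.* + N)) (λ μ → invZ μ ⊗ Π⟨ μ ⟩ (alK (suc U)) ⊗ φ μ) (partitions N))
  (trans (Σ-congᴬ (All.map (λ {μ} → term μ) (partsB-bounded N N N))) (sym (reflexive (Σ-map _ _ (partitions N)))))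
  where
  term : ∀ μ → IsPart N N μ → sgn N ⊗ qK (+ U ℤ.* + N) ⊗ (invZ μ ⊗ Π⟨ μ ⟩ (alK (suc U)) ⊗ φ μ) ≈
         sgn (N ∸ length μ) ⊗ invZ μ ⊗ Π⟨ μ ⟩ (qbrF (suc U)) ⊗ φ μ
  term μ (pos , _ , ≡.refl) = weight (Π-reverse U μ) (sgn-∸ (length≤sum pos))

Qs-evaluation : ∀ M N k → 1 ≤ M → 1 ≤ N → gcd M N ≡ k → 1 ≤ k →
  scaleS (qpow (((M ∸ 1) ℕ.* (N ∸ 1) ℕ.+ (k ∸ 1)) div 2)) (Qs M N (constS (signK N))) ≈S
  scaleS (qint k ÷K qint M) (ePl N (λ i → fromLaur (qbr (+ M) (+ i))))
Qs-evaluation M@(suc U) N@(suc N-1) k@(suc k-1) 1≤M 1≤N gcd≡k _ =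
  aux (QsF-closed M M N 1≤M ℕP.≤-refl (λ _ → 1≤N))
  where
  e = (U ℕ.* N-1 ℕ.+ k-1) div 2
  one : SymF
  one = (sgn N , []) ∷ []

  aux : Closed M N (Qs M N) → scaleS (qpow e) (Qs M N (constS (signK N))) ≈S
        scaleS (qint k ÷K qint M) (ePl N (λ i → fromLaur (qbr (+ M) (+ i))))
  aux (lift , c , strip-lift , c-spec , eval-lift) =
    ≡.subst₂ _≈S_
      (≡.trans (strip-scale (qK (+ e)) (lift one)) (≡.cong (scaleS (qpow e)) (strip-lift one)))
      (≡.trans (strip-scale (ratioF k U) (eF N (qbrF M))) (≡.cong (scaleS (qint k ÷K qint M)) (strip-e N M)))
      (eval-coeff (scaleF (qK (+ e)) (lift one)) (scaleF (ratioF k U) (eF N (qbrF M))) λ φ →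
        trans (eval-scale (qK (+ e)) (lift one) φ) (trans (*-congˡ (trans (eval-lift one φ)
          (*-congʳ (*-congʳ (*-congˡ (reflexive (≡.cong d gcd≡k)))))))
        (trans (collect qE (ratioF-d k U) (eval-e U N φ)) (sym (eval-scale (ratioF k U) (eF N (qbrF M)) φ)))))
    where
    qE : qK (+ e) ⊗ qK c ≈ qK (+ U ℤ.* + N)
    qE = trans (sym (qK-+ (+ e) c)) (x-cong (exponent U N-1 k-1 c
      (≡.trans c-spec (≡.cong (λ g → (+ suc U ℤ.- 1ℤ) ℤ.* (+ suc N-1 ℤ.+ 1ℤ) ℤ.- (+ g ℤ.- 1ℤ)) gcd≡k))))

theoremI3 : (m n k : ℕ) → 1 ≤ m → 1 ≤ n → Coprime m n → 1 ≤ k →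
    lhsI3 m n k ≈S rhsI3 m n k
theoremI3 m n k 1≤m 1≤n coprime 1≤k = Qs-evaluation (k ℕ.* m) (k ℕ.* n) k (ℕP.*-mono-≤ 1≤k 1≤m) (ℕP.*-mono-≤ 1≤k 1≤n)
  (≡.trans (≡.sym (c*gcd[m,n]≡gcd[cm,cn] k m n)) (≡.trans (≡.cong (k ℕ.*_) (coprime⇒gcd≡1 coprime)) (ℕP.*-identityʳ k))) 1≤k
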